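{- Let $G=(V,E)$ be an $n$-vertex graph of maximum degree $\Delta\ge 3$ and treewidth $t\ge 1$. For any integer $q\ge \Delta+2$, the mixing time of the Glauber dynamics for sampling uniformly random proper $q$-colorings of $G$ is $n^{O(t\Delta)}$, where the constant in $O(\cdot)$ is absolute.
   Context: A proper $q$-coloring of $G$ is a map $\sigma:V\to\{1,\dots,q\}$ with $\sigma_u\ne\sigma_v$ for every edge $uv\in E$; the target distribution $\mu$ is uniform over proper $q$-colorings. The Glauber dynamics is the Markov chain which, in each step, picks a vertex $v\in V$ uniformly at random and resamples $\sigma_v$ from the conditional distribution of the spin at $v$ under $\mu$ given the current spins on $V\setminus\{v\}$ (i.e. uniformly among colors not used by neighbors of $v$). Its mixing time is the smallest $t$ such that, from every initial proper coloring, the distribution after $t$ steps is within total variation distance $1/4$ of $\mu$. -}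

module Defs where

open import Data.Nat as ℕ using (ℕ; zero; suc; _≤_; _+_; _∸_)
open import Data.Integer using (+_)
open import Data.Rational as ℚ using (ℚ; 0ℚ; 1ℚ; ∣_∣) renaming (_+_ to _+ℚ_; _*_ to _*ℚ_; _-_ to _-ℚ_; _/_ to _/ℚ_)
open import Data.Bool using (Bool; true; false; _∧_; _∨_; not; if_then_else_; T)
open import Data.Fin as Fin using (Fin; inject₁; fromℕ)
open import Data.Fin.Subset as Sub using (Subset)
open import Data.List as List using (List; []; _∷_; allFin; concatMap; foldr; map; filter; length)
open import Data.Vec as Vec using (Vec; lookup)
import Data.Vec as V
open import Data.Product using (Σ; ∃; ∃-syntax; _×_)
open import Data.Unit using (⊤)
open import Relation.Nullary using (¬_)
open import Relation.Nullary.Decidable using (⌊_⌋)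
open import Relation.Binary.PropositionalEquality using (_≡_)
open import Function.Definitions using (Injective)

record Graph (n : ℕ) : Set where
  field
    adj    : Fin n → Fin n → Bool
    sym    : ∀ u v → adj u v ≡ adj v u
    irrefl : ∀ v → adj v v ≡ false
open Graph public

allV : (n : ℕ) → (Fin n → Bool) → Bool
allV n p = foldr (λ v b → p v ∧ b) true (allFin n)

countV : (n : ℕ) → (Fin n → Bool) → ℕ
countV n p = length (filter (λ v → T? (p v)) (allFin n))
  where open import Data.Bool.Properties using () renaming (T? to T?)

degree : ∀ {n} → Graph n → Fin n → ℕ
degree {n} G v = countV n (adj G v)

MaxDegree : ∀ {n} → Graph n → ℕ → Set
MaxDegree {n} G Δ = (∀ v → degree G v ≤ Δ) × (∃[ v ] degree G v ≡ Δ)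

data Walk {n} (G : Graph n) (P : Fin n → Set) : Fin n → Fin n → Set where
  here : ∀ {u} → P u → Walk G P u u
  step : ∀ {u w v} → P u → T (adj G u w) → Walk G P w v → Walk G P u v

Connected : ∀ {n} → Graph n → Set
Connected G = ∀ u v → Walk G (λ _ → ⊤) u v

HasCycle : ∀ {n} → Graph n → Set
HasCycle {n} G =
  Σ ℕ λ k → Σ (Fin (suc (suc (suc k))) → Fin n) λ c →
    Injective _≡_ _≡_ c ×
    (∀ (i : Fin (suc (suc k))) → T (adj G (c (inject₁ i)) (c (Fin.suc i)))) ×
    T (adj G (c (fromℕ (suc (suc k)))) (c Fin.zero))

IsTree : ∀ {m} → Graph m → Set
IsTree {m} T' = (1 ≤ m) × Connected T' × ¬ HasCycle T'

record TreeDecomposition {n} (G : Graph n) : Set where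
  field
    m        : ℕ
    tree     : Graph m
    isTree   : IsTree tree
    bag      : Fin m → Subset n
    cover    : ∀ v → ∃[ i ] (v Sub.∈ bag i)
    edgeCov  : ∀ u v → T (adj G u v) → ∃[ i ] (u Sub.∈ bag i × v Sub.∈ bag i)
    coherent : ∀ v i j → v Sub.∈ bag i → v Sub.∈ bag j →
               Walk tree (λ k → v Sub.∈ bag k) i j
open TreeDecomposition public

-- all bags have size at most b  (i.e. width ≤ b - 1)
BagsAtMost : ∀ {n} {G : Graph n} → TreeDecomposition G → ℕ → Set
BagsAtMost D b = ∀ i → Sub.∣ bag D i ∣ ≤ b

-- treewidth of G is exactly t: some decomposition has width ≤ t,
-- and none has width ≤ t - 1 (all bags of size ≤ t)
Treewidth : ∀ {n} → Graph n → ℕ → Set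
Treewidth G t = (Σ (TreeDecomposition G) λ D → BagsAtMost D (suc t))
              × (∀ (D : TreeDecomposition G) → ¬ BagsAtMost D t)

Coloring : ℕ → ℕ → Set
Coloring n q = Vec (Fin q) n

allColorings : (n q : ℕ) → List (Coloring n q)
allColorings zero    q = V.[] ∷ []
allColorings (suc n) q = concatMap (λ c → map (c V.∷_) (allColorings n q)) (allFin q)

_==_ : ∀ {q} → Fin q → Fin q → Bool
a == b = ⌊ a Fin.≟ b ⌋

isProper : ∀ {n q} → Graph n → Coloring n q → Bool
isProper {n} G σ = allV n λ u → allV n λ v → not (adj G u v) ∨ not (lookup σ u == lookup σ v)

Proper : ∀ {n q} → Graph n → Coloring n q → Set
Proper G σ = T (isProper G σ)

sumℚ : List ℚ → ℚ
sumℚ = foldr _+ℚ_ 0ℚ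

-- 1/k, with the convention 1/0 = 0 (never used in the relevant cases)
inv : ℕ → ℚ
inv zero    = 0ℚ
inv (suc k) = + 1 /ℚ suc k

available : ∀ {n q} → Graph n → Coloring n q → Fin n → Fin q → Bool
available {n} G σ v c = allV n λ u → not (adj G v u) ∨ not (lookup σ u == c)

numAvailable : ∀ {n q} → Graph n → Coloring n q → Fin n → ℕ
numAvailable {q = q} G σ v = countV q (available G σ v)

agreeOff : ∀ {n q} → Fin n → Coloring n q → Coloring n q → Bool
agreeOff {n} v σ τ = allV n λ u → (u == v) ∨ (lookup σ u == lookup τ u)

-- Glauber transition probability P(σ, τ): pick v uniformly, resample σ_v
-- uniformly among colors not used by neighbours of v
transition : ∀ {n q} → Graph n → Coloring n q → Coloring n q → ℚ
transition {n} G σ τ =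
  sumℚ (map (λ v → if agreeOff v σ τ ∧ available G σ v (lookup τ v)
                   then inv n *ℚ inv (numAvailable G σ v)
                   else 0ℚ) (allFin n))

eqColoring : ∀ {n q} → Coloring n q → Coloring n q → Bool
eqColoring {n} σ τ = allV n λ u → lookup σ u == lookup τ u

distAfter : ∀ {n q} → Graph n → Coloring n q → ℕ → Coloring n q → ℚ
distAfter G σ₀ zero    τ = if eqColoring σ₀ τ then 1ℚ else 0ℚ
distAfter {n} {q} G σ₀ (suc s) τ =
  sumℚ (map (λ σ → distAfter G σ₀ s σ *ℚ transition G σ τ) (allColorings n q))

numProper : ∀ {n} → Graph n → (q : ℕ) → ℕ
numProper {n} G q = length (filter (λ σ → Data.Bool.Properties.T? (isProper G σ)) (allColorings n q))
  where import Data.Bool.Properties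

uniformProper : ∀ {n q} → Graph n → Coloring n q → ℚ
uniformProper {q = q} G τ = if isProper G τ then inv (numProper G q) else 0ℚ

tvDist : ∀ {n q} → Graph n → Coloring n q → ℕ → ℚ
tvDist {n} {q} G σ₀ s =
  (+ 1 /ℚ 2) *ℚ sumℚ (map (λ τ → ∣ distAfter G σ₀ s τ -ℚ uniformProper G τ ∣) (allColorings n q))

-- mixing time ≤ T : the smallest s such that from every proper initial
-- coloring the TV distance is ≤ 1/4 is at most T
MixingTimeAtMost : ∀ {n} → Graph n → (q : ℕ) → ℕ → Set
MixingTimeAtMost {n} G q T' =
  ∃[ s ] (s ≤ T' × ∀ (σ₀ : Coloring n q) → Proper G σ₀ → tvDist G σ₀ s ℚ.≤ (+ 1 /ℚ 4))

{-# OPTIONS --safe #-}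

-- Write D U f for the sum, over proper colourings, of the variance of f when the colours on U are
-- resampled and all others kept.  Two inequalities bound D V by the Dirichlet form ∑ᵥ D {v}:
-- if U is a union of two parts without edges between them then D U ≤ D U₁ + D U₂, and if v ∈ U
-- then D U ≤ 4^(Δ+1) (D (U ∖ v) + D {v}).  For the latter, 𝔼[f | colours outside U ∖ v] depends,
-- within U, only on the colour of v; given any colour at v, the neighbours of v jointly avoid
-- a prescribed colour with probability at least 2^(-Δ), because q ≥ Δ + 2 leaves each of them two
-- choices, and then v can be recoloured in a single step.  No factor depends on q.
-- Balanced separators of a tree decomposition of width t clear the graph in (t+1)(log₂ n + 1)
-- rounds of deletion, so the inverse spectral gap is n 4^((Δ+1)(t+1)(log₂ n + 1)) = n^O(tΔ).
-- The usual loss log(q^n) in passing to total variation is harmless when q ≤ Δ + 4Δ²; for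
-- larger q the Glauber dynamics contracts the Lipschitz constant of a function (Dobrushin).
module Submission where

open import Defs hiding (m; step; here; tree; isTree; bag; cover; edgeCov; coherent) renaming (sym to adj-sym)
open import Data.Bool using (Bool; true; false; _∧_; _∨_; not; if_then_else_; T)
open import Data.Bool.Properties using (T?; T-∧; T-∨; ∧-identityʳ; ∨-identityʳ; ∨-zeroʳ)
open import Data.Empty using (⊥; ⊥-elim)
open import Data.Fin as Fin using (Fin; inject₁; fromℕ; toℕ; fromℕ<)
import Data.Fin.Properties as Finₚ
open import Data.Fin.Subset as Sub using (Subset; inside; outside)
open import Data.Fin.Subset.Properties using (_∈?_)
import Data.Integer as ℤ
import Data.Integer.Properties as ℤₚ
open import Data.List using (List; []; _∷_; _++_; map; allFin; concatMap; filter; foldr; length)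
import Data.List as List
open import Data.List.Membership.Propositional using (_∈_)
open import Data.List.Membership.Propositional.Properties using (∈-map⁺; ∈-allFin; ∈-length; ∈-filter⁺; ∈-lookup)
open import Data.List.Properties using (map-tabulate; length-tabulate; length-map; length-++; length-filter; foldr-map)
open import Data.List.Relation.Unary.All as All using (All; []; _∷_)
import Data.List.Relation.Unary.All.Properties as Allₚ
open import Data.List.Relation.Unary.AllPairs using ([]; _∷_)
open import Data.List.Relation.Unary.Any using (here; there; any?)
open import Data.List.Relation.Unary.Unique.Propositional using (Unique)
open import Data.List.Relation.Unary.Unique.Propositional.Properties using (allFin⁺)
open import Data.Nat as ℕ using (ℕ; zero; suc)
import Data.Nat.Coprimality as Cop
open import Data.Nat.Induction using (<-wellFounded)
import Data.Nat.Properties as ℕₚ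
open import Data.Nat.Tactic.RingSolver using () renaming (solve-∀ to ℕ-solve-∀)
open import Data.Product using (Σ; ∃; ∃-syntax; _×_; _,_; proj₁; proj₂)
import Data.Rational as ℚ
import Data.Rational.Properties as ℚₚ
open import Data.Sum using (_⊎_; inj₁; inj₂; [_,_]′)
open import Data.Unit using (⊤; tt)
open import Data.Vec as V using (lookup; _[_]≔_; here; there)
open import Data.Vec.Properties using (lookup∘tabulate; lookup∘update; lookup∘update′; []≔-lookup; []≔-idempotent; []≔-commutes; ∷-injectiveˡ; ∷-injectiveʳ)
open import Function using (_∘_; id; Equivalence)
open import Induction.WellFounded using (Acc; acc)
open import Relation.Binary.PropositionalEquality using (_≡_; _≢_; refl; sym; cong; cong₂; trans; subst; subst₂; module ≡-Reasoning)
open import Relation.Nullary using (¬_; Dec; yes; no)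
open import Relation.Nullary.Decidable using (⌊_⌋; toWitness; fromWitness; dec⇒maybe; _×-dec_)
open import Tactic.RingSolver using (solve-∀)
open import Tactic.RingSolver.Core.AlmostCommutativeRing using (AlmostCommutativeRing; fromCommutativeRing)

-- Everything stays in ℚ, without roots, logarithms or eigenvalues: contraction by 1 - 1/M is stated
-- as `ι (suc j) * x ≤ ι j * y` with M = `suc j`, and iterates are compared with powers of 2. The
-- obstacle to deleting `v` is that two colourings that agree outside `U` may give `v` colours
-- between which no single move exists, because a neighbour holds the wanted colour. A neighbour
-- inside `U` can be resampled without changing the conditional expectation; one outside `U` never
-- holds that colour, since the target colouring is proper with the same surroundings. This costs
-- 2^Δ. A second 2^Δ pays for replacing the conditional law of the colour at `v` by the choice made
-- in a single move: with d = q - Δ, the law gives no colour more than 1/d, the move gives each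
-- available colour at least 1/q, and q/d ≤ 2^Δ. The last factor 4 comes from returning from the
-- conditional expectation to f. Testing against signs turns distances of distributions into values
-- of functions, so both regimes study only the operator on functions. The threshold 4Δ² for d makes
-- the direct contraction 1 - 1/(2n).

T-iff : ∀ {a b} → (T a → T b) → (T b → T a) → a ≡ b
T-iff {true}  {true}  _ _ = refl
T-iff {true}  {false} f _ = ⊥-elim (f _)
T-iff {false} {true}  _ g = ⊥-elim (g _)
T-iff {false} {false} _ _ = refl

T⇒≡ : ∀ {b} → T b → b ≡ true
T⇒≡ {true} _ = refl

≡⇒T : ∀ {b} → b ≡ true → T b
≡⇒T refl = _

¬T⇒≡ : ∀ {b} → ¬ T b → b ≡ false
¬T⇒≡ {true}  f = ⊥-elim (f _)
¬T⇒≡ {false} _ = refl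

∧⁺ : ∀ {a b} → T a → T b → T (a ∧ b)
∧⁺ {true} {true} _ _ = _

∧⁻ : ∀ {a b} → T (a ∧ b) → T a × T b
∧⁻ {true} {true} _ = _ , _

allFin-suc : ∀ n → allFin (suc n) ≡ Fin.zero ∷ map Fin.suc (allFin n)
allFin-suc n = cong (Fin.zero ∷_) (sym (map-tabulate id Fin.suc))

allV-suc : ∀ n (p : Fin (suc n) → Bool) → allV (suc n) p ≡ p Fin.zero ∧ allV n (p ∘ Fin.suc)
allV-suc n p = trans (cong (foldr (λ v b → p v ∧ b) true) (allFin-suc n))
                     (cong (p Fin.zero ∧_) (foldr-map _ Fin.suc true (allFin n)))

allV⁺ : ∀ n {p : Fin n → Bool} → (∀ v → T (p v)) → T (allV n p)
allV⁺ zero    h = _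
allV⁺ (suc n) {p} h = subst T (sym (allV-suc n p)) (Equivalence.from (T-∧ {p Fin.zero} {allV n (p ∘ Fin.suc)}) (h Fin.zero , allV⁺ n {p ∘ Fin.suc} (h ∘ Fin.suc)))

allV⁻ : ∀ n {p : Fin n → Bool} → T (allV n p) → ∀ v → T (p v)
allV⁻ (suc n) {p} t v with Equivalence.to (T-∧ {p Fin.zero} {allV n (p ∘ Fin.suc)}) (subst T (allV-suc n p) t)
allV⁻ (suc n) t Fin.zero    | a , b = a
allV⁻ (suc n) {p} t (Fin.suc v) | a , b = allV⁻ n {p ∘ Fin.suc} b v

==⁺ : ∀ {q} {a b : Fin q} → a ≡ b → T (a == b)
==⁺ = fromWitness

==⁻ : ∀ {q} {a b : Fin q} → T (a == b) → a ≡ b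
==⁻ = toWitness

T-not⁺ : ∀ {b} → ¬ T b → T (not b)
T-not⁺ {true}  f = f _
T-not⁺ {false} f = _

T-not⁻ : ∀ {b} → T (not b) → ¬ T b
T-not⁻ {false} _ ()

⇒⁺ : ∀ {a b} → (T a → ¬ T b) → T (not a ∨ not b)
⇒⁺ {true}  f = T-not⁺ (f _)
⇒⁺ {false} f = _

⇒⁻ : ∀ {a b} → T (not a ∨ not b) → T a → ¬ T b
⇒⁻ {true} t _ = T-not⁻ t

n<2^n : ∀ n → n ℕ.< 2 ℕ.^ n
n<2^n zero    = ℕ.s≤s ℕ.z≤n
n<2^n (suc n) = ℕₚ.+-mono-≤ (ℕₚ.m^n>0 2 n) (ℕₚ.≤-trans (n<2^n n) (ℕₚ.m≤m+n (2 ℕ.^ n) 0))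

-- U is cleared by k rounds, each deleting one vertex from every part, parts without
-- edges between them being treated in parallel.
data Elim {n : ℕ} (G : Graph n) : (Fin n → Bool) → ℕ → Set where
  empty  : ∀ {U k} → (∀ u → U u ≡ false) → Elim G U k
  weaken : ∀ {U k} → Elim G U k → Elim G U (suc k)
  remove : ∀ {U k} v → U v ≡ true → Elim G (λ u → U u ∧ not (u == v)) k → Elim G U (suc k)
  split  : ∀ {U k} U₁ U₂ → (∀ u → U u ≡ U₁ u ∨ U₂ u) → (∀ u → U₁ u ≡ true → U₂ u ≡ false) →
           (∀ u v → U₁ u ≡ true → U₂ v ≡ true → ¬ T (adj G u v)) →
           Elim G U₁ k → Elim G U₂ k → Elim G U k

module Analysis where

  open import Data.Rational using (ℚ; 0ℚ; 1ℚ; _+_; _*_; _-_; -_; _≤_; _<_; ∣_∣; mkℚ; nonNegative; positive; ≢-nonZero)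
  open import Data.Rational.Properties
  open import Data.Rational.Unnormalised using (*≡*)
  import Data.Rational.Unnormalised.Properties as ℚᵘₚ

  -- Arithmetic and order in ℚ.

  ℚ-ring : AlmostCommutativeRing _ _
  ℚ-ring = fromCommutativeRing +-*-commutativeRing λ x → dec⇒maybe (0ℚ ≟ x)

  *-leftComm : ∀ a b c → a * (b * c) ≡ b * (a * c)
  *-leftComm = solve-∀ ℚ-ring

  *-distribˡ-minus : ∀ a b c → a * (b - c) ≡ a * b - a * c
  *-distribˡ-minus = solve-∀ ℚ-ring

  a-[a-b] : ∀ a b → b ≡ a - (a - b)
  a-[a-b] = solve-∀ ℚ-ring

  2ℚ : ℚ
  2ℚ = 1ℚ + 1ℚ

  diff⇒≤ : ∀ {a b} → 0ℚ ≤ b - a → a ≤ b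
  diff⇒≤ {a} {b} p = subst (_≤ b) (+-identityˡ a) (subst ((0ℚ + a) ≤_) (eq a b) (+-monoˡ-≤ a p))
    where
    eq : ∀ a b → b - a + a ≡ b
    eq = solve-∀ ℚ-ring

  ≤⇒diff : ∀ {a b} → a ≤ b → 0ℚ ≤ b - a
  ≤⇒diff {a} {b} p = subst (_≤ b - a) (+-inverseʳ a) (+-monoˡ-≤ (- a) p)

  *-monoʳ : ∀ {c a b} → 0ℚ ≤ c → a ≤ b → c * a ≤ c * b
  *-monoʳ {c} 0≤c p = *-monoˡ-≤-nonNeg c {{nonNegative 0≤c}} p

  *-monoˡ : ∀ {c a b} → 0ℚ ≤ c → a ≤ b → a * c ≤ b * c
  *-monoˡ {c} 0≤c p = *-monoʳ-≤-nonNeg c {{nonNegative 0≤c}} p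

  *-nonneg : ∀ {a b} → 0ℚ ≤ a → 0ℚ ≤ b → 0ℚ ≤ a * b
  *-nonneg {a} {b} 0≤a 0≤b = subst (_≤ a * b) (*-zeroʳ a) (*-monoʳ 0≤a 0≤b)

  +-nonneg : ∀ {a b} → 0ℚ ≤ a → 0ℚ ≤ b → 0ℚ ≤ a + b
  +-nonneg = +-mono-≤

  0≤1 : 0ℚ ≤ 1ℚ
  0≤1 = nonNegative⁻¹ 1ℚ

  0≤2 : 0ℚ ≤ 2ℚ
  0≤2 = nonNegative⁻¹ 2ℚ

  sq-nonneg : ∀ x → 0ℚ ≤ x * x
  sq-nonneg x with ≤-total 0ℚ x
  ... | inj₁ p = *-nonneg p p
  ... | inj₂ p = subst (0ℚ ≤_) (eq x) (*-nonneg q q)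
    where
    q : 0ℚ ≤ - x
    q = neg-antimono-≤ p
    eq : ∀ x → (- x) * (- x) ≡ x * x
    eq = solve-∀ ℚ-ring

  ≤∣∣ : ∀ x → x ≤ ∣ x ∣
  ≤∣∣ x with ≤-total 0ℚ x
  ... | inj₁ p = ≤-reflexive (sym (0≤p⇒∣p∣≡p p))
  ... | inj₂ p = ≤-trans p (0≤∣p∣ x)

  -- Total, with value 0 at 0: `E` below divides by `Z`, which can vanish at improper colourings.
  recip : ℚ → ℚ
  recip x with x ≟ 0ℚ
  ... | yes _ = 0ℚ
  ... | no ≢0 = (ℚ.1/ x) {{≢-nonZero ≢0}}

  recip-inverseˡ : ∀ {x} → x ≢ 0ℚ → recip x * x ≡ 1ℚ
  recip-inverseˡ {x} x≢0 with x ≟ 0ℚ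
  ... | yes p = ⊥-elim (x≢0 p)
  ... | no ≢0 = *-inverseˡ x {{≢-nonZero ≢0}}

  recip-unique : ∀ {x y} → y * x ≡ 1ℚ → y ≡ recip x
  recip-unique {x} {y} e = begin
    y  ≡⟨ *-identityʳ y ⟨
    y * 1ℚ  ≡⟨ cong (y *_) (recip-inverseˡ x≢0) ⟨
    y * (recip x * x)  ≡⟨ eq y (recip x) x ⟩
    y * x * recip x  ≡⟨ cong (_* recip x) e ⟩
    1ℚ * recip x  ≡⟨ *-identityˡ (recip x) ⟩
    recip x  ∎
    where
    open ≡-Reasoning
    x≢0 : x ≢ 0ℚ
    x≢0 refl = 1≢0 (sym (trans (sym (*-zeroʳ y)) e))
    eq : ∀ a b c → a * (b * c) ≡ a * c * b
    eq = solve-∀ ℚ-ring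

  recip-nonneg : ∀ {x} → 0ℚ ≤ x → 0ℚ ≤ recip x
  recip-nonneg {x} 0≤x = [ id , negative (x ≟ 0ℚ) ]′ (≤-total 0ℚ (recip x))
    where
    negative : Dec (x ≡ 0ℚ) → recip x ≤ 0ℚ → 0ℚ ≤ recip x
    negative (yes refl) _ = ≤-refl
    negative (no x≢0)   p = ⊥-elim (<-irrefl refl (<-≤-trans (positive⁻¹ 1ℚ)
      (subst (1ℚ ≤_) (*-zeroˡ x) (subst (_≤ 0ℚ * x) (recip-inverseˡ x≢0) (*-monoˡ 0≤x p)))))

  ≥1⇒≢0 : ∀ {x} → 1ℚ ≤ x → x ≢ 0ℚ
  ≥1⇒≢0 1≤x refl with ≤⇒≤ᵇ 1≤x
  ... | ()

  pos-cancel : ∀ {c a b} → 0ℚ < c → c * a ≤ c * b → a ≤ b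
  pos-cancel {c} p = *-cancelˡ-≤-pos c {{positive p}}

  -- Unary recursion instead of a normalised fraction: literals such as `ι 4` unfold to sums of
  -- `1ℚ`, the shape in which the ring identities below are stated.
  ι : ℕ → ℚ
  ι zero    = 0ℚ
  ι (suc n) = 1ℚ + ι n

  ι-nonneg : ∀ n → 0ℚ ≤ ι n
  ι-nonneg zero    = ≤-refl
  ι-nonneg (suc n) = +-nonneg 0≤1 (ι-nonneg n)

  ι-+ : ∀ m n → ι (m ℕ.+ n) ≡ ι m + ι n
  ι-+ zero    n = sym (+-identityˡ (ι n))
  ι-+ (suc m) n = trans (cong (1ℚ +_) (ι-+ m n)) (sym (+-assoc 1ℚ (ι m) (ι n)))

  ι-* : ∀ m n → ι (m ℕ.* n) ≡ ι m * ι n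
  ι-* zero    n = sym (*-zeroˡ (ι n))
  ι-* (suc m) n = trans (ι-+ n (m ℕ.* n)) (trans (cong (ι n +_) (ι-* m n)) (eq (ι n) (ι m)))
    where
    eq : ∀ a b → a + b * a ≡ (1ℚ + b) * a
    eq = solve-∀ ℚ-ring

  ι-mono : ∀ {m n} → m ℕ.≤ n → ι m ≤ ι n
  ι-mono {n = n} ℕ.z≤n = ι-nonneg n
  ι-mono (ℕ.s≤s p) = +-monoʳ-≤ 1ℚ (ι-mono p)

  ι-pos : ∀ {n} → 1 ℕ.≤ n → 0ℚ < ι n
  ι-pos p = <-≤-trans (positive⁻¹ 1ℚ) (ι-mono p)

  ι≢0 : ∀ {n} → 1 ℕ.≤ n → ι n ≢ 0ℚ
  ι≢0 p e = <-irrefl (sym e) (ι-pos p)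

  ι-mkℚ : ∀ n → ι n ≡ mkℚ (ℤ.+ n) 0 (Cop.sym (Cop.1-coprimeTo n))
  ι-mkℚ zero    = refl
  ι-mkℚ (suc n) = trans (cong (1ℚ +_) (ι-mkℚ n))
    (toℚᵘ-injective (ℚᵘₚ.≃-trans (toℚᵘ-homo-+ 1ℚ (mkℚ (ℤ.+ n) 0 (Cop.sym (Cop.1-coprimeTo n)))) (*≡* (cong (λ x → (ℤ.+ 1 ℤ.+ x) ℤ.* ℤ.+ 1) (ℤₚ.*-identityʳ (ℤ.+ n))))))

  inv-ι : ∀ {n} → 1 ℕ.≤ n → inv n * ι n ≡ 1ℚ
  inv-ι {suc k} _ = begin
    inv (suc k) * ι (suc k)  ≡⟨ cong₂ _*_ (normalize-coprime (Cop.1-coprimeTo (suc k))) (ι-mkℚ (suc k)) ⟩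
    mkℚ (ℤ.+ 1) k (Cop.1-coprimeTo (suc k)) * mkℚ (ℤ.+ suc k) 0 (Cop.sym (Cop.1-coprimeTo (suc k))) ≡⟨ *-inverseˡ (mkℚ (ℤ.+ suc k) 0 (Cop.sym (Cop.1-coprimeTo (suc k)))) ⟩
    1ℚ  ∎
    where open ≡-Reasoning

  inv≡recip : ∀ {n} → 1 ℕ.≤ n → inv n ≡ recip (ι n)
  inv≡recip p = recip-unique (inv-ι p)

  inv-nonneg : ∀ n → 0ℚ ≤ inv n
  inv-nonneg zero    = ≤-refl
  inv-nonneg (suc n) = subst (0ℚ ≤_) (sym (inv≡recip {suc n} (ℕ.s≤s ℕ.z≤n))) (recip-nonneg (ι-nonneg (suc n)))

  -- Indicators and finite sums.

  𝟙 : Bool → ℚ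
  𝟙 true  = 1ℚ
  𝟙 false = 0ℚ

  𝟙-nonneg : ∀ b → 0ℚ ≤ 𝟙 b
  𝟙-nonneg true  = 0≤1
  𝟙-nonneg false = ≤-refl

  𝟙≤1 : ∀ b → 𝟙 b ≤ 1ℚ
  𝟙≤1 true  = ≤-refl
  𝟙≤1 false = 0≤1

  𝟙-∧ : ∀ a b → 𝟙 (a ∧ b) ≡ 𝟙 a * 𝟙 b
  𝟙-∧ true  b = sym (*-identityˡ (𝟙 b))
  𝟙-∧ false b = sym (*-zeroˡ (𝟙 b))

  if-𝟙 : ∀ b x → (if b then x else 0ℚ) ≡ 𝟙 b * x
  if-𝟙 true  x = sym (*-identityˡ x)
  if-𝟙 false x = sym (*-zeroˡ x)

  𝟙-true : ∀ {b} → T b → 𝟙 b ≡ 1ℚ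
  𝟙-true {true} _ = refl

  𝟙-false : ∀ {b} → ¬ T b → 𝟙 b ≡ 0ℚ
  𝟙-false {true}  p = ⊥-elim (p _)
  𝟙-false {false} _ = refl

  𝟙-under : ∀ b {x y} → (T b → x ≡ y) → 𝟙 b * x ≡ 𝟙 b * y
  𝟙-under true  f = cong (1ℚ *_) (f _)
  𝟙-under false {x} {y} f = trans (*-zeroˡ x) (sym (*-zeroˡ y))

  𝟙-under-≤ : ∀ b {x y} → (T b → x ≤ y) → 𝟙 b * x ≤ 𝟙 b * y
  𝟙-under-≤ true  f = *-monoʳ 0≤1 (f _)
  𝟙-under-≤ false {x} {y} f = ≤-reflexive (trans (*-zeroˡ x) (sym (*-zeroˡ y)))

  module _ {A : Set} where

    ∑ : List A → (A → ℚ) → ℚ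
    ∑ xs f = sumℚ (map f xs)

    ∑-cong : ∀ xs {f g : A → ℚ} → (∀ x → f x ≡ g x) → ∑ xs f ≡ ∑ xs g
    ∑-cong []       e = refl
    ∑-cong (x ∷ xs) e = cong₂ _+_ (e x) (∑-cong xs e)

    ∑-mono : ∀ xs {f g : A → ℚ} → (∀ x → f x ≤ g x) → ∑ xs f ≤ ∑ xs g
    ∑-mono []       e = ≤-refl
    ∑-mono (x ∷ xs) e = +-mono-≤ (e x) (∑-mono xs e)

    ∑-0 : ∀ xs → ∑ xs (λ _ → 0ℚ) ≡ 0ℚ
    ∑-0 []       = refl
    ∑-0 (x ∷ xs) = trans (+-identityˡ _) (∑-0 xs)

    ∑-nonneg : ∀ xs {f : A → ℚ} → (∀ x → 0ℚ ≤ f x) → 0ℚ ≤ ∑ xs f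
    ∑-nonneg xs {f} p = subst (_≤ ∑ xs f) (∑-0 xs) (∑-mono xs p)

    ∑-+ : ∀ xs (f g : A → ℚ) → ∑ xs (λ x → f x + g x) ≡ ∑ xs f + ∑ xs g
    ∑-+ []       f g = refl
    ∑-+ (x ∷ xs) f g = trans (cong (f x + g x +_) (∑-+ xs f g)) (eq (f x) (g x) (∑ xs f) (∑ xs g))
      where
      eq : ∀ a b c d → a + b + (c + d) ≡ a + c + (b + d)
      eq = solve-∀ ℚ-ring

    ∑-* : ∀ xs c (f : A → ℚ) → ∑ xs (λ x → c * f x) ≡ c * ∑ xs f
    ∑-* []       c f = sym (*-zeroʳ c)
    ∑-* (x ∷ xs) c f = trans (cong (c * f x +_) (∑-* xs c f)) (sym (*-distribˡ-+ c (f x) (∑ xs f)))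

    ∑-*ʳ : ∀ xs c (f : A → ℚ) → ∑ xs (λ x → f x * c) ≡ ∑ xs f * c
    ∑-*ʳ xs c f = trans (∑-cong xs (λ x → *-comm (f x) c)) (trans (∑-* xs c f) (*-comm c (∑ xs f)))

    ∑-neg : ∀ xs (f : A → ℚ) → ∑ xs (λ x → - f x) ≡ - ∑ xs f
    ∑-neg []       f = refl
    ∑-neg (x ∷ xs) f = trans (cong (- f x +_) (∑-neg xs f)) (sym (neg-distrib-+ (f x) (∑ xs f)))

    ∑-minus : ∀ xs (f g : A → ℚ) → ∑ xs (λ x → f x - g x) ≡ ∑ xs f - ∑ xs g
    ∑-minus xs f g = trans (∑-+ xs f (λ x → - g x)) (cong (∑ xs f +_) (∑-neg xs g))

    ∑-++ : ∀ xs ys (f : A → ℚ) → ∑ (xs ++ ys) f ≡ ∑ xs f + ∑ ys f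
    ∑-++ []       ys f = sym (+-identityˡ _)
    ∑-++ (x ∷ xs) ys f = trans (cong (f x +_) (∑-++ xs ys f)) (sym (+-assoc (f x) (∑ xs f) (∑ ys f)))

    ∑-const : ∀ xs c → ∑ xs (λ _ → c) ≡ ι (length xs) * c
    ∑-const []       c = sym (*-zeroˡ c)
    ∑-const (x ∷ xs) c = trans (cong (c +_) (∑-const xs c)) (eq c (ι (length xs)))
      where
      eq : ∀ c n → c + n * c ≡ (1ℚ + n) * c
      eq = solve-∀ ℚ-ring

    ∑-abs : ∀ xs (f : A → ℚ) → ∣ ∑ xs f ∣ ≤ ∑ xs (λ x → ∣ f x ∣)
    ∑-abs []       f = ≤-refl
    ∑-abs (x ∷ xs) f = ≤-trans (∣p+q∣≤∣p∣+∣q∣ (f x) (∑ xs f)) (+-monoʳ-≤ ∣ f x ∣ (∑-abs xs f))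

    ∑-filter : ∀ (p : A → Bool) xs → ι (length (filter (λ x → T? (p x)) xs)) ≡ ∑ xs (λ x → 𝟙 (p x))
    ∑-filter p []       = refl
    ∑-filter p (x ∷ xs) with p x
    ... | true  = cong (1ℚ +_) (∑-filter p xs)
    ... | false = trans (∑-filter p xs) (sym (+-identityˡ _))

  ∑-map : ∀ {A B : Set} (h : A → B) xs (f : B → ℚ) → ∑ (map h xs) f ≡ ∑ xs (f ∘ h)
  ∑-map h []       f = refl
  ∑-map h (x ∷ xs) f = cong (f (h x) +_) (∑-map h xs f)

  ∑-concatMap : ∀ {A B : Set} (h : A → List B) xs (f : B → ℚ) → ∑ (concatMap h xs) f ≡ ∑ xs (λ x → ∑ (h x) f)
  ∑-concatMap h []       f = refl
  ∑-concatMap h (x ∷ xs) f = trans (∑-++ (h x) (concatMap h xs) f) (cong (∑ (h x) f +_) (∑-concatMap h xs f))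

  ∑-swap : ∀ {A B : Set} (xs : List A) (ys : List B) (f : A → B → ℚ) →
           ∑ xs (λ x → ∑ ys (f x)) ≡ ∑ ys (λ y → ∑ xs (λ x → f x y))
  ∑-swap []       ys f = sym (∑-0 ys)
  ∑-swap (x ∷ xs) ys f = trans (cong (∑ ys (f x) +_) (∑-swap xs ys f)) (sym (∑-+ ys (f x) (λ y → ∑ xs (λ x → f x y))))

  ∑ᶠ : ∀ n → (Fin n → ℚ) → ℚ
  ∑ᶠ n f = ∑ (allFin n) f

  ∑ᶠ-suc : ∀ n f → ∑ᶠ (suc n) f ≡ f Fin.zero + ∑ᶠ n (f ∘ Fin.suc)
  ∑ᶠ-suc n f = trans (cong (λ xs → ∑ xs f) (allFin-suc n)) (cong (f Fin.zero +_) (∑-map Fin.suc (allFin n) f))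

  ∑ᶠ-single : ∀ {n} {f : Fin n → ℚ} c → (∀ d → d ≢ c → f d ≡ 0ℚ) → ∑ᶠ n f ≡ f c
  ∑ᶠ-single {suc n} {f} Fin.zero h = begin
    ∑ᶠ (suc n) f  ≡⟨ ∑ᶠ-suc n f ⟩
    f Fin.zero + ∑ᶠ n (f ∘ Fin.suc)  ≡⟨ cong (f Fin.zero +_) (∑-cong (allFin n) (λ d → h (Fin.suc d) λ ())) ⟩
    f Fin.zero + ∑ᶠ n (λ _ → 0ℚ)  ≡⟨ cong (f Fin.zero +_) (∑-0 (allFin n)) ⟩
    f Fin.zero + 0ℚ  ≡⟨ +-identityʳ _ ⟩
    f Fin.zero  ∎
    where open ≡-Reasoning
  ∑ᶠ-single {suc n} {f} (Fin.suc c) h = begin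
    ∑ᶠ (suc n) f  ≡⟨ ∑ᶠ-suc n f ⟩
    f Fin.zero + ∑ᶠ n (f ∘ Fin.suc)  ≡⟨ cong₂ _+_ (h Fin.zero λ ()) (∑ᶠ-single c (λ d d≢c → h (Fin.suc d) (d≢c ∘ Finₚ.suc-injective))) ⟩
    0ℚ + f (Fin.suc c)  ≡⟨ +-identityˡ _ ⟩
    f (Fin.suc c)  ∎
    where open ≡-Reasoning

  term≤∑ᶠ : ∀ {n} {f : Fin n → ℚ} → (∀ d → 0ℚ ≤ f d) → ∀ c → f c ≤ ∑ᶠ n f
  term≤∑ᶠ {suc n} {f} h Fin.zero = subst (f Fin.zero ≤_) (sym (∑ᶠ-suc n f))
    (subst (_≤ f Fin.zero + ∑ᶠ n (f ∘ Fin.suc)) (+-identityʳ (f Fin.zero)) (+-monoʳ-≤ (f Fin.zero) (∑-nonneg (allFin n) (h ∘ Fin.suc))))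
  term≤∑ᶠ {suc n} {f} h (Fin.suc c) = subst (f (Fin.suc c) ≤_) (sym (∑ᶠ-suc n f))
    (subst (_≤ f Fin.zero + ∑ᶠ n (f ∘ Fin.suc)) (+-identityˡ (f (Fin.suc c))) (+-mono-≤ (h Fin.zero) (term≤∑ᶠ (h ∘ Fin.suc) c)))

  ∑ᶠ-const : ∀ n c → ∑ᶠ n (λ _ → c) ≡ ι n * c
  ∑ᶠ-const n c = trans (∑-const (allFin n) c) (cong (λ k → ι k * c) (length-tabulate {n = n} id))

  ι-countV : ∀ n p → ι (countV n p) ≡ ∑ᶠ n (λ v → 𝟙 (p v))
  ι-countV n p = ∑-filter p (allFin n)

  -- Sums over all colourings, proper or not.

  ∑ᶜ : ∀ n q → (Coloring n q → ℚ) → ℚ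
  ∑ᶜ n q F = ∑ (allColorings n q) F

  ∑ᶜ-suc : ∀ n q F → ∑ᶜ (suc n) q F ≡ ∑ᶠ q (λ c → ∑ᶜ n q (λ σ → F (c V.∷ σ)))
  ∑ᶜ-suc n q F = trans (∑-concatMap (λ c → map (c V.∷_) (allColorings n q)) (allFin q) F)
                       (∑-cong (allFin q) (λ c → ∑-map (c V.∷_) (allColorings n q) F))

  lookup-ext : ∀ {A : Set} {n} {σ τ : V.Vec A n} → (∀ u → lookup σ u ≡ lookup τ u) → σ ≡ τ
  lookup-ext {σ = V.[]}    {V.[]}    h = refl
  lookup-ext {σ = x V.∷ σ} {y V.∷ τ} h = cong₂ V._∷_ (h Fin.zero) (lookup-ext (h ∘ Fin.suc))

  ∑ᶜ-single : ∀ {n q} {F : Coloring n q → ℚ} σ → (∀ τ → τ ≢ σ → F τ ≡ 0ℚ) → ∑ᶜ n q F ≡ F σ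
  ∑ᶜ-single {zero}  V.[] h = +-identityʳ _
  ∑ᶜ-single {suc n} {q} {F} (c V.∷ σ) h = begin
    ∑ᶜ (suc n) q F  ≡⟨ ∑ᶜ-suc n q F ⟩
    ∑ᶠ q (λ d → ∑ᶜ n q (λ τ → F (d V.∷ τ)))  ≡⟨ ∑ᶠ-single c (λ d d≢c → trans (∑-cong (allColorings n q) (λ τ → h (d V.∷ τ) (d≢c ∘ ∷-injectiveˡ))) (∑-0 (allColorings n q))) ⟩
    ∑ᶜ n q (λ τ → F (c V.∷ τ))  ≡⟨ ∑ᶜ-single σ (λ τ τ≢σ → h (c V.∷ τ) (τ≢σ ∘ ∷-injectiveʳ)) ⟩
    F (c V.∷ σ)  ∎
    where open ≡-Reasoning

  -- The hypothesis says that `F` is supported on the colourings that differ from `σ` at most at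
  -- `v`; these are listed by the colour of `v`.
  ∑ᶜ-recolour : ∀ {n q} {F : Coloring n q → ℚ} v σ → (∀ τ → τ ≢ σ [ v ]≔ lookup τ v → F τ ≡ 0ℚ) →
                ∑ᶜ n q F ≡ ∑ᶠ q (λ c → F (σ [ v ]≔ c))
  ∑ᶜ-recolour {suc n} {q} {F} Fin.zero (c V.∷ σ) h = trans (∑ᶜ-suc n q F)
    (∑-cong (allFin q) (λ d → ∑ᶜ-single σ (λ τ τ≢σ → h (d V.∷ τ) (τ≢σ ∘ ∷-injectiveʳ))))
  ∑ᶜ-recolour {suc n} {q} {F} (Fin.suc v) (c V.∷ σ) h = begin
    ∑ᶜ (suc n) q F  ≡⟨ ∑ᶜ-suc n q F ⟩
    ∑ᶠ q (λ d → ∑ᶜ n q (λ τ → F (d V.∷ τ)))  ≡⟨ ∑ᶠ-single c (λ d d≢c → trans (∑-cong (allColorings n q) (λ τ → h (d V.∷ τ) (d≢c ∘ ∷-injectiveˡ))) (∑-0 (allColorings n q))) ⟩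
    ∑ᶜ n q (λ τ → F (c V.∷ τ))  ≡⟨ ∑ᶜ-recolour v σ (λ τ τ≢ → h (c V.∷ τ) (τ≢ ∘ ∷-injectiveʳ)) ⟩
    ∑ᶠ q (λ d → F (c V.∷ (σ [ v ]≔ d)))  ∎
    where open ≡-Reasoning

  term≤∑ᶜ : ∀ {n q} {F : Coloring n q → ℚ} → (∀ τ → 0ℚ ≤ F τ) → ∀ σ → F σ ≤ ∑ᶜ n q F
  term≤∑ᶜ {zero}  {F = F} h V.[] = ≤-reflexive (sym (+-identityʳ (F V.[])))
  term≤∑ᶜ {suc n} {q} {F} h (c V.∷ σ) = ≤-trans (term≤∑ᶜ (λ τ → h (c V.∷ τ)) σ)
    (≤-trans (term≤∑ᶠ (λ d → ∑-nonneg (allColorings n q) (λ τ → h (d V.∷ τ))) c) (≤-reflexive (sym (∑ᶜ-suc n q F))))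

  ∣C∣ : ℕ → ℕ → ℚ
  ∣C∣ n q = ∑ᶜ n q (λ _ → 1ℚ)

  ∑ᶜ-const : ∀ n q c → ∑ᶜ n q (λ _ → c) ≡ ∣C∣ n q * c
  ∑ᶜ-const n q c = trans (∑-cong (allColorings n q) (λ _ → sym (*-identityˡ c))) (∑-*ʳ (allColorings n q) c (λ _ → 1ℚ))

  ∣C∣≡ : ∀ n q → ∣C∣ n q ≡ ι (q ℕ.^ n)
  ∣C∣≡ zero    q = refl
  ∣C∣≡ (suc n) q = begin
    ∣C∣ (suc n) q  ≡⟨ ∑ᶜ-suc n q (λ _ → 1ℚ) ⟩
    ∑ᶠ q (λ _ → ∣C∣ n q)  ≡⟨ ∑ᶠ-const q (∣C∣ n q) ⟩
    ι q * ∣C∣ n q  ≡⟨ cong (ι q *_) (∣C∣≡ n q) ⟩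
    ι q * ι (q ℕ.^ n)  ≡⟨ ι-* q (q ℕ.^ n) ⟨
    ι (q ℕ.^ suc n)  ∎
    where open ≡-Reasoning

  -- Each colouring arises `q` times as `σ [ v ]≔ c`, once for every colour that `σ` may have had at
  -- `v`.
  ∑ᶜ-resample : ∀ {n q} (F : Coloring n q → ℚ) v →
                ∑ᶜ n q (λ σ → ∑ᶠ q (λ c → F (σ [ v ]≔ c))) ≡ ι q * ∑ᶜ n q F
  ∑ᶜ-resample {suc n} {q} F Fin.zero = begin
    ∑ᶜ (suc n) q (λ σ → ∑ᶠ q (λ c → F (σ [ Fin.zero ]≔ c)))  ≡⟨ ∑ᶜ-suc n q (λ σ → ∑ᶠ q (λ c → F (σ [ Fin.zero ]≔ c))) ⟩
    ∑ᶠ q (λ _ → ∑ᶜ n q (λ σ → ∑ᶠ q (λ c → F (c V.∷ σ))))  ≡⟨ ∑ᶠ-const q _ ⟩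
    ι q * ∑ᶜ n q (λ σ → ∑ᶠ q (λ c → F (c V.∷ σ)))  ≡⟨ cong (ι q *_) (∑-swap (allColorings n q) (allFin q) (λ σ c → F (c V.∷ σ))) ⟩
    ι q * ∑ᶠ q (λ c → ∑ᶜ n q (λ σ → F (c V.∷ σ)))  ≡⟨ cong (ι q *_) (∑ᶜ-suc n q F) ⟨
    ι q * ∑ᶜ (suc n) q F  ∎
    where open ≡-Reasoning
  ∑ᶜ-resample {suc n} {q} F (Fin.suc v) = begin
    ∑ᶜ (suc n) q (λ σ → ∑ᶠ q (λ c → F (σ [ Fin.suc v ]≔ c)))  ≡⟨ ∑ᶜ-suc n q (λ σ → ∑ᶠ q (λ c → F (σ [ Fin.suc v ]≔ c))) ⟩
    ∑ᶠ q (λ d → ∑ᶜ n q (λ σ → ∑ᶠ q (λ c → F (d V.∷ (σ [ v ]≔ c))))) ≡⟨ ∑-cong (allFin q) (λ d → ∑ᶜ-resample (λ σ → F (d V.∷ σ)) v) ⟩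
    ∑ᶠ q (λ d → ι q * ∑ᶜ n q (λ σ → F (d V.∷ σ)))  ≡⟨ ∑-* (allFin q) (ι q) _ ⟩
    ι q * ∑ᶠ q (λ d → ∑ᶜ n q (λ σ → F (d V.∷ σ)))  ≡⟨ cong (ι q *_) (∑ᶜ-suc n q F) ⟨
    ι q * ∑ᶜ (suc n) q F  ∎
    where open ≡-Reasoning

  -- Resampling a set of vertices.

  mrg : ∀ {n q} → (Fin n → Bool) → Coloring n q → Coloring n q → Coloring n q
  mrg U σ τ = V.tabulate (λ u → if U u then lookup τ u else lookup σ u)

  lookup-mrg : ∀ {n q} (U : Fin n → Bool) (σ τ : Coloring n q) u →
               lookup (mrg U σ τ) u ≡ (if U u then lookup τ u else lookup σ u)
  lookup-mrg U σ τ u = lookup∘tabulate _ u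

  lookup-mrg-on : ∀ {n q} (U : Fin n → Bool) (σ τ : Coloring n q) {u} → U u ≡ true → lookup (mrg U σ τ) u ≡ lookup τ u
  lookup-mrg-on U σ τ {u} e = trans (lookup-mrg U σ τ u) (cong (λ b → if b then lookup τ u else lookup σ u) e)

  lookup-mrg-off : ∀ {n q} (U : Fin n → Bool) (σ τ : Coloring n q) {u} → U u ≡ false → lookup (mrg U σ τ) u ≡ lookup σ u
  lookup-mrg-off U σ τ {u} e = trans (lookup-mrg U σ τ u) (cong (λ b → if b then lookup τ u else lookup σ u) e)

  mrg-unique : ∀ {n q} (U : Fin n → Bool) (σ τ ρ : Coloring n q) →
               (∀ u → U u ≡ true → lookup τ u ≡ lookup ρ u) → (∀ u → U u ≡ false → lookup σ u ≡ lookup ρ u) → mrg U σ τ ≡ ρ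
  mrg-unique U σ τ ρ on off = lookup-ext λ u → trans (lookup-mrg U σ τ u) (go u (U u) refl)
    where
    go : ∀ u b → U u ≡ b → (if b then lookup τ u else lookup σ u) ≡ lookup ρ u
    go u true  e = on u e
    go u false e = off u e

  mrg-cross : ∀ {n q} (U : Fin n → Bool) (σ τ : Coloring n q) → mrg U (mrg U σ τ) (mrg U τ σ) ≡ σ
  mrg-cross U σ τ = mrg-unique U (mrg U σ τ) (mrg U τ σ) σ (λ u e → lookup-mrg-on U τ σ e) (λ u e → lookup-mrg-off U σ τ e)

  mrg-idem : ∀ {n q} (U : Fin n → Bool) (σ : Coloring n q) → mrg U σ σ ≡ σ
  mrg-idem U σ = mrg-unique U σ σ σ (λ _ _ → refl) (λ _ _ → refl)

  -- Swapping the restrictions of `σ` and `τ` to `U` is an involution on pairs of colourings. This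
  -- symmetry is the source of reversibility. In the induction a vertex of `U` interchanges the two
  -- sums over head colours.
  ∑ᶜ-exchange : ∀ {n q} (U : Fin n → Bool) (F : Coloring n q → Coloring n q → ℚ) →
                ∑ᶜ n q (λ σ → ∑ᶜ n q (λ τ → F (mrg U σ τ) (mrg U τ σ))) ≡ ∑ᶜ n q (λ σ → ∑ᶜ n q (F σ))
  ∑ᶜ-exchange {zero}  U F = refl
  ∑ᶜ-exchange {suc n} {q} U F = begin
    ∑ᶜ (suc n) q (λ σ → ∑ᶜ (suc n) q (λ τ → F (mrg U σ τ) (mrg U τ σ)))
      ≡⟨ unfold (λ σ τ → F (mrg U σ τ) (mrg U τ σ)) ⟩
    ∑ᶠ q (λ c → ∑ᶠ q (λ d → ∑ᶜ n q (λ σ → ∑ᶜ n q (λ τ → F (mrg U (c V.∷ σ) (d V.∷ τ)) (mrg U (d V.∷ τ) (c V.∷ σ))))))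
      ≡⟨ heads (U Fin.zero) refl ⟩
    ∑ᶠ q (λ c → ∑ᶠ q (λ d → ∑ᶜ n q (λ σ → ∑ᶜ n q (λ τ → F (c V.∷ mrg U′ σ τ) (d V.∷ mrg U′ τ σ)))))
      ≡⟨ ∑-cong (allFin q) (λ c → ∑-cong (allFin q) (λ d → ∑ᶜ-exchange U′ (λ σ τ → F (c V.∷ σ) (d V.∷ τ)))) ⟩
    ∑ᶠ q (λ c → ∑ᶠ q (λ d → ∑ᶜ n q (λ σ → ∑ᶜ n q (λ τ → F (c V.∷ σ) (d V.∷ τ)))))
      ≡⟨ unfold F ⟨
    ∑ᶜ (suc n) q (λ σ → ∑ᶜ (suc n) q (F σ)) ∎
    where
    open ≡-Reasoning
    U′ = U ∘ Fin.suc
    unfold : ∀ (H : Coloring (suc n) q → Coloring (suc n) q → ℚ) →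
            ∑ᶜ (suc n) q (λ σ → ∑ᶜ (suc n) q (H σ)) ≡
            ∑ᶠ q (λ c → ∑ᶠ q (λ d → ∑ᶜ n q (λ σ → ∑ᶜ n q (λ τ → H (c V.∷ σ) (d V.∷ τ)))))
    unfold H = trans (∑ᶜ-suc n q (λ σ → ∑ᶜ (suc n) q (H σ)))
      (∑-cong (allFin q) (λ c → trans (∑-cong (allColorings n q) (λ σ → ∑ᶜ-suc n q (H (c V.∷ σ))))
        (∑-swap (allColorings n q) (allFin q) (λ σ d → ∑ᶜ n q (λ τ → H (c V.∷ σ) (d V.∷ τ))))))
    heads : ∀ b → U Fin.zero ≡ b →
      ∑ᶠ q (λ c → ∑ᶠ q (λ d → ∑ᶜ n q (λ σ → ∑ᶜ n q (λ τ → F (mrg U (c V.∷ σ) (d V.∷ τ)) (mrg U (d V.∷ τ) (c V.∷ σ))))))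
      ≡ ∑ᶠ q (λ c → ∑ᶠ q (λ d → ∑ᶜ n q (λ σ → ∑ᶜ n q (λ τ → F (c V.∷ mrg U′ σ τ) (d V.∷ mrg U′ τ σ)))))
    heads b e rewrite e = byCase b
      where
      byCase : ∀ b →
        ∑ᶠ q (λ c → ∑ᶠ q (λ d → ∑ᶜ n q (λ σ → ∑ᶜ n q (λ τ → F ((if b then d else c) V.∷ mrg U′ σ τ) ((if b then c else d) V.∷ mrg U′ τ σ)))))
        ≡ ∑ᶠ q (λ c → ∑ᶠ q (λ d → ∑ᶜ n q (λ σ → ∑ᶜ n q (λ τ → F (c V.∷ mrg U′ σ τ) (d V.∷ mrg U′ τ σ)))))
      byCase true  = ∑-swap (allFin q) (allFin q) (λ c d → ∑ᶜ n q (λ σ → ∑ᶜ n q (λ τ → F (d V.∷ mrg U′ σ τ) (c V.∷ mrg U′ τ σ))))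
      byCase false = refl

  ∑ᶜ-resampleSet : ∀ {n q} (U : Fin n → Bool) (F : Coloring n q → ℚ) →
                   ∑ᶜ n q (λ σ → ∑ᶜ n q (λ τ → F (mrg U σ τ))) ≡ ∣C∣ n q * ∑ᶜ n q F
  ∑ᶜ-resampleSet {n} {q} U F = begin
    ∑ᶜ n q (λ σ → ∑ᶜ n q (λ τ → F (mrg U σ τ)))  ≡⟨ ∑ᶜ-exchange U (λ σ _ → F σ) ⟩
    ∑ᶜ n q (λ σ → ∑ᶜ n q (λ _ → F σ))  ≡⟨ ∑-cong (allColorings n q) (λ σ → ∑ᶜ-const n q (F σ)) ⟩
    ∑ᶜ n q (λ σ → ∣C∣ n q * F σ)  ≡⟨ ∑-* (allColorings n q) (∣C∣ n q) F ⟩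
    ∣C∣ n q * ∑ᶜ n q F  ∎
    where open ≡-Reasoning

  -- The colour of `v` in a uniformly random colouring is uniform; denominators are cleared.
  ∑ᶜ-marginal : ∀ {n q} (H : Fin q → ℚ) (v : Fin n) → ι q * ∑ᶜ n q (λ τ → H (lookup τ v)) ≡ ∣C∣ n q * ∑ᶠ q H
  ∑ᶜ-marginal {n} {q} H v = begin
    ι q * ∑ᶜ n q (λ τ → H (lookup τ v))  ≡⟨ ∑ᶜ-resample (λ τ → H (lookup τ v)) v ⟨
    ∑ᶜ n q (λ τ → ∑ᶠ q (λ c → H (lookup (τ [ v ]≔ c) v)))  ≡⟨ ∑-cong (allColorings n q) (λ τ → ∑-cong (allFin q) (λ c → cong H (lookup∘update v τ c))) ⟩
    ∑ᶜ n q (λ τ → ∑ᶠ q H)  ≡⟨ ∑ᶜ-const n q (∑ᶠ q H) ⟩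
    ∣C∣ n q * ∑ᶠ q H  ∎
    where
    open ≡-Reasoning

  -- Conditional expectation and variance over proper colourings.

  module Averages {n : ℕ} (q : ℕ) (G : Graph n) where

    Col : Set
    Col = Coloring n q

    Fn : Set
    Fn = Col → ℚ

    S : Fn → ℚ
    S = ∑ᶜ n q

    cs = allColorings n q

    IsP : Col → Set
    IsP σ = ∀ u v → T (adj G u v) → lookup σ u ≢ lookup σ v

    proper⁻ : ∀ {σ} → Proper G σ → IsP σ
    proper⁻ {σ} p u v uv e = ⇒⁻ (allV⁻ n {λ v → not (adj G u v) ∨ not (lookup σ u == lookup σ v)} (allV⁻ n p u) v) uv (==⁺ e)

    proper⁺ : ∀ {σ} → IsP σ → Proper G σ
    proper⁺ {σ} p = allV⁺ n λ u → allV⁺ n {λ v → not (adj G u v) ∨ not (lookup σ u == lookup σ v)} λ v → ⇒⁺ (λ uv e → p u v uv (==⁻ e))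

    w : Fn
    w σ = 𝟙 (isProper G σ)

    w-nonneg : ∀ σ → 0ℚ ≤ w σ
    w-nonneg σ = 𝟙-nonneg (isProper G σ)

    w-proper : ∀ σ → Proper G σ → w σ ≡ 1ℚ
    w-proper σ = 𝟙-true {isProper G σ}

    w-iff : ∀ {σ τ} → (IsP σ → IsP τ) → (IsP τ → IsP σ) → w σ ≡ w τ
    w-iff {σ} {τ} f g = cong 𝟙 (T-iff (proper⁺ {τ} ∘ f ∘ proper⁻ {σ}) (proper⁺ {σ} ∘ g ∘ proper⁻ {τ}))

    w-absorb : ∀ {σ τ} → (IsP τ → IsP σ) → w σ * w τ ≡ w τ
    w-absorb {σ} {τ} f = trans (*-comm (w σ) (w τ)) (trans (𝟙-under (isProper G τ) {w σ} {1ℚ} (λ p → w-proper σ (proper⁺ {σ} (f (proper⁻ {τ} p))))) (*-identityʳ (w τ)))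

    infix 8 ⟪_,_⟫
    infixl 6 _⊕_ _⊖_

    -- The inner product of L²(μ) without division by the number of proper colourings; the
    -- inequalities below are homogeneous.
    ⟪_,_⟫ : Fn → Fn → ℚ
    ⟪ f , g ⟫ = S (λ σ → w σ * (f σ * g σ))

    _⊕_ _⊖_ : Fn → Fn → Fn
    (f ⊕ g) σ = f σ + g σ
    (f ⊖ g) σ = f σ - g σ

    ⟪⟫-cong : ∀ f f′ g g′ → (∀ σ → Proper G σ → f σ ≡ f′ σ) → (∀ σ → Proper G σ → g σ ≡ g′ σ) → ⟪ f , g ⟫ ≡ ⟪ f′ , g′ ⟫
    ⟪⟫-cong f f′ g g′ e e′ = ∑-cong cs λ σ → 𝟙-under (isProper G σ) λ p → cong₂ _*_ (e σ p) (e′ σ p)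

    ⟪⟫-congʳ : ∀ f g g′ → (∀ σ → Proper G σ → g σ ≡ g′ σ) → ⟪ f , g ⟫ ≡ ⟪ f , g′ ⟫
    ⟪⟫-congʳ f g g′ = ⟪⟫-cong f f g g′ (λ _ _ → refl)

    ⟪⟫-comm : ∀ f g → ⟪ f , g ⟫ ≡ ⟪ g , f ⟫
    ⟪⟫-comm f g = ∑-cong cs λ σ → cong (w σ *_) (*-comm (f σ) (g σ))

    ⟪⟫-nonneg : ∀ f → 0ℚ ≤ ⟪ f , f ⟫
    ⟪⟫-nonneg f = ∑-nonneg cs λ σ → *-nonneg (w-nonneg σ) (sq-nonneg (f σ))

    ⟪⟫-⊕ʳ : ∀ h f g → ⟪ h , f ⊕ g ⟫ ≡ ⟪ h , f ⟫ + ⟪ h , g ⟫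
    ⟪⟫-⊕ʳ h f g = trans (∑-cong cs λ σ → eq (w σ) (h σ) (f σ) (g σ)) (∑-+ cs _ _)
      where
      eq : ∀ w h f g → w * (h * (f + g)) ≡ w * (h * f) + w * (h * g)
      eq = solve-∀ ℚ-ring

    ⟪⟫-⊖ʳ : ∀ h f g → ⟪ h , f ⊖ g ⟫ ≡ ⟪ h , f ⟫ - ⟪ h , g ⟫
    ⟪⟫-⊖ʳ h f g = trans (∑-cong cs λ σ → eq (w σ) (h σ) (f σ) (g σ)) (∑-minus cs _ _)
      where
      eq : ∀ w h f g → w * (h * (f - g)) ≡ w * (h * f) - w * (h * g)
      eq = solve-∀ ℚ-ring

    ⟪⟫-⊕ˡ : ∀ f g h → ⟪ f ⊕ g , h ⟫ ≡ ⟪ f , h ⟫ + ⟪ g , h ⟫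
    ⟪⟫-⊕ˡ f g h = trans (⟪⟫-comm (f ⊕ g) h) (trans (⟪⟫-⊕ʳ h f g) (cong₂ _+_ (⟪⟫-comm h f) (⟪⟫-comm h g)))

    ⟪⟫-⊖ˡ : ∀ f g h → ⟪ f ⊖ g , h ⟫ ≡ ⟪ f , h ⟫ - ⟪ g , h ⟫
    ⟪⟫-⊖ˡ f g h = trans (⟪⟫-comm (f ⊖ g) h) (trans (⟪⟫-⊖ʳ h f g) (cong₂ _-_ (⟪⟫-comm h f) (⟪⟫-comm h g)))

    ⟪⟫-⊖² : ∀ f g → ⟪ f ⊖ g , f ⊖ g ⟫ ≡ ⟪ f , f ⟫ - 2ℚ * ⟪ f , g ⟫ + ⟪ g , g ⟫
    ⟪⟫-⊖² f g = trans (⟪⟫-⊖ˡ f g (f ⊖ g)) (trans (cong₂ _-_ (⟪⟫-⊖ʳ f f g) (trans (⟪⟫-⊖ʳ g f g) (cong (_- ⟪ g , g ⟫) (⟪⟫-comm g f)))) (eq ⟪ f , f ⟫ ⟪ f , g ⟫ ⟪ g , g ⟫))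
      where
      eq : ∀ a b c → a - b - (b - c) ≡ a - (1ℚ + 1ℚ) * b + c
      eq = solve-∀ ℚ-ring

    VSet : Set
    VSet = Fin n → Bool

    _⊆_ : VSet → VSet → Set
    U′ ⊆ U = ∀ u → U′ u ≡ true → U u ≡ true

    ⊆-off : ∀ {U′ U : VSet} → U′ ⊆ U → ∀ u → U u ≡ false → U′ u ≡ false
    ⊆-off {U′} {U} s u e = go (U′ u) refl
      where
      go : ∀ b → U′ u ≡ b → U′ u ≡ false
      go false p = p
      go true  p with () ← trans (sym (s u p)) e

    Z : VSet → Fn
    Z U σ = S λ τ → w (mrg U σ τ)

    A : VSet → Fn → Fn
    A U f σ = S λ τ → w (mrg U σ τ) * f (mrg U σ τ)

    -- The sums run over colourings τ of all vertices although only τ on U matters; the resulting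
    -- factor q^(n - ∣U∣) is common to A and Z and cancels.
    E : VSet → Fn → Fn
    E U f σ = recip (Z U σ) * A U f σ

    Z-nonneg : ∀ U σ → 0ℚ ≤ Z U σ
    Z-nonneg U σ = ∑-nonneg cs λ τ → w-nonneg (mrg U σ τ)

    mrg-⊆ : ∀ {U′ U : VSet} → U′ ⊆ U → ∀ (σ τ ρ : Col) → mrg U (mrg U′ σ τ) ρ ≡ mrg U σ ρ
    mrg-⊆ {U′} {U} s σ τ ρ = mrg-unique U (mrg U′ σ τ) ρ (mrg U σ ρ) (λ u e → sym (lookup-mrg-on U σ ρ e))
      (λ u e → trans (lookup-mrg-off U′ σ τ (⊆-off s u e)) (sym (lookup-mrg-off U σ ρ e)))

    Z-inv : ∀ {U′ U} → U′ ⊆ U → ∀ σ τ → Z U (mrg U′ σ τ) ≡ Z U σ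
    Z-inv s σ τ = ∑-cong cs λ ρ → cong w (mrg-⊆ s σ τ ρ)

    E-inv : ∀ {U′ U} → U′ ⊆ U → ∀ f σ τ → E U f (mrg U′ σ τ) ≡ E U f σ
    E-inv s f σ τ = cong₂ (λ a b → recip a * b) (Z-inv s σ τ) (∑-cong cs λ ρ → cong (λ x → w x * f x) (mrg-⊆ s σ τ ρ))

    ⊆-refl : ∀ {U} → U ⊆ U
    ⊆-refl u e = e

    Z≢0 : ∀ U σ → Proper G σ → Z U σ ≢ 0ℚ
    Z≢0 U σ p = ≥1⇒≢0 (subst (_≤ Z U σ) (trans (cong w (mrg-idem U σ)) (w-proper σ p))
      (term≤∑ᶜ (λ τ → w-nonneg (mrg U σ τ)) σ))

    E-fix : ∀ U h σ → Proper G σ → (∀ τ → h (mrg U σ τ) ≡ h σ) → E U h σ ≡ h σ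
    E-fix U h σ p inv = begin
      recip (Z U σ) * A U h σ  ≡⟨ cong (recip (Z U σ) *_) (trans (∑-cong cs λ τ → cong (w (mrg U σ τ) *_) (inv τ)) (∑-*ʳ cs (h σ) (λ τ → w (mrg U σ τ)))) ⟩
      recip (Z U σ) * (Z U σ * h σ)  ≡⟨ *-assoc (recip (Z U σ)) (Z U σ) (h σ) ⟨
      recip (Z U σ) * Z U σ * h σ  ≡⟨ cong (_* h σ) (recip-inverseˡ (Z≢0 U σ p)) ⟩
      1ℚ * h σ  ≡⟨ *-identityˡ (h σ) ⟩
      h σ  ∎
      where open ≡-Reasoning

    ⟪⟫-E : ∀ U h f → ⟪ h , E U f ⟫ ≡ S (λ σ → S (λ τ → w σ * w (mrg U σ τ) * recip (Z U σ) * (h σ * f (mrg U σ τ))))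
    ⟪⟫-E U h f = ∑-cong cs λ σ → begin
      w σ * (h σ * (recip (Z U σ) * A U f σ))  ≡⟨ eq (w σ) (h σ) (recip (Z U σ)) (A U f σ) ⟩
      (w σ * h σ * recip (Z U σ)) * A U f σ  ≡⟨ ∑-* cs (w σ * h σ * recip (Z U σ)) (λ τ → w (mrg U σ τ) * f (mrg U σ τ)) ⟨
      S (λ τ → (w σ * h σ * recip (Z U σ)) * (w (mrg U σ τ) * f (mrg U σ τ)))  ≡⟨ ∑-cong cs (λ τ → eq′ (w σ) (h σ) (recip (Z U σ)) (w (mrg U σ τ)) (f (mrg U σ τ))) ⟩
      S (λ τ → w σ * w (mrg U σ τ) * recip (Z U σ) * (h σ * f (mrg U σ τ)))  ∎
      where
      open ≡-Reasoning
      eq : ∀ a b c d → a * (b * (c * d)) ≡ a * b * c * d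
      eq = solve-∀ ℚ-ring
      eq′ : ∀ a b c d e → a * b * c * (d * e) ≡ a * d * c * (b * e)
      eq′ = solve-∀ ℚ-ring

    -- The kernel of `E U` is symmetric in `σ` and `mrg U σ τ`, because `Z U` takes the same value
    -- at both; `∑ᶜ-exchange` interchanges the two. So `E U` is self-adjoint.
    E-sym : ∀ U h f → ⟪ h , E U f ⟫ ≡ ⟪ E U h , f ⟫
    E-sym U h f = begin
      ⟪ h , E U f ⟫  ≡⟨ ⟪⟫-E U h f ⟩
      S (λ σ → S (λ τ → K σ (mrg U σ τ)))  ≡⟨ ∑-cong cs (λ σ → ∑-cong cs (λ τ → cross σ τ)) ⟩
      S (λ σ → S (λ τ → K′ (mrg U σ τ) (mrg U τ σ)))  ≡⟨ ∑ᶜ-exchange U K′ ⟩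
      S (λ σ → S (K′ σ))  ≡⟨ ⟪⟫-E U f h ⟨
      ⟪ f , E U h ⟫  ≡⟨ ⟪⟫-comm f (E U h) ⟩
      ⟪ E U h , f ⟫  ∎
      where
      open ≡-Reasoning
      K K′ : Col → Col → ℚ
      K σ ρ = w σ * w ρ * recip (Z U σ) * (h σ * f ρ)
      K′ σ τ = w σ * w (mrg U σ τ) * recip (Z U σ) * (f σ * h (mrg U σ τ))
      eq : ∀ a b c d e → a * b * c * (d * e) ≡ b * a * c * (e * d)
      eq = solve-∀ ℚ-ring
      cross : ∀ σ τ → K σ (mrg U σ τ) ≡ K′ (mrg U σ τ) (mrg U τ σ)
      cross σ τ = trans (eq (w σ) (w (mrg U σ τ)) (recip (Z U σ)) (h σ) (f (mrg U σ τ)))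
        (cong₂ (λ x z → w (mrg U σ τ) * w x * recip z * (f (mrg U σ τ) * h x)) (sym (mrg-cross U σ τ)) (sym (Z-inv {U} {U} ⊆-refl σ τ)))

    -- `E U g` does not depend on the colours in `U`, so `E U′` fixes it; self-adjointness moves
    -- this to the left argument.
    E-absorb : ∀ {U′ U} → U′ ⊆ U → ∀ f g → ⟪ E U′ f , E U g ⟫ ≡ ⟪ f , E U g ⟫
    E-absorb {U′} {U} s f g = trans (sym (E-sym U′ f (E U g))) (⟪⟫-congʳ f (E U′ (E U g)) (E U g) λ σ p → E-fix U′ (E U g) σ p (λ τ → E-inv s g σ τ))

    E-idem : ∀ U f g → ⟪ E U f , E U g ⟫ ≡ ⟪ f , E U g ⟫
    E-idem U = E-absorb {U} {U} ⊆-refl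

    E-⊖ : ∀ U f g σ → E U (f ⊖ g) σ ≡ E U f σ - E U g σ
    E-⊖ U f g σ = trans (cong (recip (Z U σ) *_) (trans (∑-cong cs λ τ → *-distribˡ-minus (w (mrg U σ τ)) (f (mrg U σ τ)) (g (mrg U σ τ))) (∑-minus cs _ _)))
                        (*-distribˡ-minus (recip (Z U σ)) (A U f σ) (A U g σ))

    E-⊕ : ∀ U f g σ → E U (f ⊕ g) σ ≡ E U f σ + E U g σ
    E-⊕ U f g σ = trans (cong (recip (Z U σ) *_) (trans (∑-cong cs λ τ → eq (w (mrg U σ τ)) (f (mrg U σ τ)) (g (mrg U σ τ))) (∑-+ cs _ _)))
                        (eq (recip (Z U σ)) (A U f σ) (A U g σ))
      where
      eq : ∀ a b c → a * (b + c) ≡ a * b + a * c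
      eq = solve-∀ ℚ-ring

    D : VSet → Fn → ℚ
    D U f = ⟪ f , f ⟫ - ⟪ f , E U f ⟫

    -- `E U` is an orthogonal projection, and this is Pythagoras.
    D≡ : ∀ U f → D U f ≡ ⟪ f ⊖ E U f , f ⊖ E U f ⟫
    D≡ U f = sym (trans (⟪⟫-⊖² f (E U f)) (trans (cong (λ x → ⟪ f , f ⟫ - 2ℚ * ⟪ f , E U f ⟫ + x) (E-idem U f f)) (eq ⟪ f , f ⟫ ⟪ f , E U f ⟫)))
      where
      eq : ∀ a b → a - (1ℚ + 1ℚ) * b + b ≡ a - b
      eq = solve-∀ ℚ-ring

    D-nonneg : ∀ U f → 0ℚ ≤ D U f
    D-nonneg U f = subst (0ℚ ≤_) (sym (D≡ U f)) (⟪⟫-nonneg (f ⊖ E U f))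

    D≤norm : ∀ U f → D U f ≤ ⟪ f , f ⟫
    D≤norm U f = diff⇒≤ (subst (0ℚ ≤_) (trans (E-idem U f f) (a-[a-b] ⟪ f , f ⟫ ⟪ f , E U f ⟫)) (⟪⟫-nonneg (E U f)))

    -- The parallelogram law for the form D U.
    D-⊖ : ∀ U f k → D U (f ⊖ k) ≤ 2ℚ * D U f + 2ℚ * D U k
    D-⊖ U f k = diff⇒≤ (subst (0ℚ ≤_) law (D-nonneg U (f ⊕ k)))
      where
      fk⁻ : ⟪ f ⊖ k , E U (f ⊖ k) ⟫ ≡ ⟪ f , E U f ⟫ - ⟪ f , E U k ⟫ - (⟪ k , E U f ⟫ - ⟪ k , E U k ⟫)
      fk⁻ = trans (⟪⟫-congʳ (f ⊖ k) (E U (f ⊖ k)) (E U f ⊖ E U k) λ σ _ → E-⊖ U f k σ)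
            (trans (⟪⟫-⊖ˡ f k (E U f ⊖ E U k)) (cong₂ _-_ (⟪⟫-⊖ʳ f (E U f) (E U k)) (⟪⟫-⊖ʳ k (E U f) (E U k))))
      fk⁺ : ⟪ f ⊕ k , E U (f ⊕ k) ⟫ ≡ ⟪ f , E U f ⟫ + ⟪ f , E U k ⟫ + (⟪ k , E U f ⟫ + ⟪ k , E U k ⟫)
      fk⁺ = trans (⟪⟫-congʳ (f ⊕ k) (E U (f ⊕ k)) (E U f ⊕ E U k) λ σ _ → E-⊕ U f k σ)
            (trans (⟪⟫-⊕ˡ f k (E U f ⊕ E U k)) (cong₂ _+_ (⟪⟫-⊕ʳ f (E U f) (E U k)) (⟪⟫-⊕ʳ k (E U f) (E U k))))
      n⁻ : ⟪ f ⊖ k , f ⊖ k ⟫ ≡ ⟪ f , f ⟫ - ⟪ f , k ⟫ - (⟪ k , f ⟫ - ⟪ k , k ⟫)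
      n⁻ = trans (⟪⟫-⊖ˡ f k (f ⊖ k)) (cong₂ _-_ (⟪⟫-⊖ʳ f f k) (⟪⟫-⊖ʳ k f k))
      n⁺ : ⟪ f ⊕ k , f ⊕ k ⟫ ≡ ⟪ f , f ⟫ + ⟪ f , k ⟫ + (⟪ k , f ⟫ + ⟪ k , k ⟫)
      n⁺ = trans (⟪⟫-⊕ˡ f k (f ⊕ k)) (cong₂ _+_ (⟪⟫-⊕ʳ f f k) (⟪⟫-⊕ʳ k f k))
      eq : ∀ a b c d a′ b′ c′ d′ → a + b + (c + d) - (a′ + b′ + (c′ + d′)) ≡
        (1ℚ + 1ℚ) * (a - a′) + (1ℚ + 1ℚ) * (d - d′) - (a - b - (c - d) - (a′ - b′ - (c′ - d′)))
      eq = solve-∀ ℚ-ring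
      law : D U (f ⊕ k) ≡ 2ℚ * D U f + 2ℚ * D U k - D U (f ⊖ k)
      law = trans (cong₂ _-_ n⁺ fk⁺) (trans (eq ⟪ f , f ⟫ ⟪ f , k ⟫ ⟪ k , f ⟫ ⟪ k , k ⟫ ⟪ f , E U f ⟫ ⟪ f , E U k ⟫ ⟪ k , E U f ⟫ ⟪ k , E U k ⟫)
        (cong (λ x → 2ℚ * D U f + 2ℚ * D U k - x) (sym (cong₂ _-_ n⁻ fk⁻))))

    -- The law of total variance: `E U` after `E U′` is `E U`, so only the mixed term with `E U′ f`
    -- has to be inserted.
    D-tower : ∀ {U′ U} → U′ ⊆ U → ∀ f → D U f ≡ D U′ f + D U (E U′ f)
    D-tower {U′} {U} s f = begin
      ⟪ f , f ⟫ - ⟪ f , E U f ⟫  ≡⟨ eq ⟪ f , f ⟫ ⟪ f , E U f ⟫ ⟪ f , g ⟫ ⟩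
      ⟪ f , f ⟫ - ⟪ f , g ⟫ + (⟪ f , g ⟫ - ⟪ f , E U f ⟫)  ≡⟨ cong (D U′ f +_) (cong₂ _-_ (sym (E-idem U′ f f)) (sym gEg)) ⟩
      D U′ f + (⟪ g , g ⟫ - ⟪ g , E U g ⟫)  ∎
      where
      open ≡-Reasoning
      g = E U′ f
      eq : ∀ a b c → a - b ≡ a - c + (c - b)
      eq = solve-∀ ℚ-ring
      gEg : ⟪ g , E U g ⟫ ≡ ⟪ f , E U f ⟫
      gEg = begin
        ⟪ g , E U g ⟫  ≡⟨ E-absorb s f g ⟩
        ⟪ f , E U g ⟫  ≡⟨ E-sym U f g ⟩
        ⟪ E U f , g ⟫  ≡⟨ ⟪⟫-comm (E U f) g ⟩
        ⟪ g , E U f ⟫  ≡⟨ E-absorb s f f ⟩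
        ⟪ f , E U f ⟫  ∎

    -- Given the colours outside `U`, `σ` and `mrg U σ τ` are two independent samples, and twice a
    -- variance is the mean squared difference of such a pair. In this form variances on different
    -- sets can be compared move by move.
    D-pairs : ∀ U g → 2ℚ * D U g ≡ S (λ σ → S (λ τ → w σ * w (mrg U σ τ) * recip (Z U σ) * ((g σ - g (mrg U σ τ)) * (g σ - g (mrg U σ τ)))))
    D-pairs U g = sym (begin
      S (λ σ → S (λ τ → k σ τ * ((g σ - g (mrg U σ τ)) * (g σ - g (mrg U σ τ)))))
        ≡⟨ ∑-cong cs (λ σ → trans (∑-cong cs (λ τ → eq (k σ τ) (g σ) (g (mrg U σ τ)))) (∑-+ cs _ _)) ⟩
      S (λ σ → S (λ τ → k σ τ * (g² σ * one (mrg U σ τ)) + k σ τ * (one σ * g² (mrg U σ τ))) + S (λ τ → - 2ℚ * (k σ τ * (g σ * g (mrg U σ τ)))))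
        ≡⟨ trans (∑-+ cs _ _) (cong₂ _+_ (trans (∑-cong cs (λ σ → ∑-+ cs _ _)) (∑-+ cs _ _)) (trans (∑-cong cs (λ σ → ∑-* cs (- 2ℚ) _)) (∑-* cs (- 2ℚ) _))) ⟩
      S (λ σ → S (λ τ → k σ τ * (g² σ * one (mrg U σ τ)))) + S (λ σ → S (λ τ → k σ τ * (one σ * g² (mrg U σ τ)))) + - 2ℚ * S (λ σ → S (λ τ → k σ τ * (g σ * g (mrg U σ τ))))
        ≡⟨ cong₂ _+_ (cong₂ _+_ (⟪⟫-E U g² one) (⟪⟫-E U one g²)) (cong (- 2ℚ *_) (⟪⟫-E U g g)) ⟨
      ⟪ g² , E U one ⟫ + ⟪ one , E U g² ⟫ + - 2ℚ * ⟪ g , E U g ⟫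
        ≡⟨ cong₂ (λ a b → a + b + - 2ℚ * ⟪ g , E U g ⟫) part₁ (trans (E-sym U one g²) (trans (⟪⟫-comm (E U one) g²) part₁)) ⟩
      ⟪ g , g ⟫ + ⟪ g , g ⟫ + - 2ℚ * ⟪ g , E U g ⟫
        ≡⟨ eq₂ ⟪ g , g ⟫ ⟪ g , E U g ⟫ ⟩
      2ℚ * D U g ∎)
      where
      open ≡-Reasoning
      one g² : Fn
      one _ = 1ℚ
      g² σ = g σ * g σ
      k : Col → Col → ℚ
      k σ τ = w σ * w (mrg U σ τ) * recip (Z U σ)
      eq : ∀ k a b → k * ((a - b) * (a - b)) ≡ k * (a * a * 1ℚ) + k * (1ℚ * (b * b)) + - (1ℚ + 1ℚ) * (k * (a * b))
      eq = solve-∀ ℚ-ring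
      eq₂ : ∀ a b → a + a + - (1ℚ + 1ℚ) * b ≡ (1ℚ + 1ℚ) * (a - b)
      eq₂ = solve-∀ ℚ-ring
      part₁ : ⟪ g² , E U one ⟫ ≡ ⟪ g , g ⟫
      part₁ = trans (⟪⟫-congʳ g² (E U one) one λ σ p → E-fix U one σ p (λ _ → refl)) (∑-cong cs λ σ → cong (w σ *_) (*-identityʳ (g² σ)))

  -- Subadditivity of the variance over parts without edges between them.

  module Splitting {n : ℕ} (q : ℕ) (G : Graph n) (U U₁ U₂ : Fin n → Bool)
    (U≡ : ∀ u → U u ≡ U₁ u ∨ U₂ u)
    (disjoint : ∀ u → U₁ u ≡ true → U₂ u ≡ false)
    (separated : ∀ u v → U₁ u ≡ true → U₂ v ≡ true → ¬ T (adj G u v)) where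

    open Averages q G

    -- Since no edge joins the two parts, properness after resampling both can be checked edge by
    -- edge with only one part changed.
    sides : ∀ u v → T (adj G u v) → (U₁ u ≡ false × U₁ v ≡ false) ⊎ (U₂ u ≡ false × U₂ v ≡ false)
    sides u v uv = go (U₁ u) (U₁ v) refl refl
      where
      off : ∀ {x y} → T (adj G x y) → U₁ x ≡ true → ∀ b → U₂ y ≡ b → U₂ y ≡ false
      off xy p false e = e
      off {x} {y} xy p true e = ⊥-elim (separated x y p e xy)
      vu : T (adj G v u)
      vu = subst T (adj-sym G u v) uv
      go : ∀ a b → U₁ u ≡ a → U₁ v ≡ b → (U₁ u ≡ false × U₁ v ≡ false) ⊎ (U₂ u ≡ false × U₂ v ≡ false)
      go false false p r = inj₁ (p , r)
      go true  b     p r = inj₂ (disjoint u p , off uv p (U₂ v) refl)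
      go false true  p r = inj₂ (off vu r (U₂ u) refl , disjoint v r)

    mrg-split : ∀ (σ τ ρ : Col) → mrg U₂ (mrg U₁ σ τ) ρ ≡ mrg U σ (mrg U₂ τ ρ)
    mrg-split σ τ ρ = lookup-ext λ u → begin
      lookup (mrg U₂ (mrg U₁ σ τ) ρ) u
        ≡⟨ lookup-mrg U₂ (mrg U₁ σ τ) ρ u ⟩
      (if U₂ u then lookup ρ u else lookup (mrg U₁ σ τ) u)
        ≡⟨ cong (λ x → if U₂ u then lookup ρ u else x) (lookup-mrg U₁ σ τ u) ⟩
      (if U₂ u then lookup ρ u else (if U₁ u then lookup τ u else lookup σ u))
        ≡⟨ bool (U₁ u) (U₂ u) (lookup σ u) (lookup τ u) (lookup ρ u) ⟩
      (if U₁ u ∨ U₂ u then (if U₂ u then lookup ρ u else lookup τ u) else lookup σ u)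
        ≡⟨ cong₂ (λ b x → if b then x else lookup σ u) (U≡ u) (lookup-mrg U₂ τ ρ u) ⟨
      (if U u then lookup (mrg U₂ τ ρ) u else lookup σ u)
        ≡⟨ lookup-mrg U σ (mrg U₂ τ ρ) u ⟨
      lookup (mrg U σ (mrg U₂ τ ρ)) u ∎
      where
      open ≡-Reasoning
      bool : ∀ a b (x y z : Fin q) → (if b then z else (if a then y else x)) ≡ (if a ∨ b then (if b then z else y) else x)
      bool true  true  x y z = refl
      bool true  false x y z = refl
      bool false true  x y z = refl
      bool false false x y z = refl

    module _ (σ : Col) (σ-proper : IsP σ) (τ ρ : Col) where

      private
        a b x : Col
        a = mrg U₁ σ τ
        b = mrg U₂ σ ρ
        x = mrg U₂ a ρ

        a≡σ : ∀ {u} → U₁ u ≡ false → lookup a u ≡ lookup σ u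
        a≡σ = lookup-mrg-off U₁ σ τ

        b≡σ : ∀ {u} → U₂ u ≡ false → lookup b u ≡ lookup σ u
        b≡σ = lookup-mrg-off U₂ σ ρ

        x≡a : ∀ {u} → U₂ u ≡ false → lookup x u ≡ lookup a u
        x≡a = lookup-mrg-off U₂ a ρ

        x≡b : ∀ {u} → U₁ u ≡ false → lookup x u ≡ lookup b u
        x≡b {u} e = trans (lookup-mrg U₂ a ρ u) (trans (cong (λ y → if U₂ u then lookup ρ u else y) (a≡σ e)) (sym (lookup-mrg U₂ σ ρ u)))

        ≢-transport : ∀ {a b a′ b′ : Fin q} → a ≡ a′ → b ≡ b′ → a′ ≢ b′ → a ≢ b
        ≢-transport refl refl p = p

      drop-second : IsP x → IsP a
      drop-second px u v uv with sides u v uv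
      ... | inj₁ (e , e′) = ≢-transport (a≡σ e) (a≡σ e′) (σ-proper u v uv)
      ... | inj₂ (e , e′) = ≢-transport (sym (x≡a e)) (sym (x≡a e′)) (px u v uv)

      drop-first : IsP x → IsP b
      drop-first px u v uv with sides u v uv
      ... | inj₁ (e , e′) = ≢-transport (sym (x≡b e)) (sym (x≡b e′)) (px u v uv)
      ... | inj₂ (e , e′) = ≢-transport (b≡σ e) (b≡σ e′) (σ-proper u v uv)

      combine : IsP a → IsP b → IsP x
      combine pa pb u v uv with sides u v uv
      ... | inj₁ (e , e′) = ≢-transport (x≡b e) (x≡b e′) (pb u v uv)
      ... | inj₂ (e , e′) = ≢-transport (x≡a e) (x≡a e′) (pa u v uv)

    A-split : ∀ f σ → Proper G σ → A U₁ (E U₂ f) σ ≡ recip (Z U₂ σ) * ∣C∣ n q * A U f σ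
    A-split f σ p = begin
      S (λ τ → w (mrg U₁ σ τ) * E U₂ f (mrg U₁ σ τ))
        ≡⟨ ∑-cong cs (λ τ → trans (𝟙-under (isProper G (mrg U₁ σ τ)) (λ pa → cong (λ z → recip z * A U₂ f (mrg U₁ σ τ)) (Z≡ τ (proper⁻ {mrg U₁ σ τ} pa))))
                                  (*-leftComm (w (mrg U₁ σ τ)) (recip (Z U₂ σ)) (A U₂ f (mrg U₁ σ τ)))) ⟩
      S (λ τ → recip (Z U₂ σ) * (w (mrg U₁ σ τ) * A U₂ f (mrg U₁ σ τ)))
        ≡⟨ ∑-* cs (recip (Z U₂ σ)) (λ τ → w (mrg U₁ σ τ) * A U₂ f (mrg U₁ σ τ)) ⟩
      recip (Z U₂ σ) * S (λ τ → w (mrg U₁ σ τ) * A U₂ f (mrg U₁ σ τ))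
        ≡⟨ cong (recip (Z U₂ σ) *_) (∑-cong cs (λ τ → trans (sym (∑-* cs (w (mrg U₁ σ τ)) (λ ρ → w (x τ ρ) * f (x τ ρ)))) (∑-cong cs (λ ρ → term τ ρ)))) ⟩
      recip (Z U₂ σ) * S (λ τ → S (λ ρ → F (mrg U₂ τ ρ)))
        ≡⟨ cong (recip (Z U₂ σ) *_) (∑ᶜ-resampleSet U₂ F) ⟩
      recip (Z U₂ σ) * (∣C∣ n q * A U f σ)
        ≡⟨ *-assoc (recip (Z U₂ σ)) (∣C∣ n q) (A U f σ) ⟨
      recip (Z U₂ σ) * ∣C∣ n q * A U f σ ∎
      where
      open ≡-Reasoning
      σp : IsP σ
      σp = proper⁻ {σ} p
      x : Col → Col → Col
      x τ ρ = mrg U₂ (mrg U₁ σ τ) ρ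
      F : Fn
      F ρ = w (mrg U σ ρ) * f (mrg U σ ρ)
      Z≡ : ∀ τ → IsP (mrg U₁ σ τ) → Z U₂ (mrg U₁ σ τ) ≡ Z U₂ σ
      Z≡ τ pa = ∑-cong cs λ ρ → w-iff {x τ ρ} {mrg U₂ σ ρ} (drop-first σ σp τ ρ) (combine σ σp τ ρ pa)
      term : ∀ τ ρ → w (mrg U₁ σ τ) * (w (x τ ρ) * f (x τ ρ)) ≡ F (mrg U₂ τ ρ)
      term τ ρ = begin
        w (mrg U₁ σ τ) * (w (x τ ρ) * f (x τ ρ))  ≡⟨ *-assoc (w (mrg U₁ σ τ)) (w (x τ ρ)) (f (x τ ρ)) ⟨
        w (mrg U₁ σ τ) * w (x τ ρ) * f (x τ ρ)  ≡⟨ cong (_* f (x τ ρ)) (w-absorb {mrg U₁ σ τ} {x τ ρ} (drop-second σ σp τ ρ)) ⟩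
        w (x τ ρ) * f (x τ ρ)  ≡⟨ cong (λ y → w y * f y) (mrg-split σ τ ρ) ⟩
        F (mrg U₂ τ ρ)  ∎

    -- Conditional independence of the two parts given the outside. The constants are not computed:
    -- `A-split` for the function 1 yields the normalisation.
    E-split : ∀ f σ → Proper G σ → E U₁ (E U₂ f) σ ≡ E U f σ
    E-split f σ p = begin
      recip (Z U₁ σ) * A U₁ (E U₂ f) σ  ≡⟨ cong (recip (Z U₁ σ) *_) (A-split f σ p) ⟩
      recip (Z U₁ σ) * (K * A U f σ)  ≡⟨ *-assoc (recip (Z U₁ σ)) K (A U f σ) ⟨
      recip (Z U₁ σ) * K * A U f σ  ≡⟨ cong (_* A U f σ) (recip-unique {Z U σ} {recip (Z U₁ σ) * K} normalised) ⟩
      recip (Z U σ) * A U f σ  ∎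
      where
      open ≡-Reasoning
      K : ℚ
      K = recip (Z U₂ σ) * ∣C∣ n q
      one : Fn
      one _ = 1ℚ
      Z₁ : Z U₁ σ ≡ K * Z U σ
      Z₁ = begin
        Z U₁ σ  ≡⟨ ∑-cong cs (λ τ → trans (sym (*-identityʳ (w (mrg U₁ σ τ)))) (𝟙-under (isProper G (mrg U₁ σ τ)) (λ p′ → sym (E-fix U₂ one (mrg U₁ σ τ) p′ (λ _ → refl))))) ⟩
        A U₁ (E U₂ one) σ  ≡⟨ A-split one σ p ⟩
        K * A U one σ  ≡⟨ cong (K *_) (∑-cong cs (λ τ → *-identityʳ (w (mrg U σ τ)))) ⟩
        K * Z U σ  ∎
      normalised : recip (Z U₁ σ) * K * Z U σ ≡ 1ℚ
      normalised = trans (*-assoc (recip (Z U₁ σ)) K (Z U σ)) (trans (cong (recip (Z U₁ σ) *_) (sym Z₁)) (recip-inverseˡ (Z≢0 U₁ σ p)))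

    ⊆₁ : U₁ ⊆ U
    ⊆₁ u e = trans (U≡ u) (cong (_∨ U₂ u) e)

    ⊆₂ : U₂ ⊆ U
    ⊆₂ u e = trans (U≡ u) (trans (cong (U₁ u ∨_) e) (∨-zeroʳ (U₁ u)))

    -- By `E-split`, `a ⊖ b` is (1 - E₁)(1 - E₂) f for the two projections, and its squared norm is
    -- exactly the difference of the two sides.
    D-split : ∀ f → D U f ≤ D U₁ f + D U₂ f
    D-split f = diff⇒≤ (subst (0ℚ ≤_) expand (⟪⟫-nonneg (a ⊖ b)))
      where
      a b : Fn
      a = f ⊖ E U₁ f
      b = E U₂ f ⊖ E U f
      x₂ x : ℚ
      x₂ = ⟪ f , E U₂ f ⟫
      x = ⟪ f , E U f ⟫
      cross : ⟪ E U₁ f , E U₂ f ⟫ ≡ x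
      cross = trans (sym (E-sym U₁ f (E U₂ f))) (⟪⟫-congʳ f (E U₁ (E U₂ f)) (E U f) (E-split f))
      bb : ⟪ b , b ⟫ ≡ x₂ - 2ℚ * x + x
      bb = trans (⟪⟫-⊖² (E U₂ f) (E U f)) (cong₂ _+_ (cong₂ (λ y z → y - 2ℚ * z) (E-idem U₂ f f) (E-absorb ⊆₂ f f)) (E-idem U f f))
      ab : ⟪ a , b ⟫ ≡ x₂ - x - (x - x)
      ab = trans (⟪⟫-⊖ˡ f (E U₁ f) b) (cong₂ _-_ (⟪⟫-⊖ʳ f (E U₂ f) (E U f)) (trans (⟪⟫-⊖ʳ (E U₁ f) (E U₂ f) (E U f)) (cong₂ _-_ cross (E-absorb ⊆₁ f f))))
      eq : ∀ n x₁ x₂ x → n - x₁ - (1ℚ + 1ℚ) * (x₂ - x - (x - x)) + (x₂ - (1ℚ + 1ℚ) * x + x) ≡ n - x₁ + (n - x₂) - (n - x)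
      eq = solve-∀ ℚ-ring
      expand : ⟪ a ⊖ b , a ⊖ b ⟫ ≡ D U₁ f + D U₂ f - D U f
      expand = trans (⟪⟫-⊖² a b) (trans (cong₂ _+_ (cong₂ (λ y z → y - 2ℚ * z) (sym (D≡ U₁ f)) ab) bb) (eq ⟪ f , f ⟫ ⟪ f , E U₁ f ⟫ x₂ x))

  -- Available colours and recolouring of a single vertex.

  1≤all+missing : ∀ n (p : Fin n → Bool) → 1ℚ ≤ 𝟙 (allV n p) + ∑ᶠ n (λ u → 𝟙 (not (p u)))
  1≤all+missing zero    p = ≤-reflexive (sym (+-identityʳ 1ℚ))
  1≤all+missing (suc n) p = subst (1ℚ ≤_) (cong₂ _+_ (cong 𝟙 (sym (allV-suc n p))) (sym (∑ᶠ-suc n (λ u → 𝟙 (not (p u)))))) (onCase (p Fin.zero) refl)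
    where
    rest : ℚ
    rest = ∑ᶠ n (λ u → 𝟙 (not (p (Fin.suc u))))
    0≤rest : 0ℚ ≤ rest
    0≤rest = ∑-nonneg (allFin n) (λ u → 𝟙-nonneg (not (p (Fin.suc u))))
    onCase : ∀ b → p Fin.zero ≡ b → 1ℚ ≤ 𝟙 (p Fin.zero ∧ allV n (p ∘ Fin.suc)) + (𝟙 (not (p Fin.zero)) + rest)
    onCase true  e rewrite e = subst (1ℚ ≤_) (cong (𝟙 (allV n (p ∘ Fin.suc)) +_) (sym (+-identityˡ rest))) (1≤all+missing n (p ∘ Fin.suc))
    onCase false e rewrite e = subst (1ℚ ≤_) (sym (+-identityˡ (1ℚ + rest))) (+-mono-≤ (≤-refl {1ℚ}) 0≤rest)

  module Recolouring {n : ℕ} (q : ℕ) (G : Graph n) where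

    open Averages q G public

    av : Col → Fin n → ℚ
    av σ v = ∑ᶠ q (λ c → 𝟙 (available G σ v c))

    -- Each neighbour forbids exactly one colour. The union bound `1≤all+missing` is summed over the
    -- colours and the sums are interchanged.
    q≤av+degree : ∀ σ v → ι q ≤ av σ v + ι (degree G v)
    q≤av+degree σ v = begin
      ι q  ≡⟨ trans (∑ᶠ-const q 1ℚ) (*-identityʳ (ι q)) ⟨
      ∑ᶠ q (λ _ → 1ℚ)  ≤⟨ ∑-mono (allFin q) (λ c → 1≤all+missing n (p c)) ⟩
      ∑ᶠ q (λ c → 𝟙 (available G σ v c) + ∑ᶠ n (λ u → 𝟙 (not (p c u)))) ≡⟨ ∑-+ (allFin q) _ _ ⟩
      av σ v + ∑ᶠ q (λ c → ∑ᶠ n (λ u → 𝟙 (not (p c u))))  ≡⟨ cong (av σ v +_) (∑-swap (allFin q) (allFin n) (λ c u → 𝟙 (not (p c u)))) ⟩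
      av σ v + ∑ᶠ n (λ u → ∑ᶠ q (λ c → 𝟙 (not (p c u))))  ≡⟨ cong (av σ v +_) (∑-cong (allFin n) (λ u → trans (∑ᶠ-single (lookup σ u) (λ c c≢ → other u c c≢ (adj G v u))) (same u (adj G v u)))) ⟩
      av σ v + ∑ᶠ n (λ u → 𝟙 (adj G v u))  ≡⟨ cong (av σ v +_) (ι-countV n (adj G v)) ⟨
      av σ v + ι (degree G v)  ∎
      where
      open ≤-Reasoning
      p : Fin q → Fin n → Bool
      p c u = not (adj G v u) ∨ not (lookup σ u == c)
      other : ∀ u c → c ≢ lookup σ u → ∀ b → 𝟙 (not (not b ∨ not (lookup σ u == c))) ≡ 0ℚ
      other u c c≢ false = refl
      other u c c≢ true  = 𝟙-false (λ t → T-not⁻ t (T-not⁺ (λ t′ → c≢ (sym (==⁻ t′)))))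
      same : ∀ u b → 𝟙 (not (not b ∨ not (lookup σ u == lookup σ u))) ≡ 𝟙 b
      same u false = refl
      same u true  = 𝟙-true {not (not (lookup σ u == lookup σ u))} (T-not⁺ {not (lookup σ u == lookup σ u)} (λ t → T-not⁻ t (==⁺ {a = lookup σ u} refl)))

    adj⇒≢ : ∀ {u v} → T (adj G u v) → u ≢ v
    adj⇒≢ {u} uv refl = subst T (irrefl G u) uv

    available⁻ : ∀ {σ : Col} {v c} → T (available G σ v c) → ∀ u → T (adj G v u) → lookup σ u ≢ c
    available⁻ {σ} {v} {c} t u vu e = ⇒⁻ (allV⁻ n {λ u → not (adj G v u) ∨ not (lookup σ u == c)} t u) vu (==⁺ e)

    available⁺ : ∀ {σ : Col} {v c} → (∀ u → T (adj G v u) → lookup σ u ≢ c) → T (available G σ v c)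
    available⁺ h = allV⁺ n λ u → ⇒⁺ (λ vu e → h u vu (==⁻ e))

    -- Edges that miss `v` do not see the recolouring and are settled by the one proper choice `c₀`;
    -- `available` judges the edges at `v`.
    w-recolour : ∀ {σ : Col} v c₀ → IsP (σ [ v ]≔ c₀) → ∀ c → w (σ [ v ]≔ c) ≡ 𝟙 (available G σ v c)
    w-recolour {σ} v c₀ p₀ c = cong 𝟙 (T-iff (to ∘ proper⁻ {σ [ v ]≔ c}) (proper⁺ {σ [ v ]≔ c} ∘ from ∘ available⁻ {σ}))
      where
      at : ∀ c → lookup (σ [ v ]≔ c) v ≡ c
      at c = lookup∘update v σ c
      off : ∀ {u} c → u ≢ v → lookup (σ [ v ]≔ c) u ≡ lookup σ u
      off c u≢v = lookup∘update′ u≢v σ c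
      to : IsP (σ [ v ]≔ c) → T (available G σ v c)
      to p = available⁺ {σ} λ u vu e → p v u vu (trans (at c) (trans (sym e) (sym (off c (λ u≡v → adj⇒≢ vu (sym u≡v))))))
      from : (∀ u → T (adj G v u) → lookup σ u ≢ c) → IsP (σ [ v ]≔ c)
      from h x y xy e with x Fin.≟ v | y Fin.≟ v
      ... | yes refl | _        = h y xy (trans (sym (off c (λ y≡v → adj⇒≢ xy (sym y≡v)))) (trans (sym e) (at c)))
      ... | no x≢v   | yes refl = h x (subst T (adj-sym G x y) xy) (trans (sym (off c x≢v)) (trans e (at c)))
      ... | no x≢v   | no y≢v   = p₀ x y xy (trans (off c₀ x≢v) (trans (trans (sym (off c x≢v)) (trans e (off c y≢v))) (sym (off c₀ y≢v))))

    w-available : ∀ {σ : Col} v c → IsP σ → w (σ [ v ]≔ c) ≡ 𝟙 (available G σ v c)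
    w-available {σ} v c p = w-recolour {σ} v (lookup σ v) (subst IsP (sym ([]≔-lookup σ v)) p) c

    mrg-agree : ∀ (U : VSet) (x y : Col) → (∀ u → U u ≡ false → lookup x u ≡ lookup y u) → ∀ ρ → mrg U x ρ ≡ mrg U y ρ
    mrg-agree U x y h ρ = mrg-unique U x ρ (mrg U y ρ) (λ u e → sym (lookup-mrg-on U y ρ e)) (λ u e → trans (h u e) (sym (lookup-mrg-off U y ρ e)))

    E-agree : ∀ (U : VSet) f (x y : Col) → (∀ u → U u ≡ false → lookup x u ≡ lookup y u) → E U f x ≡ E U f y
    E-agree U f x y h = cong₂ (λ a b → recip a * b) (∑-cong cs λ ρ → cong w (mrg-agree U x y h ρ))
      (∑-cong cs λ ρ → cong (λ z → w z * f z) (mrg-agree U x y h ρ))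

    recolour-agree : ∀ (U : VSet) (σ : Col) {u} c → U u ≡ true → ∀ x → U x ≡ false → lookup (σ [ u ]≔ c) x ≡ lookup σ x
    recolour-agree U σ {u} c Uu x Ux = lookup∘update′ x≢u σ c
      where
      x≢u : x ≢ u
      x≢u refl with () ← trans (sym Uu) Ux

    module Slack {Δ d : ℕ} (degree≤ : ∀ v → degree G v ℕ.≤ Δ) (q≡ : q ≡ Δ ℕ.+ d) (2≤d : 2 ℕ.≤ d) where

      d≤av : ∀ σ v → ι d ≤ av σ v
      d≤av σ v = diff⇒≤ (subst (0ℚ ≤_) (eq (av σ v) (ι Δ) (ι d)) (≤⇒diff (≤-trans (≤-reflexive (sym (trans (cong ι q≡) (ι-+ Δ d)))) (≤-trans (q≤av+degree σ v) (+-monoʳ-≤ (av σ v) (ι-mono (degree≤ v)))))))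
        where
        eq : ∀ a b c → a + b - (b + c) ≡ a - c
        eq = solve-∀ ℚ-ring

      -- If the left side is not zero, the surroundings of `v` admit at least `d` colours. Hence no
      -- colour at `v` has conditional probability above 1/d.
      d*w≤ : ∀ σ v c₀ → ι d * w (σ [ v ]≔ c₀) ≤ ∑ᶠ q (λ c → w (σ [ v ]≔ c))
      d*w≤ σ v c₀ = go (T? (isProper G (σ [ v ]≔ c₀)))
        where
        go : Dec (Proper G (σ [ v ]≔ c₀)) → ι d * w (σ [ v ]≔ c₀) ≤ ∑ᶠ q (λ c → w (σ [ v ]≔ c))
        go (yes p) = subst₂ _≤_ (sym (trans (cong (ι d *_) (w-proper (σ [ v ]≔ c₀) p)) (*-identityʳ (ι d))))
          (sym (∑-cong (allFin q) (w-recolour {σ} v c₀ (proper⁻ {σ [ v ]≔ c₀} p)))) (d≤av σ v)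
        go (no ¬p) = subst (_≤ ∑ᶠ q (λ c → w (σ [ v ]≔ c))) (sym (trans (cong (ι d *_) (𝟙-false ¬p)) (*-zeroʳ (ι d))))
          (∑-nonneg (allFin q) (λ c → w-nonneg (σ [ v ]≔ c)))

      -- By `2 ≤ d` the excluded term `x₀` is at most half of the whole sum.
      halve : ∀ σ u c₀ → ∑ᶠ q (λ c → w (σ [ u ]≔ c)) ≤ 2ℚ * ∑ᶠ q (λ c → w (σ [ u ]≔ c) * 𝟙 (not (c == c₀)))
      halve σ u c₀ = diff⇒≤ (subst (0ℚ ≤_) (trans (cong (_- 2ℚ * x₀) X≡) (trans (eq x₀ Y) (cong (λ y → 2ℚ * Y - y) (sym X≡)))) (≤⇒diff 2x₀≤X))
        where
        x₀ X Y : ℚ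
        x₀ = w (σ [ u ]≔ c₀)
        X = ∑ᶠ q (λ c → w (σ [ u ]≔ c))
        Y = ∑ᶠ q (λ c → w (σ [ u ]≔ c) * 𝟙 (not (c == c₀)))
        2x₀≤X : 2ℚ * x₀ ≤ X
        2x₀≤X = ≤-trans (*-monoˡ (w-nonneg (σ [ u ]≔ c₀)) (ι-mono 2≤d)) (d*w≤ σ u c₀)
        bit : ∀ x b → x ≡ x * 𝟙 (not b) + x * 𝟙 b
        bit x true  = trans (eq′ x) (cong (_+ x * 1ℚ) (sym (*-zeroʳ x)))
          where
          eq′ : ∀ x → x ≡ 0ℚ + x * 1ℚ
          eq′ = solve-∀ ℚ-ring
        bit x false = trans (eq′ x) (cong (x * 1ℚ +_) (sym (*-zeroʳ x)))
          where
          eq′ : ∀ x → x ≡ x * 1ℚ + 0ℚ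
          eq′ = solve-∀ ℚ-ring
        X≡ : X ≡ Y + x₀
        X≡ = trans (∑-cong (allFin q) (λ c → bit (w (σ [ u ]≔ c)) (c == c₀)))
          (trans (∑-+ (allFin q) _ _) (cong (Y +_) (trans (∑ᶠ-single c₀ (λ c c≢ → trans (cong (w (σ [ u ]≔ c) *_) (𝟙-false (c≢ ∘ ==⁻))) (*-zeroʳ (w (σ [ u ]≔ c)))))
            (trans (cong (x₀ *_) (𝟙-true (==⁺ {a = c₀} refl))) (*-identityʳ x₀)))))
        eq : ∀ x y → y + x - (1ℚ + 1ℚ) * x ≡ (1ℚ + 1ℚ) * y - (y + x)
        eq = solve-∀ ℚ-ring

      0<ιq : 0ℚ < ι q
      0<ιq = ι-pos (subst (1 ℕ.≤_) (sym q≡) (ℕₚ.≤-trans (ℕₚ.≤-trans (ℕ.s≤s ℕ.z≤n) 2≤d) (ℕₚ.m≤n+m d Δ)))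

      -- Neighbours of v are resampled one at a time; each avoids c with conditional probability at least 1/2.
      module Avoidance (v : Fin n) (c : Fin q) (R : Fn) (R-nonneg : ∀ σ → 0ℚ ≤ R σ)
        (R-step : ∀ u → T (adj G v u) → (∀ σ c′ → R (σ [ u ]≔ c′) ≡ R σ) ⊎ (∀ σ → 𝟙 (not (lookup σ u == c)) * R σ ≡ R σ)) where

        avoids : List (Fin n) → Col → Bool
        avoids L σ = foldr (λ u b → (not (adj G v u) ∨ not (lookup σ u == c)) ∧ b) true L

        nbrs : List (Fin n) → ℕ
        nbrs L = length (filter (λ u → T? (adj G v u)) L)

        weight : List (Fin n) → Fn
        weight L σ = w σ * 𝟙 (avoids L σ) * R σ

        avoids-recolour : ∀ L {u} → All (u ≢_) L → ∀ σ c′ → avoids L (σ [ u ]≔ c′) ≡ avoids L σ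
        avoids-recolour []      []       σ c′ = refl
        avoids-recolour (x ∷ L) (p ∷ ps) σ c′ = cong₂ (λ y b → (not (adj G v x) ∨ not (y == c)) ∧ b)
          (lookup∘update′ (p ∘ sym) σ c′) (avoids-recolour L ps σ c′)

        -- Resample `u` alone: `R` does not change by hypothesis, nor does the event for `L`, as `u`
        -- is not in `L`; so `halve` applies with everything else fixed.
        avoid-one : ∀ u L → All (u ≢_) L → (∀ σ c′ → R (σ [ u ]≔ c′) ≡ R σ) →
                    S (weight L) ≤ 2ℚ * S (λ σ → w σ * (𝟙 (not (lookup σ u == c)) * 𝟙 (avoids L σ)) * R σ)
        avoid-one u L fresh R-inv = pos-cancel 0<ιq (begin
          ι q * S (weight L)  ≡⟨ ∑ᶜ-resample (weight L) u ⟨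
          S (λ σ → ∑ᶠ q (λ c′ → weight L (σ [ u ]≔ c′)))  ≡⟨ ∑-cong cs (λ σ → trans (∑-cong (allFin q) (λ c′ → lhs σ c′)) (∑-*ʳ (allFin q) (B σ) (λ c′ → w (σ [ u ]≔ c′)))) ⟩
          S (λ σ → ∑ᶠ q (λ c′ → w (σ [ u ]≔ c′)) * B σ)  ≤⟨ ∑-mono cs (λ σ → *-monoˡ (*-nonneg (𝟙-nonneg (avoids L σ)) (R-nonneg σ)) (halve σ u c)) ⟩
          S (λ σ → 2ℚ * ∑ᶠ q (λ c′ → w (σ [ u ]≔ c′) * 𝟙 (not (c′ == c))) * B σ)  ≡⟨ ∑-cong cs (λ σ → trans (*-assoc 2ℚ (∑ᶠ q (λ c′ → w (σ [ u ]≔ c′) * 𝟙 (not (c′ == c)))) (B σ)) (cong (2ℚ *_) (trans (sym (∑-*ʳ (allFin q) (B σ) (λ c′ → w (σ [ u ]≔ c′) * 𝟙 (not (c′ == c))))) (∑-cong (allFin q) (λ c′ → rhs σ c′))))) ⟩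
          S (λ σ → 2ℚ * ∑ᶠ q (λ c′ → F (σ [ u ]≔ c′)))  ≡⟨ trans (∑-* cs 2ℚ (λ σ → ∑ᶠ q (λ c′ → F (σ [ u ]≔ c′)))) (cong (2ℚ *_) (∑ᶜ-resample F u)) ⟩
          2ℚ * (ι q * S F)  ≡⟨ *-leftComm 2ℚ (ι q) (S F) ⟩
          ι q * (2ℚ * S F)  ∎)
          where
          open ≤-Reasoning
          F B : Fn
          F σ = w σ * (𝟙 (not (lookup σ u == c)) * 𝟙 (avoids L σ)) * R σ
          B σ = 𝟙 (avoids L σ) * R σ
          lhs : ∀ σ c′ → weight L (σ [ u ]≔ c′) ≡ w (σ [ u ]≔ c′) * B σ
          lhs σ c′ = trans (cong₂ (λ a r → w (σ [ u ]≔ c′) * 𝟙 a * r) (avoids-recolour L fresh σ c′) (R-inv σ c′)) (*-assoc (w (σ [ u ]≔ c′)) (𝟙 (avoids L σ)) (R σ))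
          eq′ : ∀ a b c d → a * b * (c * d) ≡ a * (b * c) * d
          eq′ = solve-∀ ℚ-ring
          rhs : ∀ σ c′ → w (σ [ u ]≔ c′) * 𝟙 (not (c′ == c)) * B σ ≡ F (σ [ u ]≔ c′)
          rhs σ c′ = trans (eq′ (w (σ [ u ]≔ c′)) (𝟙 (not (c′ == c))) (𝟙 (avoids L σ)) (R σ))
            (sym (trans (cong₂ (λ a r → w (σ [ u ]≔ c′) * (𝟙 (not (lookup (σ [ u ]≔ c′) u == c)) * 𝟙 a) * r) (avoids-recolour L fresh σ c′) (R-inv σ c′))
              (cong (λ x → w (σ [ u ]≔ c′) * (𝟙 (not (x == c)) * 𝟙 (avoids L σ)) * R σ) (lookup∘update u σ c′))))

        avoid : ∀ L → Unique L → S (λ σ → w σ * R σ) ≤ ι (2 ℕ.^ nbrs L) * S (weight L)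
        avoid []      [] = ≤-reflexive (trans (∑-cong cs (λ σ → cong (_* R σ) (sym (*-identityʳ (w σ))))) (sym (*-identityˡ (S (weight [])))))
        avoid (u ∷ L) (fresh ∷ uniq) = ≤-trans (avoid L uniq) (onCase (adj G v u) refl)
          where
          onCase : ∀ b → adj G v u ≡ b → ι (2 ℕ.^ nbrs L) * S (weight L) ≤ ι (2 ℕ.^ nbrs (u ∷ L)) * S (weight (u ∷ L))
          onCase false e rewrite e = ≤-refl
          onCase true  e = subst (λ k → ι (2 ℕ.^ nbrs L) * S (weight L) ≤ ι (2 ℕ.^ k) * S (weight (u ∷ L))) (sym count)
            (≤-trans (*-monoʳ (ι-nonneg (2 ℕ.^ nbrs L)) (≤-trans double (≤-reflexive (cong (2ℚ *_) (sym grown)))))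
              (≤-reflexive (trans (eq (ι (2 ℕ.^ nbrs L)) 2ℚ (S (weight (u ∷ L)))) (cong (_* S (weight (u ∷ L))) (sym (ι-* 2 (2 ℕ.^ nbrs L)))))))
            where
            count : nbrs (u ∷ L) ≡ suc (nbrs L)
            count rewrite e = refl
            grown : S (weight (u ∷ L)) ≡ S (λ σ → w σ * (𝟙 (not (lookup σ u == c)) * 𝟙 (avoids L σ)) * R σ)
            grown = ∑-cong cs λ σ → cong (λ x → w σ * x * R σ) (trans (cong (λ b → 𝟙 ((not b ∨ not (lookup σ u == c)) ∧ avoids L σ)) e) (𝟙-∧ (not (lookup σ u == c)) (avoids L σ)))
            eq : ∀ a b c → a * (b * c) ≡ b * a * c
            eq = solve-∀ ℚ-ring
            eq₂ : ∀ a b c d → a * b * (c * d) ≡ a * (c * b) * d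
            eq₂ = solve-∀ ℚ-ring
            X : ℚ
            X = S (λ σ → w σ * (𝟙 (not (lookup σ u == c)) * 𝟙 (avoids L σ)) * R σ)
            double : S (weight L) ≤ 2ℚ * X
            double with R-step u (subst T (sym e) _)
            ... | inj₁ inv = avoid-one u L fresh inv
            -- `R` already vanishes where `u` has colour `c`, so the new factor is free; the 2 is
            -- given away to keep one exponent for all neighbours.
            ... | inj₂ free = ≤-trans (≤-reflexive (∑-cong cs (λ σ → trans (cong (w σ * 𝟙 (avoids L σ) *_) (sym (free σ))) (eq₂ (w σ) (𝟙 (avoids L σ)) (𝟙 (not (lookup σ u == c))) (R σ)))))
              (subst (_≤ 2ℚ * X) (*-identityˡ X) (*-monoˡ 0≤X (≤ᵇ⇒≤ {1ℚ} {2ℚ} _)))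
              where
              0≤X : 0ℚ ≤ X
              0≤X = ∑-nonneg cs λ σ → *-nonneg (*-nonneg (w-nonneg σ) (*-nonneg (𝟙-nonneg (not (lookup σ u == c))) (𝟙-nonneg (avoids L σ)))) (R-nonneg σ)

        avoid-all : S (λ σ → w σ * R σ) ≤ ι (2 ℕ.^ degree G v) * S (λ σ → w σ * 𝟙 (available G σ v c) * R σ)
        avoid-all = avoid (allFin n) (allFin⁺ n)

  -- Removing one vertex from the resampled set.

  module Removal {n : ℕ} (q : ℕ) (G : Graph n) where

    open Recolouring q G public

    single : Fin n → VSet
    single v u = u == v

    _∖_ : VSet → Fin n → VSet
    (U ∖ v) u = U u ∧ not (u == v)

    ∖-⊆ : ∀ U v → (U ∖ v) ⊆ U
    ∖-⊆ U v u e with U u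
    ... | true = refl

    single-off : ∀ {v u} → u ≢ v → single v u ≡ false
    single-off {v} {u} u≢v with u Fin.≟ v
    ... | yes e = ⊥-elim (u≢v e)
    ... | no _  = refl

    single-on : ∀ v → single v v ≡ true
    single-on v with v Fin.≟ v
    ... | yes _ = refl
    ... | no ≢  = ⊥-elim (≢ refl)

    ∖-on : ∀ {U v u} → U u ≡ true → u ≢ v → (U ∖ v) u ≡ true
    ∖-on {U} {v} {u} e u≢v = cong₂ _∧_ e (cong not (single-off u≢v))

    ∖-off : ∀ U v u → (U ∖ v) u ≡ false → U u ≡ false ⊎ u ≡ v
    ∖-off U v u e with u Fin.≟ v
    ... | yes p = inj₂ p
    ... | no _ with U u
    ...   | false = inj₁ refl

    mrg-single : ∀ v (σ τ : Col) → mrg (single v) σ τ ≡ σ [ v ]≔ lookup τ v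
    mrg-single v σ τ = mrg-unique (single v) σ τ (σ [ v ]≔ lookup τ v) on off
      where
      on : ∀ u → single v u ≡ true → lookup τ u ≡ lookup (σ [ v ]≔ lookup τ v) u
      on u e with ==⁻ {a = u} {v} (subst T (sym e) _)
      ... | refl = sym (lookup∘update v σ (lookup τ v))
      off : ∀ u → single v u ≡ false → lookup σ u ≡ lookup (σ [ v ]≔ lookup τ v) u
      off u e = sym (lookup∘update′ u≢v σ (lookup τ v))
        where
        u≢v : u ≢ v
        u≢v refl with () ← trans (sym (single-on v)) e

    mrg-update : ∀ (U : VSet) v → U v ≡ true → ∀ (σ τ : Col) c → mrg U σ (τ [ v ]≔ c) ≡ mrg U σ τ [ v ]≔ c
    mrg-update U v Uv σ τ c = lookup-ext λ u → pointwise u (u Fin.≟ v)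
      where
      pointwise : ∀ u → Dec (u ≡ v) → lookup (mrg U σ (τ [ v ]≔ c)) u ≡ lookup (mrg U σ τ [ v ]≔ c) u
      pointwise u (yes refl) = trans (lookup-mrg-on U σ (τ [ v ]≔ c) Uv) (trans (lookup∘update v τ c) (sym (lookup∘update v (mrg U σ τ) c)))
      pointwise u (no u≢v) = trans (lookup-mrg U σ (τ [ v ]≔ c) u)
        (trans (cong (λ x → if U u then x else lookup σ u) (lookup∘update′ u≢v τ c))
          (trans (sym (lookup-mrg U σ τ u)) (sym (lookup∘update′ u≢v (mrg U σ τ) c))))

    Z≤∣C∣ : ∀ U σ → Z U σ ≤ ∣C∣ n q
    Z≤∣C∣ U σ = ∑-mono cs λ τ → 𝟙≤1 (isProper G (mrg U σ τ))

    D-cong : ∀ U {f g} → (∀ σ → f σ ≡ g σ) → D U f ≡ D U g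
    D-cong U {f} {g} e = cong₂ _-_ (⟪⟫-cong f g f g (λ σ _ → e σ) (λ σ _ → e σ))
      (⟪⟫-cong f g (E U f) (E U g) (λ σ _ → e σ) (λ σ _ → cong (recip (Z U σ) *_) (∑-cong cs λ τ → cong (w (mrg U σ τ) *_) (e (mrg U σ τ)))))

    module Bounded {Δ d : ℕ} (degree≤ : ∀ v → degree G v ℕ.≤ Δ) (q≡ : q ≡ Δ ℕ.+ d) (2≤d : 2 ℕ.≤ d) where

      open Slack {Δ} {d} degree≤ q≡ 2≤d public

      0<ιd : 0ℚ < ι d
      0<ιd = ι-pos (ℕₚ.≤-trans (ℕ.s≤s ℕ.z≤n) 2≤d)

      -- Resampling `v` once more, `d*w≤` shows that each colour at `v` has conditional probability
      -- at most 1/d.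
      marginal-bound : ∀ U v → U v ≡ true → ∀ σ (H : Fin q → ℚ) → (∀ c → 0ℚ ≤ H c) →
                       ι d * S (λ τ → w (mrg U σ τ) * H (lookup τ v)) ≤ Z U σ * ∑ᶠ q H
      marginal-bound U v Uv σ H H≥0 = pos-cancel 0<ιq (begin
        ι q * (ι d * S F)  ≡⟨ *-leftComm (ι q) (ι d) (S F) ⟩
        ι d * (ι q * S F)  ≡⟨ cong (ι d *_) (∑ᶜ-resample F v) ⟨
        ι d * S (λ τ → ∑ᶠ q (λ c → F (τ [ v ]≔ c)))  ≡⟨ ∑-* cs (ι d) (λ τ → ∑ᶠ q (λ c → F (τ [ v ]≔ c))) ⟨
        S (λ τ → ι d * ∑ᶠ q (λ c → F (τ [ v ]≔ c)))  ≡⟨ ∑-cong cs (λ τ → trans (sym (∑-* (allFin q) (ι d) (λ c → F (τ [ v ]≔ c)))) (∑-cong (allFin q) (λ c → resampled τ c))) ⟩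
        S (λ τ → ∑ᶠ q (λ c → (ι d * w (mrg U σ τ [ v ]≔ c)) * H c))  ≤⟨ ∑-mono cs (λ τ → ∑-mono (allFin q) (λ c → *-monoˡ (H≥0 c) (d*w≤ (mrg U σ τ) v c))) ⟩
        S (λ τ → ∑ᶠ q (λ c → X τ * H c))  ≡⟨ ∑-cong cs (λ τ → ∑-* (allFin q) (X τ) H) ⟩
        S (λ τ → X τ * ∑ᶠ q H)  ≡⟨ ∑-*ʳ cs (∑ᶠ q H) X ⟩
        S X * ∑ᶠ q H  ≡⟨ cong (_* ∑ᶠ q H) (trans (∑-cong cs (λ τ → ∑-cong (allFin q) (λ c → cong w (sym (mrg-update U v Uv σ τ c))))) (∑ᶜ-resample (λ τ → w (mrg U σ τ)) v)) ⟩
        ι q * Z U σ * ∑ᶠ q H  ≡⟨ *-assoc (ι q) (Z U σ) (∑ᶠ q H) ⟩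
        ι q * (Z U σ * ∑ᶠ q H)  ∎)
        where
        open ≤-Reasoning
        F X : Fn
        F τ = w (mrg U σ τ) * H (lookup τ v)
        X τ = ∑ᶠ q (λ c → w (mrg U σ τ [ v ]≔ c))
        resampled : ∀ τ c → ι d * F (τ [ v ]≔ c) ≡ (ι d * w (mrg U σ τ [ v ]≔ c)) * H c
        resampled τ c = trans (cong₂ (λ x y → ι d * (w x * H y)) (mrg-update U v Uv σ τ c) (lookup∘update v τ c)) (sym (*-assoc (ι d) (w (mrg U σ τ [ v ]≔ c)) (H c)))

      module _ (U : VSet) (v : Fin n) (Uv : U v ≡ true) (f : Fn) where

        private
          g : Fn
          g = E (U ∖ v) f

          H : Col → Fin q → ℚ
          H σ c = w (σ [ v ]≔ c) * ((g σ - g (σ [ v ]≔ c)) * (g σ - g (σ [ v ]≔ c)))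

          H≥0 : ∀ σ c → 0ℚ ≤ H σ c
          H≥0 σ c = *-nonneg (w-nonneg (σ [ v ]≔ c)) (sq-nonneg (g σ - g (σ [ v ]≔ c)))

          g-recolour : ∀ {u} → U u ≡ true → u ≢ v → ∀ σ c → g (σ [ u ]≔ c) ≡ g σ
          g-recolour Uu u≢v σ c = E-agree (U ∖ v) f (σ [ _ ]≔ c) σ (recolour-agree (U ∖ v) σ c (∖-on {U} Uu u≢v))

          g-mrg : ∀ σ τ → g (mrg U σ τ) ≡ g (σ [ v ]≔ lookup τ v)
          g-mrg σ τ = E-agree (U ∖ v) f (mrg U σ τ) (σ [ v ]≔ lookup τ v) λ u e → agree u (∖-off U v u e) (u Fin.≟ v)
            where
            agree : ∀ u → U u ≡ false ⊎ u ≡ v → Dec (u ≡ v) → lookup (mrg U σ τ) u ≡ lookup (σ [ v ]≔ lookup τ v) u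
            agree u _        (yes refl) = trans (lookup-mrg-on U σ τ Uv) (sym (lookup∘update v σ (lookup τ v)))
            agree u (inj₂ p) (no u≢v)   = ⊥-elim (u≢v p)
            agree u (inj₁ e) (no u≢v)   = trans (lookup-mrg-off U σ τ e) (sym (lookup∘update′ u≢v σ (lookup τ v)))

          -- For fixed `τ`, the summand of `D-pairs` as a function of `σ`, with the factor `w σ` set
          -- aside. It is the weight given to `Avoidance`, where the colour to be avoided is that of
          -- `τ` at `v`.
          R : Col → Fn
          R τ σ = w (mrg U σ τ) * (recip (Z U σ) * ((g σ - g (mrg U σ τ)) * (g σ - g (mrg U σ τ))))

          R≥0 : ∀ τ σ → 0ℚ ≤ R τ σ
          R≥0 τ σ = *-nonneg (w-nonneg (mrg U σ τ)) (*-nonneg (recip-nonneg (Z-nonneg U σ)) (sq-nonneg (g σ - g (mrg U σ τ))))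

          -- A neighbour inside `U` is overwritten by `mrg` and ignored by `g`. A neighbour outside
          -- `U` keeps its colour in `mrg U σ τ`, which has `lookup τ v` at `v`; properness of that
          -- colouring forces the two colours apart.
          R-step : ∀ τ u → T (adj G v u) → (∀ σ c → R τ (σ [ u ]≔ c) ≡ R τ σ) ⊎ (∀ σ → 𝟙 (not (lookup σ u == lookup τ v)) * R τ σ ≡ R τ σ)
          R-step τ u vu = byCase (U u) refl
            where
            byCase : ∀ b → U u ≡ b → (∀ σ c → R τ (σ [ u ]≔ c) ≡ R τ σ) ⊎ (∀ σ → 𝟙 (not (lookup σ u == lookup τ v)) * R τ σ ≡ R τ σ)
            byCase true Uu = inj₁ λ σ c → trans
              (cong₂ (λ x z → w x * (recip z * ((g (σ [ u ]≔ c) - g x) * (g (σ [ u ]≔ c) - g x))))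
                (mrg-agree U (σ [ u ]≔ c) σ (recolour-agree U σ c Uu) τ) (∑-cong cs λ ρ → cong w (mrg-agree U (σ [ u ]≔ c) σ (recolour-agree U σ c Uu) ρ)))
              (cong (λ y → w (mrg U σ τ) * (recip (Z U σ) * ((y - g (mrg U σ τ)) * (y - g (mrg U σ τ))))) (g-recolour Uu (λ u≡v → adj⇒≢ vu (sym u≡v)) σ c))
            byCase false Uu = inj₂ λ σ → let x = 𝟙 (not (lookup σ u == lookup τ v)); r = recip (Z U σ) * ((g σ - g (mrg U σ τ)) * (g σ - g (mrg U σ τ))) in
              trans (*-leftComm x (w (mrg U σ τ)) r)
                (trans (𝟙-under (isProper G (mrg U σ τ)) {x * r} {r} (λ p → trans (cong (_* r) (𝟙-true {not (lookup σ u == lookup τ v)} (T-not⁺ {lookup σ u == lookup τ v} (λ t → differ σ (proper⁻ {mrg U σ τ} p) (==⁻ t))))) (*-identityˡ r)))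
                  refl)
              where
              differ : ∀ σ → IsP (mrg U σ τ) → lookup σ u ≢ lookup τ v
              differ σ p e = p v u vu (trans (lookup-mrg-on U σ τ Uv) (trans (sym e) (sym (lookup-mrg-off U σ τ Uu))))

          -- For a factor 2^Δ, `Avoidance` makes the colour of `τ` at `v` available in `σ`, so that
          -- each pair turns into a single move. Then `marginal-bound` trades that random colour for
          -- a sum over all colours, gaining 1/d, and `Z U σ` cancels.
          below : ι d * (2ℚ * D U g) ≤ ι (2 ℕ.^ Δ) * S (λ σ → w σ * ∑ᶠ q (H σ))
          below = begin
            ι d * (2ℚ * D U g)
              ≡⟨ cong (ι d *_) (trans (D-pairs U g) (trans (∑-swap cs cs (λ σ τ → w σ * w (mrg U σ τ) * recip (Z U σ) * ((g σ - g (mrg U σ τ)) * (g σ - g (mrg U σ τ))))) (∑-cong cs (λ τ → ∑-cong cs (λ σ → eq₁ (w σ) (w (mrg U σ τ)) (recip (Z U σ)) ((g σ - g (mrg U σ τ)) * (g σ - g (mrg U σ τ)))))))) ⟩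
            ι d * S (λ τ → S (λ σ → w σ * R τ σ))
              ≤⟨ *-monoʳ (ι-nonneg d) (∑-mono cs λ τ → ≤-trans (Avoidance.avoid-all v (lookup τ v) (R τ) (R≥0 τ) (R-step τ)) (*-monoˡ (S-nonneg τ) (ι-mono (ℕₚ.^-monoʳ-≤ 2 (degree≤ v))))) ⟩
            ι d * S (λ τ → ι (2 ℕ.^ Δ) * S (λ σ → w σ * 𝟙 (available G σ v (lookup τ v)) * R τ σ))
              ≡⟨ cong (ι d *_) (trans (∑-* cs (ι (2 ℕ.^ Δ)) (λ τ → S (λ σ → w σ * 𝟙 (available G σ v (lookup τ v)) * R τ σ))) (cong (ι (2 ℕ.^ Δ) *_) (trans (∑-swap cs cs (λ τ σ → w σ * 𝟙 (available G σ v (lookup τ v)) * R τ σ)) (∑-cong cs (λ σ → trans (∑-cong cs (λ τ → regroup σ τ)) (∑-* cs (w σ * recip (Z U σ)) (λ τ → w (mrg U σ τ) * H σ (lookup τ v)))))))) ⟩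
            ι d * (ι (2 ℕ.^ Δ) * S (λ σ → w σ * recip (Z U σ) * S (λ τ → w (mrg U σ τ) * H σ (lookup τ v))))
              ≡⟨ trans (*-leftComm (ι d) (ι (2 ℕ.^ Δ)) (S (λ σ → w σ * recip (Z U σ) * S (λ τ → w (mrg U σ τ) * H σ (lookup τ v))))) (cong (ι (2 ℕ.^ Δ) *_) (sym (∑-* cs (ι d) (λ σ → w σ * recip (Z U σ) * S (λ τ → w (mrg U σ τ) * H σ (lookup τ v)))))) ⟩
            ι (2 ℕ.^ Δ) * S (λ σ → ι d * (w σ * recip (Z U σ) * S (λ τ → w (mrg U σ τ) * H σ (lookup τ v))))
              ≤⟨ *-monoʳ (ι-nonneg (2 ℕ.^ Δ)) (∑-mono cs λ σ → ≤-trans (≤-reflexive (*-leftComm (ι d) (w σ * recip (Z U σ)) (S (λ τ → w (mrg U σ τ) * H σ (lookup τ v))))) (*-monoʳ (*-nonneg (w-nonneg σ) (recip-nonneg (Z-nonneg U σ))) (marginal-bound U v Uv σ (H σ) (H≥0 σ)))) ⟩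
            ι (2 ℕ.^ Δ) * S (λ σ → w σ * recip (Z U σ) * (Z U σ * ∑ᶠ q (H σ)))
              ≡⟨ cong (ι (2 ℕ.^ Δ) *_) (∑-cong cs λ σ → trans (eq₃ (w σ) (recip (Z U σ)) (Z U σ) (∑ᶠ q (H σ))) (𝟙-under (isProper G σ) (λ p → trans (cong (_* ∑ᶠ q (H σ)) (recip-inverseˡ (Z≢0 U σ p))) (*-identityˡ (∑ᶠ q (H σ)))))) ⟩
            ι (2 ℕ.^ Δ) * S (λ σ → w σ * ∑ᶠ q (H σ)) ∎
            where
            open ≤-Reasoning
            eq₁ : ∀ a b c d → a * b * c * d ≡ a * (b * (c * d))
            eq₁ = solve-∀ ℚ-ring
            eq₃ : ∀ a b c d → a * b * (c * d) ≡ a * (b * c * d)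
            eq₃ = solve-∀ ℚ-ring
            eq₄ : ∀ a b c d e → a * b * (c * (d * e)) ≡ a * (b * (c * (d * e)))
            eq₄ = solve-∀ ℚ-ring
            eq₅ : ∀ a b c d e → a * (b * (c * (d * e))) ≡ a * d * (c * (b * e))
            eq₅ = solve-∀ ℚ-ring
            S-nonneg : ∀ τ → 0ℚ ≤ S (λ σ → w σ * 𝟙 (available G σ v (lookup τ v)) * R τ σ)
            S-nonneg τ = ∑-nonneg cs λ σ → *-nonneg (*-nonneg (w-nonneg σ) (𝟙-nonneg (available G σ v (lookup τ v)))) (R≥0 τ σ)
            regroup : ∀ σ τ → w σ * 𝟙 (available G σ v (lookup τ v)) * R τ σ ≡ w σ * recip (Z U σ) * (w (mrg U σ τ) * H σ (lookup τ v))
            regroup σ τ = trans (eq₄ (w σ) (𝟙 (available G σ v (lookup τ v))) (w (mrg U σ τ)) (recip (Z U σ)) ((g σ - g (mrg U σ τ)) * (g σ - g (mrg U σ τ))))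
              (trans (𝟙-under (isProper G σ) (λ p → cong₂ (λ a y → a * (w (mrg U σ τ) * (recip (Z U σ) * ((g σ - y) * (g σ - y))))) (sym (w-available {σ} v (lookup τ v) (proper⁻ {σ} p))) (g-mrg σ τ)))
                (eq₅ (w σ) (w (σ [ v ]≔ lookup τ v)) (w (mrg U σ τ)) (recip (Z U σ)) ((g σ - g (σ [ v ]≔ lookup τ v)) * (g σ - g (σ [ v ]≔ lookup τ v)))))

          -- At most all `q` colours are available at `v`, in the form `Z₁ σ ≤ ∣C∣ n q`, so the
          -- average over `v` alone weighs each available colour by at least 1/q.
          above : S (λ σ → w σ * ∑ᶠ q (H σ)) ≤ ι q * (2ℚ * D (single v) g)
          above = begin
            S (λ σ → w σ * ∑ᶠ q (H σ))
              ≤⟨ ∑-mono cs (λ σ → 𝟙-under-≤ (isProper G σ) (pointwise σ)) ⟩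
            S (λ σ → w σ * (recip (Z₁ σ) * (∣C∣ n q * ∑ᶠ q (H σ))))
              ≡⟨ ∑-cong cs (λ σ → trans (cong (λ x → w σ * (recip (Z₁ σ) * x)) (sym (∑ᶜ-marginal (H σ) v))) (eq₁ (w σ) (recip (Z₁ σ)) (ι q) (S (λ τ → H σ (lookup τ v))))) ⟩
            S (λ σ → ι q * (w σ * recip (Z₁ σ) * S (λ τ → H σ (lookup τ v))))
              ≡⟨ trans (∑-* cs (ι q) (λ σ → w σ * recip (Z₁ σ) * S (λ τ → H σ (lookup τ v)))) (cong (ι q *_) (∑-cong cs (λ σ → trans (sym (∑-* cs (w σ * recip (Z₁ σ)) (λ τ → H σ (lookup τ v)))) (∑-cong cs (λ τ → regroup σ τ))))) ⟩
            ι q * S (λ σ → S (λ τ → w σ * w (m σ τ) * recip (Z₁ σ) * ((g σ - g (m σ τ)) * (g σ - g (m σ τ)))))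
              ≡⟨ cong (ι q *_) (D-pairs (single v) g) ⟨
            ι q * (2ℚ * D (single v) g) ∎
            where
            open ≤-Reasoning
            Z₁ : Fn
            Z₁ = Z (single v)
            m : Col → Col → Col
            m = mrg (single v)
            eq₁ : ∀ a b c d → a * (b * (c * d)) ≡ c * (a * b * d)
            eq₁ = solve-∀ ℚ-ring
            eq₂ : ∀ a b c d → a * b * (c * d) ≡ a * c * b * d
            eq₂ = solve-∀ ℚ-ring
            ∑H≥0 : ∀ σ → 0ℚ ≤ ∑ᶠ q (H σ)
            ∑H≥0 σ = ∑-nonneg (allFin q) (H≥0 σ)
            pointwise : ∀ σ → Proper G σ → ∑ᶠ q (H σ) ≤ recip (Z₁ σ) * (∣C∣ n q * ∑ᶠ q (H σ))
            pointwise σ p = subst (_≤ recip (Z₁ σ) * (∣C∣ n q * ∑ᶠ q (H σ)))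
              (trans (sym (*-assoc (recip (Z₁ σ)) (Z₁ σ) (∑ᶠ q (H σ)))) (trans (cong (_* ∑ᶠ q (H σ)) (recip-inverseˡ (Z≢0 (single v) σ p))) (*-identityˡ (∑ᶠ q (H σ)))))
              (*-monoʳ (recip-nonneg (Z-nonneg (single v) σ)) (*-monoˡ (∑H≥0 σ) (Z≤∣C∣ (single v) σ)))
            regroup : ∀ σ τ → w σ * recip (Z₁ σ) * H σ (lookup τ v) ≡ w σ * w (m σ τ) * recip (Z₁ σ) * ((g σ - g (m σ τ)) * (g σ - g (m σ τ)))
            regroup σ τ = trans (eq₂ (w σ) (recip (Z₁ σ)) (w (σ [ v ]≔ lookup τ v)) ((g σ - g (σ [ v ]≔ lookup τ v)) * (g σ - g (σ [ v ]≔ lookup τ v))))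
              (cong (λ x → w σ * w x * recip (Z₁ σ) * ((g σ - g x) * (g σ - g x))) (sym (mrg-single v σ τ)))

        q≤d*2^Δ : q ℕ.≤ d ℕ.* 2 ℕ.^ Δ
        q≤d*2^Δ = subst (ℕ._≤ d ℕ.* 2 ℕ.^ Δ) (sym q≡) (ℕₚ.≤-trans (go Δ) (ℕₚ.*-monoʳ-≤ d (n<2^n Δ)))
          where
          go : ∀ Δ → Δ ℕ.+ d ℕ.≤ d ℕ.* suc Δ
          go Δ = subst (Δ ℕ.+ d ℕ.≤_) (trans (ℕₚ.+-comm (d ℕ.* Δ) d) (sym (ℕₚ.*-suc d Δ)))
            (ℕₚ.+-monoˡ-≤ d (subst (ℕ._≤ d ℕ.* Δ) (ℕₚ.*-identityˡ Δ) (ℕₚ.*-monoˡ-≤ Δ (ℕₚ.≤-trans (ℕ.s≤s ℕ.z≤n) 2≤d))))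

        -- One 2^Δ is the price of avoidance. The other bounds q/d, since Δ + d ≤ d (1 + Δ); thus
        -- `d`, and with it `q`, cancels.
        D-oneSite : D U g ≤ ι (4 ℕ.^ Δ) * D (single v) g
        D-oneSite = pos-cancel (positive⁻¹ 2ℚ) (pos-cancel 0<ιd (begin
          ι d * (2ℚ * D U g)  ≤⟨ below ⟩
          ι (2 ℕ.^ Δ) * S (λ σ → w σ * ∑ᶠ q (H σ))  ≤⟨ *-monoʳ (ι-nonneg (2 ℕ.^ Δ)) (≤-trans above (*-monoˡ (*-nonneg 0≤2 (D-nonneg (single v) g)) (≤-trans (ι-mono q≤d*2^Δ) (≤-reflexive (ι-* d (2 ℕ.^ Δ)))))) ⟩
          ι (2 ℕ.^ Δ) * (ι d * ι (2 ℕ.^ Δ) * (2ℚ * D (single v) g))  ≡⟨ eq (ι (2 ℕ.^ Δ)) (ι d) 2ℚ (D (single v) g) ⟩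
          ι d * (2ℚ * (ι (2 ℕ.^ Δ) * ι (2 ℕ.^ Δ) * D (single v) g))  ≡⟨ cong (λ x → ι d * (2ℚ * (x * D (single v) g))) (trans (sym (ι-* (2 ℕ.^ Δ) (2 ℕ.^ Δ))) (cong ι 2^Δ*2^Δ)) ⟩
          ι d * (2ℚ * (ι (4 ℕ.^ Δ) * D (single v) g))  ∎))
          where
          open ≤-Reasoning
          2^Δ*2^Δ : 2 ℕ.^ Δ ℕ.* 2 ℕ.^ Δ ≡ 4 ℕ.^ Δ
          2^Δ*2^Δ = trans (sym (ℕₚ.^-distribˡ-+-* 2 Δ Δ)) (trans (cong (λ k → 2 ℕ.^ (Δ ℕ.+ k)) (sym (ℕₚ.+-identityʳ Δ))) (sym (ℕₚ.^-*-assoc 2 2 Δ)))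
          eq : ∀ a b c d → a * (b * a * (c * d)) ≡ b * (c * (a * a * d))
          eq = solve-∀ ℚ-ring

        -- The tower splits off the variance of `g`, which moves at `v` control. To return from `g`
        -- to `f`, write g = f - (f - g): the squared norm of f - g is the variance on the smaller
        -- set, which is already present. With K = 4^Δ ≥ 1 the coefficients 1 + 2K and 2K are at
        -- most 4K.
        D-remove : D U f ≤ ι (4 ℕ.^ suc Δ) * (D (U ∖ v) f + D (single v) f)
        D-remove = begin
          D U f  ≡⟨ D-tower (∖-⊆ U v) f ⟩
          D′ + D U g  ≤⟨ +-monoʳ-≤ D′ (≤-trans D-oneSite (*-monoʳ (ι-nonneg (4 ℕ.^ Δ)) oneSite)) ⟩
          D′ + K * (2ℚ * Dᵥ + 2ℚ * D′)  ≤⟨ diff⇒≤ (subst (0ℚ ≤_) (eq K D′ Dᵥ) (+-nonneg (*-nonneg (≤⇒diff 1≤K) (D-nonneg (U ∖ v) f)) (+-nonneg (*-nonneg K≥0 (D-nonneg (U ∖ v) f)) (*-nonneg (*-nonneg 0≤2 K≥0) (D-nonneg (single v) f))))) ⟩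
          ι 4 * K * (D′ + Dᵥ)  ≡⟨ cong (_* (D′ + Dᵥ)) (ι-* 4 (4 ℕ.^ Δ)) ⟨
          ι (4 ℕ.^ suc Δ) * (D′ + Dᵥ)  ∎
          where
          open ≤-Reasoning
          D′ Dᵥ K : ℚ
          D′ = D (U ∖ v) f
          Dᵥ = D (single v) f
          K = ι (4 ℕ.^ Δ)
          K≥0 : 0ℚ ≤ K
          K≥0 = ι-nonneg (4 ℕ.^ Δ)
          1≤K : 1ℚ ≤ K
          1≤K = ι-mono (ℕₚ.m^n>0 4 Δ)
          eq : ∀ k a b → (k - 1ℚ) * a + (k * a + (1ℚ + 1ℚ) * k * b) ≡ (1ℚ + (1ℚ + (1ℚ + (1ℚ + 0ℚ)))) * k * (a + b) - (a + k * ((1ℚ + 1ℚ) * b + (1ℚ + 1ℚ) * a))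
          eq = solve-∀ ℚ-ring
          oneSite : D (single v) g ≤ 2ℚ * Dᵥ + 2ℚ * D′
          oneSite = ≤-trans (≤-reflexive (D-cong (single v) (λ σ → a-[a-b] (f σ) (g σ))))
            (≤-trans (D-⊖ (single v) f (f ⊖ g)) (+-monoʳ-≤ (2ℚ * Dᵥ) (*-monoʳ 0≤2 (≤-trans (D≤norm (single v) (f ⊖ g)) (≤-reflexive (sym (D≡ (U ∖ v) f)))))))

  -- The Poincaré inequality along an elimination.

  module Poincaré {n : ℕ} (q : ℕ) (G : Graph n) {Δ d : ℕ}
    (degree≤ : ∀ v → degree G v ℕ.≤ Δ) (q≡ : q ≡ Δ ℕ.+ d) (2≤d : 2 ℕ.≤ d) where

    open Removal q G
    open Bounded {Δ} {d} degree≤ q≡ 2≤d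

    module _ (f : Fn) where

      local : VSet → ℚ
      local U = ∑ᶠ n (λ u → 𝟙 (U u) * D (single u) f)

      local-nonneg : ∀ U → 0ℚ ≤ local U
      local-nonneg U = ∑-nonneg (allFin n) λ u → *-nonneg (𝟙-nonneg (U u)) (D-nonneg (single u) f)

      factor : ℕ → ℚ
      factor k = ι ((4 ℕ.^ suc Δ) ℕ.^ k)

      factor-nonneg : ∀ k → 0ℚ ≤ factor k
      factor-nonneg k = ι-nonneg ((4 ℕ.^ suc Δ) ℕ.^ k)

      factor-suc : ∀ k → factor (suc k) ≡ ι (4 ℕ.^ suc Δ) * factor k
      factor-suc k = ι-* (4 ℕ.^ suc Δ) ((4 ℕ.^ suc Δ) ℕ.^ k)

      1≤K^ : ∀ k → 1 ℕ.≤ (4 ℕ.^ suc Δ) ℕ.^ k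
      1≤K^ k = ℕₚ.m^n>0 (4 ℕ.^ suc Δ) {{ℕₚ.m^n≢0 4 (suc Δ)}} k

      local-remove : ∀ {U v} → U v ≡ true → local U ≡ local (U ∖ v) + D (single v) f
      local-remove {U} {v} Uv = trans (∑-cong (allFin n) λ u → pointwise u (u Fin.≟ v))
        (trans (∑-+ (allFin n) _ _) (cong (local (U ∖ v) +_)
          (trans (∑ᶠ-single v (λ u u≢v → trans (cong (λ b → 𝟙 b * D (single u) f) (single-off u≢v)) (*-zeroˡ (D (single u) f))))
            (trans (cong (λ b → 𝟙 b * D (single v) f) (single-on v)) (*-identityˡ (D (single v) f))))))
        where
        pointwise : ∀ u → Dec (u ≡ v) → 𝟙 (U u) * D (single u) f ≡ 𝟙 ((U ∖ v) u) * D (single u) f + 𝟙 (single v u) * D (single u) f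
        pointwise u (yes refl) rewrite Uv | single-on u = eq (D (single u) f)
          where
          eq : ∀ x → 1ℚ * x ≡ 0ℚ * x + 1ℚ * x
          eq = solve-∀ ℚ-ring
        pointwise u (no u≢v) rewrite single-off u≢v | ∧-identityʳ (U u) = eq (𝟙 (U u)) (D (single u) f)
          where
          eq : ∀ a x → a * x ≡ a * x + 0ℚ * x
          eq = solve-∀ ℚ-ring

      local-split : ∀ {U} U₁ U₂ → (∀ u → U u ≡ U₁ u ∨ U₂ u) → (∀ u → U₁ u ≡ true → U₂ u ≡ false) → local U ≡ local U₁ + local U₂
      local-split {U} U₁ U₂ U≡ disj = trans (∑-cong (allFin n) λ u → trans (cong (_* D (single u) f) (trans (cong 𝟙 (U≡ u)) (bit (U₁ u) (U₂ u) (disj u)))) (*-distribʳ-+ (D (single u) f) (𝟙 (U₁ u)) (𝟙 (U₂ u)))) (∑-+ (allFin n) _ _)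
        where
        bit : ∀ a b → (a ≡ true → b ≡ false) → 𝟙 (a ∨ b) ≡ 𝟙 a + 𝟙 b
        bit true  b h rewrite h refl = refl
        bit false b h = sym (+-identityˡ (𝟙 b))

      -- Each deletion costs one factor 4^(Δ+1). At a split both sides carry the same factor and
      -- their local forms add up, so the exponent is the number of rounds and not of deleted
      -- vertices.
      poincaré : ∀ {U k} → Elim G U k → D U f ≤ factor k * local U
      poincaré {U} {k} (empty none) = ≤-trans (≤-reflexive zero-D) (*-nonneg (factor-nonneg k) (local-nonneg U))
        where
        fixed : ∀ σ τ → mrg U σ τ ≡ σ
        fixed σ τ = mrg-unique U σ τ σ (λ u e → ⊥-elim (true≢false (trans (sym e) (none u)))) (λ _ _ → refl)
          where
          true≢false : true ≢ false
          true≢false ()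
        zero-D : D U f ≡ 0ℚ
        zero-D = trans (cong (λ x → ⟪ f , f ⟫ - x) (⟪⟫-congʳ f (E U f) f (λ σ p → E-fix U f σ p (λ τ → cong f (fixed σ τ))))) (+-inverseʳ ⟪ f , f ⟫)
      poincaré {U} {suc k} (weaken e) = ≤-trans (poincaré e) (*-monoˡ (local-nonneg U) (ι-mono
        (ℕₚ.m≤n*m ((4 ℕ.^ suc Δ) ℕ.^ k) (4 ℕ.^ suc Δ) {{ℕₚ.m^n≢0 4 (suc Δ)}})))
      poincaré {U} {suc k} (remove v Uv e) = begin
        D U f  ≤⟨ D-remove U v Uv f ⟩
        K * (D (U ∖ v) f + Dᵥ)  ≤⟨ *-monoʳ (ι-nonneg (4 ℕ.^ suc Δ)) (+-mono-≤ (poincaré e) (≤-trans (≤-reflexive (sym (*-identityˡ Dᵥ))) (*-monoˡ (D-nonneg (single v) f) (ι-mono (1≤K^ k))))) ⟩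
        K * (factor k * local (U ∖ v) + factor k * Dᵥ)  ≡⟨ eq K (factor k) (local (U ∖ v)) Dᵥ ⟩
        K * factor k * (local (U ∖ v) + Dᵥ)  ≡⟨ cong₂ _*_ (factor-suc k) (local-remove {U} Uv) ⟨
        factor (suc k) * local U  ∎
        where
        open ≤-Reasoning
        K Dᵥ : ℚ
        K = ι (4 ℕ.^ suc Δ)
        Dᵥ = D (single v) f
        eq : ∀ a b c d → a * (b * c + b * d) ≡ a * b * (c + d)
        eq = solve-∀ ℚ-ring
      poincaré {U} {k} (split U₁ U₂ U≡ disj sep e₁ e₂) = begin
        D U f  ≤⟨ Splitting.D-split q G U U₁ U₂ U≡ disj sep f ⟩
        D U₁ f + D U₂ f  ≤⟨ +-mono-≤ (poincaré e₁) (poincaré e₂) ⟩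
        factor k * local U₁ + factor k * local U₂  ≡⟨ *-distribˡ-+ (factor k) (local U₁) (local U₂) ⟨
        factor k * (local U₁ + local U₂)  ≡⟨ cong (factor k *_) (local-split U₁ U₂ U≡ disj) ⟨
        factor k * local U  ∎
        where open ≤-Reasoning

  -- The Glauber operator on functions and its duality with distributions.

  sgn : ℚ → ℚ
  sgn x = if ⌊ 0ℚ ℚ.≤? x ⌋ then 1ℚ else - 1ℚ

  ∣∣≡*sgn : ∀ x → ℚ.∣ x ∣ ≡ x * sgn x
  ∣∣≡*sgn x with 0ℚ ℚ.≤? x
  ... | yes p = trans (0≤p⇒∣p∣≡p p) (sym (*-identityʳ x))
  ... | no ¬p = trans (sym (∣-p∣≡∣p∣ x)) (trans (0≤p⇒∣p∣≡p (neg-antimono-≤ (<⇒≤ (≰⇒> ¬p)))) (eq x))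
    where
    eq : ∀ x → - x ≡ x * - 1ℚ
    eq = solve-∀ ℚ-ring

  -- The sign of 0 is taken to be 1, so that a test function made of signs has squared norm exactly
  -- `N`.
  sgn²≡1 : ∀ x → sgn x * sgn x ≡ 1ℚ
  sgn²≡1 x with 0ℚ ℚ.≤? x
  ... | yes _ = refl
  ... | no  _ = refl

  ∣sgn∣≤1 : ∀ x → ℚ.∣ sgn x ∣ ≤ 1ℚ
  ∣sgn∣≤1 x with 0ℚ ℚ.≤? x
  ... | yes _ = ≤-refl
  ... | no  _ = ≤-refl

  module Glauber {n : ℕ} (q : ℕ) (G : Graph n) where

    open Removal q G public

    Pᵥ : Fin n → Fn → Fn
    Pᵥ v f σ = inv (numAvailable G σ v) * ∑ᶠ q (λ c → 𝟙 (available G σ v c) * f (σ [ v ]≔ c))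

    P : Fn → Fn
    P f σ = ∑ᶠ n (λ v → inv n * Pᵥ v f σ)

    agreeOff⁻ : ∀ {v} {σ τ : Col} → T (agreeOff v σ τ) → τ ≡ σ [ v ]≔ lookup τ v
    agreeOff⁻ {v} {σ} {τ} t = lookup-ext λ u → pointwise u (u Fin.≟ v)
      where
      pointwise : ∀ u → Dec (u ≡ v) → lookup τ u ≡ lookup (σ [ v ]≔ lookup τ v) u
      pointwise u (yes refl) = sym (lookup∘update v σ (lookup τ v))
      pointwise u (no u≢v) with Equivalence.to (T-∨ {u == v}) (allV⁻ n {λ u → (u == v) ∨ (lookup σ u == lookup τ u)} t u)
      ... | inj₁ e = ⊥-elim (u≢v (==⁻ e))
      ... | inj₂ e = trans (sym (==⁻ e)) (sym (lookup∘update′ u≢v σ (lookup τ v)))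

    agreeOff⁺ : ∀ v (σ : Col) c → T (agreeOff v σ (σ [ v ]≔ c))
    agreeOff⁺ v σ c = allV⁺ n {λ u → (u == v) ∨ (lookup σ u == lookup (σ [ v ]≔ c) u)} λ u → pointwise u (u Fin.≟ v)
      where
      pointwise : ∀ u → Dec (u ≡ v) → T ((u == v) ∨ (lookup σ u == lookup (σ [ v ]≔ c) u))
      pointwise u (yes e)   = Equivalence.from (T-∨ {u == v}) (inj₁ (==⁺ e))
      pointwise u (no u≢v) = Equivalence.from (T-∨ {u == v}) (inj₂ (==⁺ (sym (lookup∘update′ u≢v σ c))))

    -- For each `v` only the `q` recolourings of `σ` at `v` contribute.
    transition-dual : ∀ σ f → S (λ τ → transition G σ τ * f τ) ≡ P f σ
    transition-dual σ f = begin
      S (λ τ → transition G σ τ * f τ)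
        ≡⟨ ∑-cong cs (λ τ → sym (∑-*ʳ (allFin n) (f τ) (λ v → K v τ))) ⟩
      S (λ τ → ∑ᶠ n (λ v → K v τ * f τ))
        ≡⟨ ∑-swap cs (allFin n) (λ τ v → K v τ * f τ) ⟩
      ∑ᶠ n (λ v → S (λ τ → K v τ * f τ))
        ≡⟨ ∑-cong (allFin n) (λ v → trans (∑ᶜ-recolour v σ (λ τ τ≢ → trans (cong (_* f τ) (vanish v τ τ≢)) (*-zeroˡ (f τ)))) (trans (∑-cong (allFin q) (λ c → value v c)) (trans (∑-* (allFin q) (k v) (λ c → 𝟙 (available G σ v c) * f (σ [ v ]≔ c))) (*-assoc (inv n) (inv (numAvailable G σ v)) _)))) ⟩
      P f σ ∎
      where
      open ≡-Reasoning
      k : Fin n → ℚ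
      k v = inv n * inv (numAvailable G σ v)
      K : Fin n → Col → ℚ
      K v τ = if agreeOff v σ τ ∧ available G σ v (lookup τ v) then k v else 0ℚ
      vanish : ∀ v τ → τ ≢ σ [ v ]≔ lookup τ v → K v τ ≡ 0ℚ
      vanish v τ τ≢ with agreeOff v σ τ in eq
      ... | false = refl
      ... | true  = ⊥-elim (τ≢ (agreeOff⁻ {v} {σ} {τ} (subst T (sym eq) _)))
      eq : ∀ a b c → a * b * c ≡ b * (a * c)
      eq = solve-∀ ℚ-ring
      value : ∀ v c → K v (σ [ v ]≔ c) * f (σ [ v ]≔ c) ≡ k v * (𝟙 (available G σ v c) * f (σ [ v ]≔ c))
      value v c = trans (cong (_* f (σ [ v ]≔ c)) (trans (if-𝟙 (agreeOff v σ (σ [ v ]≔ c) ∧ available G σ v (lookup (σ [ v ]≔ c) v)) (k v))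
          (cong (_* k v) (trans (𝟙-∧ (agreeOff v σ (σ [ v ]≔ c)) (available G σ v (lookup (σ [ v ]≔ c) v)))
            (trans (cong₂ (λ x y → x * 𝟙 (available G σ v y)) (𝟙-true (agreeOff⁺ v σ c)) (lookup∘update v σ c)) (*-identityˡ (𝟙 (available G σ v c))))))))
        (eq (𝟙 (available G σ v c)) (k v) (f (σ [ v ]≔ c)))

    -- `P` is applied on the inside to match `distAfter`, whose outermost operation is the last step
    -- of the chain.
    pw : ℕ → Fn → Fn
    pw zero    f = f
    pw (suc s) f = pw s (P f)

    distAfter-dual : ∀ σ₀ s f → S (λ τ → distAfter G σ₀ s τ * f τ) ≡ pw s f σ₀
    distAfter-dual σ₀ zero f = trans (∑ᶜ-single σ₀ (λ τ τ≢ → trans (cong (_* f τ) (off τ τ≢)) (*-zeroˡ (f τ)))) (trans (cong (_* f σ₀) on) (*-identityˡ (f σ₀)))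
      where
      off : ∀ τ → τ ≢ σ₀ → distAfter G σ₀ zero τ ≡ 0ℚ
      off τ τ≢ with eqColoring σ₀ τ in eq
      ... | false = refl
      ... | true  = ⊥-elim (τ≢ (sym (lookup-ext λ u → ==⁻ (allV⁻ n {λ u → lookup σ₀ u == lookup τ u} (subst T (sym eq) _) u))))
      on : distAfter G σ₀ zero σ₀ ≡ 1ℚ
      on = trans (if-𝟙 (eqColoring σ₀ σ₀) 1ℚ) (trans (*-identityʳ _) (𝟙-true (allV⁺ n {λ u → lookup σ₀ u == lookup σ₀ u} λ u → ==⁺ {a = lookup σ₀ u} refl)))
    distAfter-dual σ₀ (suc s) f = begin
      S (λ τ → S (λ σ → distAfter G σ₀ s σ * transition G σ τ) * f τ)
        ≡⟨ ∑-cong cs (λ τ → trans (sym (∑-*ʳ cs (f τ) (λ σ → distAfter G σ₀ s σ * transition G σ τ))) (∑-cong cs (λ σ → *-assoc (distAfter G σ₀ s σ) (transition G σ τ) (f τ)))) ⟩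
      S (λ τ → S (λ σ → distAfter G σ₀ s σ * (transition G σ τ * f τ)))
        ≡⟨ ∑-swap cs cs (λ τ σ → distAfter G σ₀ s σ * (transition G σ τ * f τ)) ⟩
      S (λ σ → S (λ τ → distAfter G σ₀ s σ * (transition G σ τ * f τ)))
        ≡⟨ ∑-cong cs (λ σ → trans (∑-* cs (distAfter G σ₀ s σ) (λ τ → transition G σ τ * f τ)) (cong (distAfter G σ₀ s σ *_) (transition-dual σ f))) ⟩
      S (λ σ → distAfter G σ₀ s σ * P f σ)
        ≡⟨ distAfter-dual σ₀ s (P f) ⟩
      pw s (P f) σ₀ ∎
      where open ≡-Reasoning

    N : ℚ
    N = S w

    N≡ : N ≡ ι (numProper G q)
    N≡ = sym (∑-filter (isProper G) cs)

    one : Fn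
    one _ = 1ℚ

    𝔼 : Fn → ℚ
    𝔼 f = recip N * ⟪ one , f ⟫

    N≥1 : ∀ {σ} → Proper G σ → 1ℚ ≤ N
    N≥1 {σ} p = subst (_≤ N) (w-proper σ p) (term≤∑ᶜ w-nonneg σ)

    uniform-dual : ∀ {σ₀} → Proper G σ₀ → ∀ f → S (λ τ → uniformProper G τ * f τ) ≡ 𝔼 f
    uniform-dual {σ₀} p f = trans (∑-cong cs λ τ → trans (cong (_* f τ) (trans (if-𝟙 (isProper G τ) (inv (numProper G q))) (cong (w τ *_) inv≡))) (eq (w τ) (recip N) (f τ)))
      (∑-* cs (recip N) (λ τ → w τ * (1ℚ * f τ)))
      where
      1≤numProper : ∀ k → 1ℚ ≤ ι k → 1 ℕ.≤ k
      1≤numProper zero    h = ⊥-elim (≥1⇒≢0 h refl)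
      1≤numProper (suc k) h = ℕ.s≤s ℕ.z≤n
      inv≡ : inv (numProper G q) ≡ recip N
      inv≡ = trans (inv≡recip (1≤numProper (numProper G q) (subst (1ℚ ≤_) N≡ (N≥1 {σ₀} p)))) (cong recip (sym N≡))
      eq : ∀ a b c → a * b * c ≡ b * (a * (1ℚ * c))
      eq = solve-∀ ℚ-ring

    ℓ¹ : Col → ℕ → ℚ
    ℓ¹ σ₀ s = S (λ τ → ℚ.∣ distAfter G σ₀ s τ - uniformProper G τ ∣)

    test : Col → ℕ → Fn
    test σ₀ s τ = sgn (distAfter G σ₀ s τ - uniformProper G τ)

    -- The sign of the difference attains the ℓ¹ distance. This test function depends on `σ₀` and
    -- `s`, but the bounds derived from it use only that its values are 1 and -1.
    ℓ¹-dual : ∀ {σ₀} → Proper G σ₀ → ∀ s → ℓ¹ σ₀ s ≡ pw s (test σ₀ s) σ₀ - 𝔼 (test σ₀ s)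
    ℓ¹-dual {σ₀} p s = begin
      S (λ τ → ℚ.∣ a τ - b τ ∣)  ≡⟨ ∑-cong cs (λ τ → trans (∣∣≡*sgn (a τ - b τ)) (eq (a τ) (b τ) (f τ))) ⟩
      S (λ τ → a τ * f τ - b τ * f τ)  ≡⟨ ∑-minus cs (λ τ → a τ * f τ) (λ τ → b τ * f τ) ⟩
      S (λ τ → a τ * f τ) - S (λ τ → b τ * f τ) ≡⟨ cong₂ _-_ (distAfter-dual σ₀ s f) (uniform-dual {σ₀} p f) ⟩
      pw s f σ₀ - 𝔼 f  ∎
      where
      open ≡-Reasoning
      a b f : Fn
      a = distAfter G σ₀ s
      b = uniformProper G
      f = test σ₀ s
      eq : ∀ a b f → (a - b) * f ≡ a * f - b * f
      eq = solve-∀ ℚ-ring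

    module Chain (1≤n : 1 ℕ.≤ n) {Δ d : ℕ} (degree≤ : ∀ v → degree G v ℕ.≤ Δ) (q≡ : q ≡ Δ ℕ.+ d) (2≤d : 2 ℕ.≤ d) where

      open Bounded {Δ} {d} degree≤ q≡ 2≤d public

      ι-numAvailable : ∀ σ v → ι (numAvailable G σ v) ≡ av σ v
      ι-numAvailable σ v = ι-countV q (available G σ v)

      1≤numAvailable : ∀ σ v → 1 ℕ.≤ numAvailable G σ v
      1≤numAvailable σ v = go (numAvailable G σ v) (subst (ι d ≤_) (sym (ι-numAvailable σ v)) (d≤av σ v))
        where
        go : ∀ k → ι d ≤ ι k → 1 ℕ.≤ k
        go zero    h = ⊥-elim (<-irrefl refl (<-≤-trans 0<ιd h))
        go (suc k) h = ℕ.s≤s ℕ.z≤n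

      inv-av : ∀ σ v → inv (numAvailable G σ v) * av σ v ≡ 1ℚ
      inv-av σ v = subst (λ x → inv (numAvailable G σ v) * x ≡ 1ℚ) (ι-numAvailable σ v) (inv-ι (1≤numAvailable σ v))

      inv-n : inv n * ι n ≡ 1ℚ
      inv-n = inv-ι 1≤n

      -- Both sides average `f` over the colours available at `v`, one counting colours and the
      -- other colourings. By `∑ᶜ-marginal` the counts have the common ratio ∣C∣/q, and the proof
      -- cross-multiplies.
      Pᵥ≡E : ∀ v f σ → Proper G σ → Pᵥ v f σ ≡ E (single v) f σ
      Pᵥ≡E v f σ p = begin
        y * B  ≡⟨ trans (sym (*-identityˡ (y * B))) (cong (_* (y * B)) (sym (recip-inverseˡ (Z≢0 (single v) σ p)))) ⟩
        x * Z₁ * (y * B)  ≡⟨ eq₁ x Z₁ y B ⟩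
        x * y * (Z₁ * B)  ≡⟨ cong (x * y *_) cross ⟩
        x * y * (A₁ * av σ v)  ≡⟨ eq₂ x y A₁ (av σ v) ⟩
        y * av σ v * (x * A₁)  ≡⟨ trans (cong (_* (x * A₁)) (inv-av σ v)) (*-identityˡ (x * A₁)) ⟩
        x * A₁  ∎
        where
        open ≡-Reasoning
        Z₁ A₁ x y B : ℚ
        Z₁ = Z (single v) σ
        A₁ = A (single v) f σ
        x = recip Z₁
        y = inv (numAvailable G σ v)
        B = ∑ᶠ q (λ c → 𝟙 (available G σ v c) * f (σ [ v ]≔ c))
        w≡ : ∀ c → w (σ [ v ]≔ c) ≡ 𝟙 (available G σ v c)
        w≡ c = w-available {σ} v c (proper⁻ {σ} p)
        qZ : ι q * Z₁ ≡ ∣C∣ n q * av σ v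
        qZ = trans (cong (ι q *_) (∑-cong cs λ τ → trans (cong w (mrg-single v σ τ)) (w≡ (lookup τ v)))) (∑ᶜ-marginal (λ c → 𝟙 (available G σ v c)) v)
        qA : ι q * A₁ ≡ ∣C∣ n q * B
        qA = trans (cong (ι q *_) (∑-cong cs λ τ → trans (cong (λ x → w x * f x) (mrg-single v σ τ)) (cong (_* f (σ [ v ]≔ lookup τ v)) (w≡ (lookup τ v)))))
          (∑ᶜ-marginal (λ c → 𝟙 (available G σ v c) * f (σ [ v ]≔ c)) v)
        eq₁ : ∀ a b c d → a * b * (c * d) ≡ a * c * (b * d)
        eq₁ = solve-∀ ℚ-ring
        eq₂ : ∀ a b c d → a * b * (c * d) ≡ b * d * (a * c)
        eq₂ = solve-∀ ℚ-ring
        eq₃ : ∀ a b c → a * (b * c) ≡ a * b * c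
        eq₃ = solve-∀ ℚ-ring
        eq₄ : ∀ a b c → a * b * c ≡ a * c * b
        eq₄ = solve-∀ ℚ-ring
        cross : Z₁ * B ≡ A₁ * av σ v
        cross = begin
          Z₁ * B  ≡⟨ unit (Z₁ * B) ⟩
          inv q * (ι q * (Z₁ * B))  ≡⟨ cong (inv q *_) (trans (eq₃ (ι q) Z₁ B) (trans (cong (_* B) qZ) (trans (eq₄ (∣C∣ n q) (av σ v) B) (trans (cong (_* av σ v) (sym qA)) (sym (eq₃ (ι q) A₁ (av σ v))))))) ⟩
          inv q * (ι q * (A₁ * av σ v))  ≡⟨ unit (A₁ * av σ v) ⟨
          A₁ * av σ v  ∎
          where
          1≤q : 1 ℕ.≤ q
          1≤q = subst (1 ℕ.≤_) (sym q≡) (ℕₚ.≤-trans (ℕₚ.≤-trans (ℕ.s≤s ℕ.z≤n) 2≤d) (ℕₚ.m≤n+m d Δ))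
          unit : ∀ z → z ≡ inv q * (ι q * z)
          unit z = trans (sym (*-identityˡ z)) (trans (cong (_* z) (sym (inv-ι 1≤q))) (*-assoc (inv q) (ι q) z))

      Pᵥ-const : ∀ v c σ → Pᵥ v (λ _ → c) σ ≡ c
      Pᵥ-const v c σ = trans (cong (inv (numAvailable G σ v) *_) (∑-*ʳ (allFin q) c (λ x → 𝟙 (available G σ v x))))
        (trans (sym (*-assoc (inv (numAvailable G σ v)) (av σ v) c)) (trans (cong (_* c) (inv-av σ v)) (*-identityˡ c)))

      P-cong : ∀ {f g} → (∀ σ → f σ ≡ g σ) → ∀ σ → P f σ ≡ P g σ
      P-cong e σ = ∑-cong (allFin n) λ v → cong (λ x → inv n * (inv (numAvailable G σ v) * x)) (∑-cong (allFin q) λ c → cong (𝟙 (available G σ v c) *_) (e (σ [ v ]≔ c)))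

      average : ∀ x → ∑ᶠ n (λ _ → inv n * x) ≡ x
      average x = trans (∑ᶠ-const n (inv n * x)) (trans (eq (ι n) (inv n) x) (trans (cong (_* x) inv-n) (*-identityˡ x)))
        where
        eq : ∀ a b c → a * (b * c) ≡ b * a * c
        eq = solve-∀ ℚ-ring

      P-shift : ∀ f c σ → P (λ τ → f τ - c) σ ≡ P f σ - c
      P-shift f c σ = trans (∑-cong (allFin n) λ v → trans (cong (inv n *_) (shiftᵥ v)) (*-distribˡ-minus (inv n) (Pᵥ v f σ) c)) (trans (∑-minus (allFin n) _ _) (cong (λ x → P f σ - x) (average c)))
        where
        shiftᵥ : ∀ v → Pᵥ v (λ τ → f τ - c) σ ≡ Pᵥ v f σ - c
        shiftᵥ v = trans (cong (inv (numAvailable G σ v) *_) (trans (∑-cong (allFin q) λ x → *-distribˡ-minus (𝟙 (available G σ v x)) (f (σ [ v ]≔ x)) c) (∑-minus (allFin q) _ _)))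
          (trans (*-distribˡ-minus (inv (numAvailable G σ v)) _ _) (cong (λ x → Pᵥ v f σ - x) (Pᵥ-const v c σ)))

      pw-shift : ∀ s f c σ → pw s (λ τ → f τ - c) σ ≡ pw s f σ - c
      pw-shift zero    f c σ = refl
      pw-shift (suc s) f c σ = trans (pw-cong s (P-shift f c) σ) (pw-shift s (P f) c σ)
        where
        pw-cong : ∀ s {f g} → (∀ σ → f σ ≡ g σ) → ∀ σ → pw s f σ ≡ pw s g σ
        pw-cong zero    e σ = e σ
        pw-cong (suc s) e σ = pw-cong s (P-cong e) σ

      -- On proper colourings `P` is the average of the `E (single v)`, each of which is
      -- self-adjoint and fixes constants.
      stationary : ∀ f → ⟪ one , P f ⟫ ≡ ⟪ one , f ⟫
      stationary f = begin
        ⟪ one , P f ⟫  ≡⟨ ∑-cong cs (λ σ → trans (expand σ) (∑-cong (allFin n) (λ v → 𝟙-under (isProper G σ) (λ p → cong (λ x → inv n * (1ℚ * x)) (Pᵥ≡E v f σ p))))) ⟩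
        S (λ σ → ∑ᶠ n (λ v → w σ * (inv n * (1ℚ * E (single v) f σ))))  ≡⟨ ∑-swap cs (allFin n) (λ σ v → w σ * (inv n * (1ℚ * E (single v) f σ))) ⟩
        ∑ᶠ n (λ v → S (λ σ → w σ * (inv n * (1ℚ * E (single v) f σ))))  ≡⟨ ∑-cong (allFin n) (λ v → trans (∑-cong cs (λ σ → *-leftComm (w σ) (inv n) (1ℚ * E (single v) f σ))) (∑-* cs (inv n) (λ σ → w σ * (1ℚ * E (single v) f σ)))) ⟩
        ∑ᶠ n (λ v → inv n * ⟪ one , E (single v) f ⟫)  ≡⟨ ∑-cong (allFin n) (λ v → cong (inv n *_) (invariant v)) ⟩
        ∑ᶠ n (λ v → inv n * ⟪ one , f ⟫)  ≡⟨ average ⟪ one , f ⟫ ⟩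
        ⟪ one , f ⟫  ∎
        where
        open ≡-Reasoning
        eq′ : ∀ a b → a * (1ℚ * b) ≡ a * b
        eq′ = solve-∀ ℚ-ring
        expand : ∀ σ → w σ * (1ℚ * P f σ) ≡ ∑ᶠ n (λ v → w σ * (inv n * (1ℚ * Pᵥ v f σ)))
        expand σ = trans (eq′ (w σ) (P f σ)) (trans (sym (∑-* (allFin n) (w σ) (λ v → inv n * Pᵥ v f σ))) (∑-cong (allFin n) λ v → cong (λ x → w σ * (inv n * x)) (sym (*-identityˡ (Pᵥ v f σ)))))
        invariant : ∀ v → ⟪ one , E (single v) f ⟫ ≡ ⟪ one , f ⟫
        invariant v = trans (E-sym (single v) one f) (⟪⟫-cong (E (single v) one) one f f (λ σ p → E-fix (single v) one σ p (λ _ → refl)) (λ _ _ → refl))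

      pw-stationary : ∀ s f → ⟪ one , pw s f ⟫ ≡ ⟪ one , f ⟫
      pw-stationary zero    f = refl
      pw-stationary (suc s) f = trans (pw-stationary s (P f)) (stationary f)

  -- From the spectral gap to mixing.

  square≤1⇒≤1 : ∀ {y} → y * y ≤ 1ℚ → y ≤ 1ℚ
  square≤1⇒≤1 {y} h = ≮⇒≥ λ 1<y → <-irrefl refl (<-≤-trans 1<y (≤-trans (≤-reflexive (sym (*-identityʳ y))) (≤-trans (*-monoʳ (≤-trans 0≤1 (<⇒≤ 1<y)) (<⇒≤ 1<y)) h)))

  -- This is (1 + 1/j)^(j+1) ≥ 2, by Bernoulli's inequality with denominators cleared.
  2*j^[1+j]≤[1+j]^[1+j] : ∀ j → 2 ℕ.* j ℕ.^ suc j ℕ.≤ suc j ℕ.^ suc j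
  2*j^[1+j]≤[1+j]^[1+j] zero      = ℕ.z≤n
  2*j^[1+j]≤[1+j]^[1+j] j@(suc i) = ℕₚ.*-cancelʳ-≤ (2 ℕ.* j ℕ.^ suc j) (suc j ℕ.^ suc j) j (ℕₚ.≤-trans (ℕₚ.≤-trans (ℕₚ.≤-reflexive (eq (j ℕ.^ suc j) j))
      (ℕₚ.*-monoʳ-≤ (j ℕ.^ suc j) (ℕₚ.+-monoʳ-≤ j (ℕₚ.n≤1+n j)))) (bernoulli (suc j)))
    where
    eq : ∀ a j → 2 ℕ.* a ℕ.* j ≡ a ℕ.* (j ℕ.+ j)
    eq = ℕ-solve-∀
    eq₁ : ∀ a j k → (a ℕ.* (j ℕ.+ k)) ℕ.+ j ℕ.* (a ℕ.* (j ℕ.+ k)) ≡ a ℕ.* k ℕ.+ j ℕ.* a ℕ.* (j ℕ.+ suc k)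
    eq₁ = ℕ-solve-∀
    bernoulli : ∀ k → j ℕ.^ k ℕ.* (j ℕ.+ k) ℕ.≤ suc j ℕ.^ k ℕ.* j
    bernoulli zero    = ℕₚ.≤-reflexive (trans (ℕₚ.*-identityˡ (j ℕ.+ 0)) (trans (ℕₚ.+-identityʳ j) (sym (ℕₚ.*-identityˡ j))))
    bernoulli (suc k) = ℕₚ.≤-trans (ℕₚ.m≤n+m (j ℕ.* j ℕ.^ k ℕ.* (j ℕ.+ suc k)) (j ℕ.^ k ℕ.* k))
      (ℕₚ.≤-trans (ℕₚ.≤-reflexive (sym (eq₁ (j ℕ.^ k) j k)))
        (ℕₚ.≤-trans (ℕₚ.*-monoʳ-≤ (suc j) (bernoulli k)) (ℕₚ.≤-reflexive (sym (ℕₚ.*-assoc (suc j) (suc j ℕ.^ k) j)))))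

  -- For M = `suc j` this reads (1 - 1/M)^(M r) ≤ 2^(-r): every M steps halve, so `r` counts
  -- halvings.
  2^r*j^≤ : ∀ j r → 2 ℕ.^ r ℕ.* j ℕ.^ (suc j ℕ.* r) ℕ.≤ suc j ℕ.^ (suc j ℕ.* r)
  2^r*j^≤ j r = subst₂ (λ a b → 2 ℕ.^ r ℕ.* a ℕ.≤ b) (ℕₚ.^-*-assoc j (suc j) r) (ℕₚ.^-*-assoc (suc j) (suc j) r) (go r)
    where
    B = j ℕ.^ suc j
    A = suc j ℕ.^ suc j
    eq : ∀ a b c → 2 ℕ.* a ℕ.* (b ℕ.* c) ≡ 2 ℕ.* b ℕ.* (a ℕ.* c)
    eq = ℕ-solve-∀
    go : ∀ r → 2 ℕ.^ r ℕ.* B ℕ.^ r ℕ.≤ A ℕ.^ r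
    go zero    = ℕₚ.≤-refl
    go (suc r) = ℕₚ.≤-trans (ℕₚ.≤-reflexive (eq (2 ℕ.^ r) B (B ℕ.^ r))) (ℕₚ.*-mono-≤ (2*j^[1+j]≤[1+j]^[1+j] j) (go r))

  module L² {n : ℕ} (q : ℕ) (G : Graph n) (1≤n : 1 ℕ.≤ n) {Δ d : ℕ} (degree≤ : ∀ v → degree G v ℕ.≤ Δ) (q≡ : q ≡ Δ ℕ.+ d) (2≤d : 2 ℕ.≤ d)
    {k : ℕ} (elim : Elim G (λ _ → true) k) where

    open Glauber q G
    open Chain 1≤n {Δ} {d} degree≤ q≡ 2≤d

    Tₖ : ℕ
    Tₖ = (4 ℕ.^ suc Δ) ℕ.^ k

    everything : VSet
    everything _ = true

    jensen : ∀ (x : Fin n → ℚ) → ∑ᶠ n (λ v → inv n * x v) * ∑ᶠ n (λ v → inv n * x v) ≤ ∑ᶠ n (λ v → inv n * (x v * x v))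
    jensen x = diff⇒≤ (subst (0ℚ ≤_) expand (∑-nonneg (allFin n) λ v → *-nonneg (inv-nonneg n) (sq-nonneg (x v - m))))
      where
      m : ℚ
      m = ∑ᶠ n (λ v → inv n * x v)
      eq : ∀ i x m → i * ((x - m) * (x - m)) ≡ i * (x * x) - (1ℚ + 1ℚ) * m * (i * x) + i * (m * m)
      eq = solve-∀ ℚ-ring
      eq′ : ∀ a m → a - (1ℚ + 1ℚ) * m * m + m * m ≡ a - m * m
      eq′ = solve-∀ ℚ-ring
      expand : ∑ᶠ n (λ v → inv n * ((x v - m) * (x v - m))) ≡ ∑ᶠ n (λ v → inv n * (x v * x v)) - m * m
      expand = trans (∑-cong (allFin n) λ v → eq (inv n) (x v) m) (trans (∑-+ (allFin n) _ _) (trans (cong₂ _+_ (trans (∑-minus (allFin n) _ _)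
        (cong (λ y → ∑ᶠ n (λ v → inv n * (x v * x v)) - y) (∑-* (allFin n) (2ℚ * m) (λ v → inv n * x v)))) (average (m * m))) (eq′ (∑ᶠ n (λ v → inv n * (x v * x v))) m)))

    dirichlet : Fn → ℚ
    dirichlet h = ∑ᶠ n (λ v → D (single v) h)

    -- Convexity of the square bounds the norm of `P h` by the average of the norms of the
    -- `E (single v) h`, and a projection satisfies ⟪Eh, Eh⟫ = ⟪h, Eh⟫. The norm of `P h` is thus
    -- bounded directly, without its eigenvalues.
    one-step : ∀ h → ⟪ P h , P h ⟫ ≤ ⟪ h , h ⟫ - inv n * dirichlet h
    one-step h = begin
      ⟪ P h , P h ⟫
        ≤⟨ ∑-mono cs (λ σ → *-monoʳ (w-nonneg σ) (jensen (λ v → Pᵥ v h σ))) ⟩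
      S (λ σ → w σ * ∑ᶠ n (λ v → inv n * (Pᵥ v h σ * Pᵥ v h σ)))
        ≡⟨ ∑-cong cs (λ σ → trans (sym (∑-* (allFin n) (w σ) (λ v → inv n * (Pᵥ v h σ * Pᵥ v h σ)))) (∑-cong (allFin n) (λ v → trans (𝟙-under (isProper G σ) (λ p → cong (λ x → inv n * (x * x)) (Pᵥ≡E v h σ p))) (*-leftComm (w σ) (inv n) (E (single v) h σ * E (single v) h σ))))) ⟩
      S (λ σ → ∑ᶠ n (λ v → inv n * (w σ * (E (single v) h σ * E (single v) h σ))))
        ≡⟨ trans (∑-swap cs (allFin n) (λ σ v → inv n * (w σ * (E (single v) h σ * E (single v) h σ)))) (∑-cong (allFin n) (λ v → ∑-* cs (inv n) (λ σ → w σ * (E (single v) h σ * E (single v) h σ)))) ⟩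
      ∑ᶠ n (λ v → inv n * ⟪ E (single v) h , E (single v) h ⟫)
        ≡⟨ ∑-cong (allFin n) (λ v → trans (cong (inv n *_) (E-idem (single v) h h)) (eq′ (inv n) ⟪ h , h ⟫ ⟪ h , E (single v) h ⟫)) ⟩
      ∑ᶠ n (λ v → inv n * ⟪ h , h ⟫ - inv n * D (single v) h)
        ≡⟨ trans (∑-minus (allFin n) (λ _ → inv n * ⟪ h , h ⟫) (λ v → inv n * D (single v) h)) (cong₂ _-_ (average ⟪ h , h ⟫) (∑-* (allFin n) (inv n) (λ v → D (single v) h))) ⟩
      ⟪ h , h ⟫ - inv n * dirichlet h ∎
      where
      open ≤-Reasoning
      eq′ : ∀ i a b → i * b ≡ i * a - i * (a - b)
      eq′ = solve-∀ ℚ-ring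

    -- When all vertices are resampled, `E` gives the mean. It vanishes here, so the variance is the
    -- whole norm of `h`.
    gap : ∀ h → ⟪ one , h ⟫ ≡ 0ℚ → ⟪ h , h ⟫ ≤ ι Tₖ * dirichlet h
    gap h mean0 = subst₂ _≤_ whole (cong (ι Tₖ *_) (∑-cong (allFin n) λ v → *-identityˡ (D (single v) h)))
      (Poincaré.poincaré q G {Δ} {d} degree≤ q≡ 2≤d h elim)
      where
      mrg-all : ∀ σ τ → mrg everything σ τ ≡ τ
      mrg-all σ τ = mrg-unique everything σ τ τ (λ _ _ → refl) (λ _ ())
      E0 : ∀ σ → E everything h σ ≡ 0ℚ
      E0 σ = trans (cong (recip (Z everything σ) *_) (trans (∑-cong cs λ τ → trans (cong (λ x → w x * h x) (mrg-all σ τ)) (cong (w τ *_) (sym (*-identityˡ (h τ))))) mean0)) (*-zeroʳ (recip (Z everything σ)))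
      zero-fn : Fn
      zero-fn _ = 0ℚ
      eq : ∀ a b → a * (b * 0ℚ) ≡ 0ℚ
      eq = solve-∀ ℚ-ring
      eq′ : ∀ a → a - 0ℚ ≡ a
      eq′ = solve-∀ ℚ-ring
      whole : D everything h ≡ ⟪ h , h ⟫
      whole = trans (cong (λ x → ⟪ h , h ⟫ - x) (trans (⟪⟫-congʳ h (E everything h) zero-fn (λ σ _ → E0 σ)) (trans (∑-cong cs λ σ → eq (w σ) (h σ)) (∑-0 cs)))) (eq′ ⟪ h , h ⟫)

    module Decay {j : ℕ} (M≡ : n ℕ.* Tₖ ≡ suc j) where

      -- The inverse gap `n * Tₖ` is named `suc j`, so that the factor 1 - 1/(n Tₖ) becomes the
      -- ratio of `j` to `suc j`.
      contraction : ∀ h → ⟪ one , h ⟫ ≡ 0ℚ → ι (suc j) * ⟪ P h , P h ⟫ ≤ ι j * ⟪ h , h ⟫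
      contraction h mean0 = begin
        ι (suc j) * ⟪ P h , P h ⟫  ≡⟨ cong (_* ⟪ P h , P h ⟫) (trans (cong ι (sym M≡)) (ι-* n Tₖ)) ⟩
        ι n * ι Tₖ * ⟪ P h , P h ⟫  ≤⟨ *-monoʳ (*-nonneg (ι-nonneg n) (ι-nonneg Tₖ)) (one-step h) ⟩
        ι n * ι Tₖ * (⟪ h , h ⟫ - inv n * dirichlet h)  ≡⟨ eq (ι n) (ι Tₖ) ⟪ h , h ⟫ (inv n) (dirichlet h) ⟩
        ι n * ι Tₖ * ⟪ h , h ⟫ - inv n * ι n * (ι Tₖ * dirichlet h)  ≡⟨ cong₂ (λ a b → a * ⟪ h , h ⟫ - b * (ι Tₖ * dirichlet h)) (trans (sym (ι-* n Tₖ)) (cong ι M≡)) inv-n ⟩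
        ι (suc j) * ⟪ h , h ⟫ - 1ℚ * (ι Tₖ * dirichlet h)  ≤⟨ +-monoʳ-≤ (ι (suc j) * ⟪ h , h ⟫) (neg-antimono-≤ (≤-trans (gap h mean0) (≤-reflexive (sym (*-identityˡ (ι Tₖ * dirichlet h)))))) ⟩
        ι (suc j) * ⟪ h , h ⟫ - ⟪ h , h ⟫  ≡⟨ eq′ (ι j) ⟪ h , h ⟫ ⟩
        ι j * ⟪ h , h ⟫  ∎
        where
        open ≤-Reasoning
        eq : ∀ n t a i b → n * t * (a - i * b) ≡ n * t * a - i * n * (t * b)
        eq = solve-∀ ℚ-ring
        eq′ : ∀ j a → (1ℚ + j) * a - a ≡ j * a
        eq′ = solve-∀ ℚ-ring

      decay : ∀ s h → ⟪ one , h ⟫ ≡ 0ℚ → ι (suc j ℕ.^ s) * ⟪ pw s h , pw s h ⟫ ≤ ι (j ℕ.^ s) * ⟪ h , h ⟫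
      decay zero    h mean0 = ≤-refl
      decay (suc s) h mean0 = begin
        ι (suc j ℕ.^ suc s) * X  ≡⟨ trans (cong (_* X) (ι-* (suc j) (suc j ℕ.^ s))) (*-assoc (ι (suc j)) (ι (suc j ℕ.^ s)) X) ⟩
        ι (suc j) * (ι (suc j ℕ.^ s) * X)  ≤⟨ *-monoʳ (ι-nonneg (suc j)) (decay s (P h) (trans (stationary h) mean0)) ⟩
        ι (suc j) * (ι (j ℕ.^ s) * ⟪ P h , P h ⟫)  ≡⟨ *-leftComm (ι (suc j)) (ι (j ℕ.^ s)) ⟪ P h , P h ⟫ ⟩
        ι (j ℕ.^ s) * (ι (suc j) * ⟪ P h , P h ⟫)  ≤⟨ *-monoʳ (ι-nonneg (j ℕ.^ s)) (contraction h mean0) ⟩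
        ι (j ℕ.^ s) * (ι j * ⟪ h , h ⟫)  ≡⟨ trans (eq′ (ι (j ℕ.^ s)) (ι j) ⟪ h , h ⟫) (cong (_* ⟪ h , h ⟫) (sym (ι-* j (j ℕ.^ s)))) ⟩
        ι (j ℕ.^ suc s) * ⟪ h , h ⟫  ∎
        where
        open ≤-Reasoning
        X : ℚ
        X = ⟪ pw s (P h) , pw s (P h) ⟫
        eq′ : ∀ a b c → a * (b * c) ≡ b * a * c
        eq′ = solve-∀ ℚ-ring

      -- A single proper colouring has mass 1 in the unnormalised norm, so the value at `σ₀` is
      -- bounded by that norm. Centring does not enlarge the squared norm of the test function,
      -- which is `N`, at most q^n. This is the loss that restricts the argument to small `q`.
      ℓ¹-bound : ∀ {σ₀} → Proper G σ₀ → ∀ s → ι (suc j ℕ.^ s) * (ℓ¹ σ₀ s * ℓ¹ σ₀ s) ≤ ι (j ℕ.^ s) * ι (q ℕ.^ n)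
      ℓ¹-bound {σ₀} p s = begin
        ι (suc j ℕ.^ s) * (ℓ¹ σ₀ s * ℓ¹ σ₀ s)  ≡⟨ cong (λ x → ι (suc j ℕ.^ s) * (x * x)) (trans (ℓ¹-dual {σ₀} p s) (sym (pw-shift s f m σ₀))) ⟩
        ι (suc j ℕ.^ s) * (pw s h σ₀ * pw s h σ₀)  ≤⟨ *-monoʳ (ι-nonneg (suc j ℕ.^ s)) point ⟩
        ι (suc j ℕ.^ s) * ⟪ pw s h , pw s h ⟫  ≤⟨ decay s h mean0 ⟩
        ι (j ℕ.^ s) * ⟪ h , h ⟫  ≤⟨ *-monoʳ (ι-nonneg (j ℕ.^ s)) (≤-trans norm-h (≤-trans (≤-reflexive ff) (≤-trans N≤ (≤-reflexive (∣C∣≡ n q))))) ⟩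
        ι (j ℕ.^ s) * ι (q ℕ.^ n)  ∎
        where
        open ≤-Reasoning
        f h cm : Fn
        f = test σ₀ s
        m : ℚ
        m = 𝔼 f
        cm _ = m
        h τ = f τ - m
        N≢0 : N ≢ 0ℚ
        N≢0 = ≥1⇒≢0 (N≥1 {σ₀} p)
        point : pw s h σ₀ * pw s h σ₀ ≤ ⟪ pw s h , pw s h ⟫
        point = subst (_≤ ⟪ pw s h , pw s h ⟫) (trans (cong (_* (pw s h σ₀ * pw s h σ₀)) (w-proper σ₀ p)) (*-identityˡ _))
          (term≤∑ᶜ (λ σ → *-nonneg (w-nonneg σ) (sq-nonneg (pw s h σ))) σ₀)
        Nm : N * m ≡ ⟪ one , f ⟫
        Nm = trans (sym (*-assoc N (recip N) ⟪ one , f ⟫)) (trans (cong (_* ⟪ one , f ⟫) (trans (*-comm N (recip N)) (recip-inverseˡ N≢0))) (*-identityˡ ⟪ one , f ⟫))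
        eq₁ : ∀ w m → w * (1ℚ * m) ≡ w * m
        eq₁ = solve-∀ ℚ-ring
        eq₂ : ∀ w f m → w * (f * m) ≡ w * (1ℚ * f) * m
        eq₂ = solve-∀ ℚ-ring
        eq₃ : ∀ w m → w * (m * m) ≡ w * (1ℚ * m) * m
        eq₃ = solve-∀ ℚ-ring
        eq₄ : ∀ x N m → m * (N * m) ≡ x - (x - (1ℚ + 1ℚ) * (N * m * m) + N * m * m)
        eq₄ = solve-∀ ℚ-ring
        1cm : ⟪ one , cm ⟫ ≡ N * m
        1cm = trans (∑-cong cs λ σ → eq₁ (w σ) m) (∑-*ʳ cs m w)
        mean0 : ⟪ one , h ⟫ ≡ 0ℚ
        mean0 = trans (⟪⟫-⊖ʳ one f cm) (trans (cong₂ _-_ (sym Nm) 1cm) (+-inverseʳ (N * m)))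
        fcm : ⟪ f , cm ⟫ ≡ N * m * m
        fcm = trans (∑-cong cs λ σ → eq₂ (w σ) (f σ) m) (trans (∑-*ʳ cs m (λ σ → w σ * (1ℚ * f σ))) (cong (_* m) (sym Nm)))
        cmcm : ⟪ cm , cm ⟫ ≡ N * m * m
        cmcm = trans (∑-cong cs λ σ → eq₃ (w σ) m) (trans (∑-*ʳ cs m (λ σ → w σ * (1ℚ * m))) (cong (_* m) 1cm))
        hh : ⟪ h , h ⟫ ≡ ⟪ f , f ⟫ - 2ℚ * (N * m * m) + N * m * m
        hh = trans (⟪⟫-⊖² f cm) (cong₂ (λ a b → ⟪ f , f ⟫ - 2ℚ * a + b) fcm cmcm)
        norm-h : ⟪ h , h ⟫ ≤ ⟪ f , f ⟫
        norm-h = diff⇒≤ (subst (0ℚ ≤_) (trans (trans (eq₅ m N) (eq₄ ⟪ f , f ⟫ N m)) (cong (λ x → ⟪ f , f ⟫ - x) (sym hh))) (*-nonneg (≤-trans 0≤1 (N≥1 {σ₀} p)) (sq-nonneg m)))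
          where
          eq₅ : ∀ m N → N * (m * m) ≡ m * (N * m)
          eq₅ = solve-∀ ℚ-ring
        ff : ⟪ f , f ⟫ ≡ N
        ff = ∑-cong cs λ σ → trans (cong (w σ *_) (sgn²≡1 (distAfter G σ₀ s σ - uniformProper G σ))) (*-identityʳ (w σ))
        N≤ : N ≤ ∣C∣ n q
        N≤ = ∑-mono cs λ σ → 𝟙≤1 (isProper G σ)

      -- Total variation 1/4 means ℓ¹ distance 1/2. Squaring twice the distance brings in the 4 of
      -- the hypothesis on `r`.
      L²-mixing : ∀ {σ₀} → Proper G σ₀ → ∀ r → 4 ℕ.* q ℕ.^ n ℕ.≤ 2 ℕ.^ r → 2ℚ * ℓ¹ σ₀ (suc j ℕ.* r) ≤ 1ℚ
      L²-mixing {σ₀} p r large = square≤1⇒≤1 (pos-cancel (ι-pos (ℕₚ.m^n>0 (suc j) s)) (begin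
        a * (2ℚ * x * (2ℚ * x))  ≡⟨ eq a x ⟩
        ι 4 * (a * (x * x))  ≤⟨ *-monoʳ (ι-nonneg 4) (ℓ¹-bound {σ₀} p s) ⟩
        ι 4 * (ι (j ℕ.^ s) * ι (q ℕ.^ n))  ≡⟨ trans (eq′ (ι 4) (ι (j ℕ.^ s)) (ι (q ℕ.^ n))) (cong (_* ι (j ℕ.^ s)) (sym (ι-* 4 (q ℕ.^ n)))) ⟩
        ι (4 ℕ.* q ℕ.^ n) * ι (j ℕ.^ s)  ≤⟨ *-monoˡ (ι-nonneg (j ℕ.^ s)) (ι-mono large) ⟩
        ι (2 ℕ.^ r) * ι (j ℕ.^ s)  ≡⟨ ι-* (2 ℕ.^ r) (j ℕ.^ s) ⟨
        ι (2 ℕ.^ r ℕ.* j ℕ.^ s)  ≤⟨ ι-mono (2^r*j^≤ j r) ⟩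
        a  ≡⟨ *-identityʳ a ⟨
        a * 1ℚ  ∎))
        where
        open ≤-Reasoning
        s : ℕ
        s = suc j ℕ.* r
        a x : ℚ
        a = ι (suc j ℕ.^ s)
        x = ℓ¹ σ₀ s
        eq : ∀ a x → a * ((1ℚ + 1ℚ) * x * ((1ℚ + 1ℚ) * x)) ≡ (1ℚ + (1ℚ + (1ℚ + (1ℚ + 0ℚ)))) * (a * (x * x))
        eq = solve-∀ ℚ-ring
        eq′ : ∀ a b c → a * (b * c) ≡ a * c * b
        eq′ = solve-∀ ℚ-ring

  -- Dobrushin contraction when there are many colours.

  ∣∣-sym : ∀ a b → ∣ a - b ∣ ≡ ∣ b - a ∣
  ∣∣-sym a b = trans (sym (∣-p∣≡∣p∣ (a - b))) (cong ∣_∣ (eq a b))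
    where
    eq : ∀ a b → - (a - b) ≡ b - a
    eq = solve-∀ ℚ-ring

  ∣∣-triangle : ∀ a b c → ∣ a - c ∣ ≤ ∣ a - b ∣ + ∣ b - c ∣
  ∣∣-triangle a b c = ≤-trans (≤-reflexive (cong ∣_∣ (eq a b c))) (∣p+q∣≤∣p∣+∣q∣ (a - b) (b - c))
    where
    eq : ∀ a b c → a - c ≡ (a - b) + (b - c)
    eq = solve-∀ ℚ-ring

  ∣∣-*ˡ : ∀ {c} → 0ℚ ≤ c → ∀ x → ∣ c * x ∣ ≡ c * ∣ x ∣
  ∣∣-*ˡ {c} 0≤c x = trans (∣p*q∣≡∣p∣*∣q∣ c x) (cong (_* ∣ x ∣) (0≤p⇒∣p∣≡p 0≤c))

  module _ {q : ℕ} (1≤q : 1 ℕ.≤ q) where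

    mass : (Fin q → Bool) → ℚ
    mass A = ∑ᶠ q (λ c → 𝟙 (A c))

    avg : (Fin q → Bool) → (Fin q → ℚ) → ℚ
    avg A F = recip (mass A) * ∑ᶠ q (λ c → 𝟙 (A c) * F c)

    mass-nonneg : ∀ A → 0ℚ ≤ mass A
    mass-nonneg A = ∑-nonneg (allFin q) λ c → 𝟙-nonneg (A c)

    ∑𝟙-abs : ∀ A {g : Fin q → ℚ} {L} → (∀ c → ∣ g c ∣ ≤ L) → ∣ ∑ᶠ q (λ c → 𝟙 (A c) * g c) ∣ ≤ mass A * L
    ∑𝟙-abs A {g} {L} h = ≤-trans (∑-abs (allFin q) (λ c → 𝟙 (A c) * g c)) (≤-trans (∑-mono (allFin q) λ c → ≤-trans (≤-reflexive (∣∣-*ˡ (𝟙-nonneg (A c)) (g c))) (*-monoʳ (𝟙-nonneg (A c)) (h c)))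
      (≤-reflexive (∑-*ʳ (allFin q) L (λ c → 𝟙 (A c)))))

    avg-close : ∀ A → mass A ≢ 0ℚ → ∀ {F F′ L} → (∀ c → ∣ F c - F′ c ∣ ≤ L) → ∣ avg A F - avg A F′ ∣ ≤ L
    avg-close A ≢0 {F} {F′} {L} h = begin
      ∣ avg A F - avg A F′ ∣  ≡⟨ cong ∣_∣ (trans (sym (*-distribˡ-minus i (∑ᶠ q (λ c → 𝟙 (A c) * F c)) (∑ᶠ q (λ c → 𝟙 (A c) * F′ c)))) (cong (i *_) (trans (sym (∑-minus (allFin q) _ _)) (∑-cong (allFin q) λ c → sym (*-distribˡ-minus (𝟙 (A c)) (F c) (F′ c)))))) ⟩
      ∣ i * ∑ᶠ q (λ c → 𝟙 (A c) * (F c - F′ c)) ∣  ≡⟨ ∣∣-*ˡ (recip-nonneg (mass-nonneg A)) _ ⟩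
      i * ∣ ∑ᶠ q (λ c → 𝟙 (A c) * (F c - F′ c)) ∣  ≤⟨ *-monoʳ (recip-nonneg (mass-nonneg A)) (∑𝟙-abs A h) ⟩
      i * (mass A * L)  ≡⟨ trans (sym (*-assoc i (mass A) L)) (trans (cong (_* L) (recip-inverseˡ ≢0)) (*-identityˡ L)) ⟩
      L  ∎
      where
      open ≤-Reasoning
      i : ℚ
      i = recip (mass A)

    mean : (Fin q → ℚ) → ℚ
    mean F = inv q * ∑ᶠ q F

    mean-const : ∀ x → inv q * ∑ᶠ q (λ _ → x) ≡ x
    mean-const x = trans (cong (inv q *_) (∑ᶠ-const q x)) (trans (sym (*-assoc (inv q) (ι q) x)) (trans (cong (_* x) (inv-ι 1≤q)) (*-identityˡ x)))

    -- Deviations from the mean sum to zero, so the sum over A is minus the sum over the complement.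
    avg-near-mean : ∀ A → mass A ≢ 0ℚ → ∀ {F L} → (∀ x y → ∣ F x - F y ∣ ≤ L) → mass A * ∣ avg A F - mean F ∣ ≤ mass (not ∘ A) * L
    avg-near-mean A ≢0 {F} {L} osc = begin
      mass A * ∣ avg A F - b ∣  ≡⟨ ∣∣-*ˡ (mass-nonneg A) (avg A F - b) ⟨
      ∣ mass A * (avg A F - b) ∣  ≡⟨ cong ∣_∣ onA ⟩
      ∣ ∑ᶠ q (λ c → 𝟙 (A c) * g c) ∣  ≡⟨ cong ∣_∣ complement ⟩
      ∣ - ∑ᶠ q (λ c → 𝟙 (not (A c)) * g c) ∣  ≡⟨ ∣-p∣≡∣p∣ _ ⟩
      ∣ ∑ᶠ q (λ c → 𝟙 (not (A c)) * g c) ∣  ≤⟨ ∑𝟙-abs (not ∘ A) dev ⟩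
      mass (not ∘ A) * L  ∎
      where
      open ≤-Reasoning
      b : ℚ
      b = mean F
      g : Fin q → ℚ
      g x = F x - b
      eq₁ : ∀ m i s b → m * (i * s - b) ≡ i * m * s - m * b
      eq₁ = solve-∀ ℚ-ring
      onA : mass A * (avg A F - b) ≡ ∑ᶠ q (λ c → 𝟙 (A c) * g c)
      onA = trans (eq₁ (mass A) (recip (mass A)) (∑ᶠ q (λ c → 𝟙 (A c) * F c)) b)
        (trans (cong₂ _-_ (trans (cong (_* ∑ᶠ q (λ c → 𝟙 (A c) * F c)) (recip-inverseˡ ≢0)) (*-identityˡ (∑ᶠ q (λ c → 𝟙 (A c) * F c)))) (sym (∑-*ʳ (allFin q) b (λ c → 𝟙 (A c)))))
          (trans (sym (∑-minus (allFin q) _ _)) (∑-cong (allFin q) λ c → sym (*-distribˡ-minus (𝟙 (A c)) (F c) b))))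
      total : ∑ᶠ q g ≡ 0ℚ
      total = trans (∑-minus (allFin q) F (λ _ → b)) (trans (cong (λ x → ∑ᶠ q F - x) (trans (∑ᶠ-const q b) (trans (sym (*-assoc (ι q) (inv q) (∑ᶠ q F))) (trans (cong (_* ∑ᶠ q F) (trans (*-comm (ι q) (inv q)) (inv-ι 1≤q))) (*-identityˡ (∑ᶠ q F)))))) (+-inverseʳ (∑ᶠ q F)))
      bit : ∀ a x → 𝟙 a * x ≡ x - 𝟙 (not a) * x
      bit true  x = bit-true x
        where
        bit-true : ∀ x → 1ℚ * x ≡ x - 0ℚ * x
        bit-true = solve-∀ ℚ-ring
      bit false x = bit-false x
        where
        bit-false : ∀ x → 0ℚ * x ≡ x - 1ℚ * x
        bit-false = solve-∀ ℚ-ring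
      complement : ∑ᶠ q (λ c → 𝟙 (A c) * g c) ≡ - ∑ᶠ q (λ c → 𝟙 (not (A c)) * g c)
      complement = trans (∑-cong (allFin q) λ c → bit (A c) (g c)) (trans (∑-minus (allFin q) g (λ c → 𝟙 (not (A c)) * g c))
        (trans (cong (_- ∑ᶠ q (λ c → 𝟙 (not (A c)) * g c)) total) (+-identityˡ _)))
      dev : ∀ x → ∣ g x ∣ ≤ L
      dev x = begin
        ∣ F x - b ∣  ≡⟨ cong ∣_∣ (trans (cong (_- b) (sym (mean-const (F x)))) (trans (sym (*-distribˡ-minus (inv q) (∑ᶠ q (λ _ → F x)) (∑ᶠ q F))) (cong (inv q *_) (sym (∑-minus (allFin q) (λ _ → F x) F))))) ⟩
        ∣ inv q * ∑ᶠ q (λ y → F x - F y) ∣  ≡⟨ ∣∣-*ˡ (inv-nonneg q) _ ⟩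
        inv q * ∣ ∑ᶠ q (λ y → F x - F y) ∣  ≤⟨ *-monoʳ (inv-nonneg q) (≤-trans (∑-abs (allFin q) (λ y → F x - F y)) (∑-mono (allFin q) (osc x))) ⟩
        inv q * ∑ᶠ q (λ _ → L)  ≡⟨ mean-const L ⟩
        L  ∎

  module Dobrushin {n : ℕ} (q : ℕ) (G : Graph n) (1≤n : 1 ℕ.≤ n) {Δ d : ℕ} (degree≤ : ∀ v → degree G v ℕ.≤ Δ) (q≡ : q ≡ Δ ℕ.+ d) (2≤d : 2 ℕ.≤ d)
    (4Δ²≤d : 4 ℕ.* (Δ ℕ.* Δ) ℕ.≤ d) where

    open Glauber q G
    open Chain 1≤n {Δ} {d} degree≤ q≡ 2≤d

    1≤q : 1 ℕ.≤ q
    1≤q = subst (1 ℕ.≤_) (sym q≡) (ℕₚ.≤-trans (ℕₚ.≤-trans (ℕ.s≤s ℕ.z≤n) 2≤d) (ℕₚ.m≤n+m d Δ))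

    -- Improper colourings are included: the paths used later to join two colourings pass through
    -- them, and `P` has at least `d` available colours at every vertex there too.
    Lip : Fn → ℚ → Set
    Lip f L = ∀ σ v c → ∣ f σ - f (σ [ v ]≔ c) ∣ ≤ L

    Pᵥ≡avg : ∀ u f σ → Pᵥ u f σ ≡ avg 1≤q (available G σ u) (λ c → f (σ [ u ]≔ c))
    Pᵥ≡avg u f σ = cong (_* ∑ᶠ q (λ c → 𝟙 (available G σ u c) * f (σ [ u ]≔ c))) (recip-unique {av σ u} {inv (numAvailable G σ u)} (inv-av σ u))

    av≢0 : ∀ σ u → av σ u ≢ 0ℚ
    av≢0 σ u e = <-irrefl (sym e) (<-≤-trans 0<ιd (d≤av σ u))

    unavailable≤ : ∀ σ u → mass 1≤q (not ∘ available G σ u) ≤ ι Δ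
    unavailable≤ σ u = diff⇒≤ (subst (0ℚ ≤_) (eq (ι Δ) (ι d) (av σ u) (mass 1≤q (not ∘ available G σ u)) total) (≤⇒diff (d≤av σ u)))
      where
      bit : ∀ b → 𝟙 b + 𝟙 (not b) ≡ 1ℚ
      bit true  = refl
      bit false = refl
      total : av σ u + mass 1≤q (not ∘ available G σ u) ≡ ι Δ + ι d
      total = trans (sym (∑-+ (allFin q) _ _)) (trans (∑-cong (allFin q) λ c → bit (available G σ u c)) (trans (∑ᶠ-const q 1ℚ) (trans (*-identityʳ (ι q)) (trans (cong ι q≡) (ι-+ Δ d)))))
      eq : ∀ Δ d a m → a + m ≡ Δ + d → a - d ≡ Δ - m
      eq Δ d a m e = trans (eq₁ a m d) (trans (cong (λ x → x - m - d) e) (eq₂ Δ m d))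
        where
        eq₁ : ∀ a m d → a - d ≡ a + m - m - d
        eq₁ = solve-∀ ℚ-ring
        eq₂ : ∀ Δ m d → Δ + d - m - d ≡ Δ - m
        eq₂ = solve-∀ ℚ-ring

    available-nonadj : ∀ σ {u v} c → ¬ T (adj G u v) → ∀ c′ → available G (σ [ v ]≔ c) u c′ ≡ available G σ u c′
    available-nonadj σ {u} {v} c ¬uv c′ = T-iff
        (λ t → available⁺ {σ} λ x ux e → available⁻ {σ [ v ]≔ c} t x ux (trans (same x ux) e))
        (λ t → available⁺ {σ [ v ]≔ c} λ x ux e → available⁻ {σ} t x ux (trans (sym (same x ux)) e))
      where
      same : ∀ x → T (adj G u x) → lookup (σ [ v ]≔ c) x ≡ lookup σ x
      same x ux = lookup∘update′ (λ { refl → ¬uv ux }) σ c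

    avg-cong : ∀ {A A′} → (∀ c → A c ≡ A′ c) → ∀ F → avg 1≤q A F ≡ avg 1≤q A′ F
    avg-cong e F = cong₂ (λ a b → recip a * b) (∑-cong (allFin q) λ c → cong 𝟙 (e c)) (∑-cong (allFin q) λ c → cong (λ b → 𝟙 b * F c) (e c))

    module _ {f : Fn} {L : ℚ} (lip : Lip f L) (σ : Col) (v : Fin n) (c : Fin q) where

      private
        σ′ : Col
        σ′ = σ [ v ]≔ c

      0≤L : 0ℚ ≤ L
      0≤L = ≤-trans (0≤∣p∣ (f σ - f σ′)) (lip σ v c)

      -- Scaled by `d`: a disagreement at `v` persists with size `L` unless `v` itself is updated,
      -- and a neighbour of `v` adds 2ΔL/d because its available set may change.
      influence : Fin n → ℚ
      influence u = ι d * ((1ℚ - 𝟙 (u == v)) * L) + 𝟙 (adj G v u) * (2ℚ * (ι Δ * L))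

      -- Updating `v` erases the disagreement. A vertex not adjacent to `v` has the same available
      -- set in both colourings, so its averages differ by at most `L`. At a neighbour both
      -- available sets are compared with the mean over all colours, at a cost of ΔL/d each.
      site : ∀ u → ι d * ∣ Pᵥ u f σ - Pᵥ u f σ′ ∣ ≤ influence u
      site u = onCase (u Fin.≟ v) (T? (adj G u v))
        where
        open ≤-Reasoning
        second≥0 : ∀ b → 0ℚ ≤ 𝟙 b * (2ℚ * (ι Δ * L))
        second≥0 b = *-nonneg (𝟙-nonneg b) (*-nonneg 0≤2 (*-nonneg (ι-nonneg Δ) 0≤L))
        F F′ : Fin q → ℚ
        F c′ = f (σ [ u ]≔ c′)
        F′ c′ = f (σ′ [ u ]≔ c′)
        Av Av′ : Fin q → Bool
        Av = available G σ u
        Av′ = available G σ′ u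
        osc : ∀ x y → ∣ F′ x - F′ y ∣ ≤ L
        osc x y = subst (λ τ → ∣ F′ x - f τ ∣ ≤ L) ([]≔-idempotent σ′ u) (lip (σ′ [ u ]≔ x) u y)
        near : ∀ τ → ι d * ∣ avg 1≤q (available G τ u) F′ - mean 1≤q F′ ∣ ≤ ι Δ * L
        near τ = ≤-trans (*-monoˡ (0≤∣p∣ _) (d≤av τ u)) (≤-trans (avg-near-mean 1≤q (available G τ u) (av≢0 τ u) osc) (*-monoˡ 0≤L (unavailable≤ τ u)))
        eq₁ : ∀ d L → d * L ≡ d * ((1ℚ - 0ℚ) * L)
        eq₁ = solve-∀ ℚ-ring
        eq₂ : ∀ x → x + x ≡ 1ℚ * ((1ℚ + 1ℚ) * x)
        eq₂ = solve-∀ ℚ-ring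
        onCase : Dec (u ≡ v) → Dec (T (adj G u v)) → ι d * ∣ Pᵥ u f σ - Pᵥ u f σ′ ∣ ≤ influence u
        onCase (yes refl) _ = ≤-trans (≤-reflexive (trans (cong (λ x → ι d * ∣ x ∣) (trans (cong (_- Pᵥ u f σ′) same) (+-inverseʳ (Pᵥ u f σ′)))) (*-zeroʳ (ι d))))
          (+-nonneg (*-nonneg (ι-nonneg d) (*-nonneg (≤⇒diff (𝟙≤1 (u == v))) 0≤L)) (second≥0 (adj G v u)))
          where
          same : Pᵥ u f σ ≡ Pᵥ u f σ′
          same = trans (Pᵥ≡avg u f σ) (trans (trans (avg-cong (λ c′ → sym (available-nonadj σ c (subst T (irrefl G u)) c′)) F)
            (cong (recip (mass 1≤q Av′) *_) (∑-cong (allFin q) λ c′ → cong (λ τ → 𝟙 (Av′ c′) * f τ) (sym ([]≔-idempotent σ u))))) (sym (Pᵥ≡avg u f σ′)))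
        onCase (no u≢v) adjacent? = begin
          ι d * ∣ Pᵥ u f σ - Pᵥ u f σ′ ∣  ≡⟨ cong₂ (λ x y → ι d * ∣ x - y ∣) (Pᵥ≡avg u f σ) (Pᵥ≡avg u f σ′) ⟩
          ι d * ∣ avg 1≤q Av F - avg 1≤q Av′ F′ ∣  ≤⟨ *-monoʳ (ι-nonneg d) (≤-trans (∣∣-triangle (avg 1≤q Av F) (avg 1≤q Av F′) (avg 1≤q Av′ F′)) (+-monoˡ-≤ _ (avg-close 1≤q Av (av≢0 σ u) close))) ⟩
          ι d * (L + ∣ avg 1≤q Av F′ - avg 1≤q Av′ F′ ∣)  ≡⟨ *-distribˡ-+ (ι d) L _ ⟩
          ι d * L + ι d * ∣ avg 1≤q Av F′ - avg 1≤q Av′ F′ ∣  ≤⟨ +-mono-≤ (≤-reflexive first) (rest adjacent?) ⟩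
          influence u  ∎
          where
          close : ∀ c′ → ∣ F c′ - F′ c′ ∣ ≤ L
          close c′ = subst (λ τ → ∣ F c′ - f τ ∣ ≤ L) (sym ([]≔-commutes σ v u (λ e → u≢v (sym e)))) (lip (σ [ u ]≔ c′) v c)
          first : ι d * L ≡ ι d * ((1ℚ - 𝟙 (u == v)) * L)
          first = trans (eq₁ (ι d) L) (cong (λ b → ι d * ((1ℚ - 𝟙 b) * L)) (sym (single-off u≢v)))
          rest : Dec (T (adj G u v)) → ι d * ∣ avg 1≤q Av F′ - avg 1≤q Av′ F′ ∣ ≤ 𝟙 (adj G v u) * (2ℚ * (ι Δ * L))
          rest (no ¬uv) = ≤-trans (≤-reflexive (trans (cong (λ x → ι d * ∣ x ∣) (trans (cong (_- avg 1≤q Av′ F′) (avg-cong (λ c′ → sym (available-nonadj σ c ¬uv c′)) F′)) (+-inverseʳ (avg 1≤q Av′ F′)))) (*-zeroʳ (ι d)))) (second≥0 (adj G v u))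
          rest (yes uv) = begin
            ι d * ∣ avg 1≤q Av F′ - avg 1≤q Av′ F′ ∣  ≤⟨ *-monoʳ (ι-nonneg d) (∣∣-triangle (avg 1≤q Av F′) (mean 1≤q F′) (avg 1≤q Av′ F′)) ⟩
            ι d * (∣ avg 1≤q Av F′ - mean 1≤q F′ ∣ + ∣ mean 1≤q F′ - avg 1≤q Av′ F′ ∣)  ≡⟨ trans (*-distribˡ-+ (ι d) _ _) (cong (λ x → ι d * ∣ avg 1≤q Av F′ - mean 1≤q F′ ∣ + ι d * x) (∣∣-sym (mean 1≤q F′) (avg 1≤q Av′ F′))) ⟩
            ι d * ∣ avg 1≤q Av F′ - mean 1≤q F′ ∣ + ι d * ∣ avg 1≤q Av′ F′ - mean 1≤q F′ ∣  ≤⟨ +-mono-≤ (near σ) (near σ′) ⟩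
            ι Δ * L + ι Δ * L  ≡⟨ eq₂ (ι Δ * L) ⟩
            1ℚ * (2ℚ * (ι Δ * L))  ≡⟨ cong (_* (2ℚ * (ι Δ * L))) (𝟙-true (subst T (adj-sym G u v) uv)) ⟨
            𝟙 (adj G v u) * (2ℚ * (ι Δ * L))  ∎

      -- Summed over the sites, `influence` is at most d(n - 1)L + 2Δ²L. By 4Δ² ≤ d the second term
      -- is at most dL/2, half of what the update at `v` gains; this leaves the factor 1 - 1/(2n).
      contracted : ∀ {j} → n ℕ.+ n ≡ suc j → ι (suc j) * ∣ P f σ - P f σ′ ∣ ≤ ι j * L
      contracted {j} n+n = pos-cancel 0<ιd (begin
        ι d * (ι (suc j) * ∣ P f σ - P f σ′ ∣)
          ≡⟨ cong (λ x → ι d * (x * ∣ P f σ - P f σ′ ∣)) 2n ⟩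
        ι d * ((ι n + ι n) * ∣ P f σ - P f σ′ ∣)
          ≤⟨ *-monoʳ (ι-nonneg d) (*-monoʳ (+-nonneg (ι-nonneg n) (ι-nonneg n)) (≤-trans (≤-reflexive (cong ∣_∣ (sym (∑-minus (allFin n) _ _)))) (≤-trans (∑-abs (allFin n) _) (≤-reflexive (trans (∑-cong (allFin n) λ u → trans (cong ∣_∣ (sym (*-distribˡ-minus (inv n) (Pᵥ u f σ) (Pᵥ u f σ′)))) (∣∣-*ˡ (inv-nonneg n) (Pᵥ u f σ - Pᵥ u f σ′))) (∑-* (allFin n) (inv n) δ)))))) ⟩
        ι d * ((ι n + ι n) * (inv n * ∑ᶠ n δ))
          ≡⟨ trans (eq₁ (ι d) (ι n) (inv n) (∑ᶠ n δ)) (trans (cong (λ x → x * (2ℚ * (ι d * ∑ᶠ n δ))) inv-n) (trans (*-identityˡ _) (cong (2ℚ *_) (sym (∑-* (allFin n) (ι d) δ))))) ⟩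
        2ℚ * ∑ᶠ n (λ u → ι d * δ u)
          ≤⟨ *-monoʳ 0≤2 (∑-mono (allFin n) site) ⟩
        2ℚ * ∑ᶠ n influence
          ≡⟨ cong (2ℚ *_) (trans (∑-+ (allFin n) _ _) (cong₂ _+_ (trans (∑-* (allFin n) (ι d) _) (cong (ι d *_) (trans (∑-*ʳ (allFin n) L _) (cong (_* L) count)))) (trans (∑-*ʳ (allFin n) (2ℚ * (ι Δ * L)) _) (cong (_* (2ℚ * (ι Δ * L))) (sym (ι-countV n (adj G v))))))) ⟩
        2ℚ * (ι d * ((ι n - 1ℚ) * L) + ι (degree G v) * (2ℚ * (ι Δ * L)))
          ≤⟨ *-monoʳ 0≤2 (+-monoʳ-≤ (ι d * ((ι n - 1ℚ) * L)) (*-monoˡ (*-nonneg 0≤2 (*-nonneg (ι-nonneg Δ) 0≤L)) (ι-mono (degree≤ v)))) ⟩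
        2ℚ * (ι d * ((ι n - 1ℚ) * L) + ι Δ * (2ℚ * (ι Δ * L)))
          ≡⟨ eq₂ (ι d) (ι n) L (ι Δ) ⟩
        ι d * ((ι n + ι n - 2ℚ) * L) + (ι 4 * (ι Δ * ι Δ)) * L
          ≤⟨ +-monoʳ-≤ (ι d * ((ι n + ι n - 2ℚ) * L)) (*-monoˡ 0≤L (≤-trans (≤-reflexive (trans (cong (ι 4 *_) (sym (ι-* Δ Δ))) (sym (ι-* 4 (Δ ℕ.* Δ))))) (ι-mono 4Δ²≤d))) ⟩
        ι d * ((ι n + ι n - 2ℚ) * L) + ι d * L
          ≡⟨ trans (eq₃ (ι d) (ι n + ι n) L) (trans (cong (λ x → ι d * ((x - 1ℚ) * L)) (sym 2n)) (eq₄ (ι d) (ι j) L)) ⟩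
        ι d * (ι j * L) ∎)
        where
        open ≤-Reasoning
        δ : Fin n → ℚ
        δ u = ∣ Pᵥ u f σ - Pᵥ u f σ′ ∣
        2n : ι (suc j) ≡ ι n + ι n
        2n = trans (cong ι (sym n+n)) (ι-+ n n)
        eq₁ : ∀ d n i x → d * ((n + n) * (i * x)) ≡ i * n * ((1ℚ + 1ℚ) * (d * x))
        eq₁ = solve-∀ ℚ-ring
        eq₂ : ∀ d n L Δ → (1ℚ + 1ℚ) * (d * ((n - 1ℚ) * L) + Δ * ((1ℚ + 1ℚ) * (Δ * L))) ≡ d * ((n + n - (1ℚ + 1ℚ)) * L) + ((1ℚ + (1ℚ + (1ℚ + (1ℚ + 0ℚ)))) * (Δ * Δ)) * L
        eq₂ = solve-∀ ℚ-ring
        eq₃ : ∀ d m L → d * ((m - (1ℚ + 1ℚ)) * L) + d * L ≡ d * ((m - 1ℚ) * L)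
        eq₃ = solve-∀ ℚ-ring
        eq₄ : ∀ d j L → d * ((1ℚ + j - 1ℚ) * L) ≡ d * (j * L)
        eq₄ = solve-∀ ℚ-ring
        count : ∑ᶠ n (λ u → 1ℚ - 𝟙 (u == v)) ≡ ι n - 1ℚ
        count = trans (∑-minus (allFin n) (λ _ → 1ℚ) (λ u → 𝟙 (u == v))) (cong₂ _-_ (trans (∑ᶠ-const n 1ℚ) (*-identityʳ (ι n)))
          (trans (∑ᶠ-single v (λ u u≢v → cong 𝟙 (single-off u≢v))) (cong 𝟙 (single-on v))))

    module _ {j : ℕ} (n+n : n ℕ.+ n ≡ suc j) where

      private
        0<M^ : ∀ s → 0ℚ < ι (suc j ℕ.^ s)
        0<M^ s = ι-pos (ℕₚ.m^n>0 (suc j) s)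

      Lip-step : ∀ {f L} → Lip f L → Lip (P f) (recip (ι (suc j)) * (ι j * L))
      Lip-step {f} {L} lip σ v c = pos-cancel (ι-pos {suc j} (ℕ.s≤s ℕ.z≤n)) (≤-trans (contracted {f} lip σ v c n+n) (≤-reflexive (unscale (ι j * L))))
        where
        unscale : ∀ x → x ≡ ι (suc j) * (recip (ι (suc j)) * x)
        unscale x = trans (sym (*-identityˡ x)) (trans (cong (_* x) (sym (trans (*-comm (ι (suc j)) (recip (ι (suc j)))) (recip-inverseˡ (ι≢0 {suc j} (ℕ.s≤s ℕ.z≤n)))))) (*-assoc (ι (suc j)) (recip (ι (suc j))) x))

      Lip-decay : ∀ s {f L} → Lip f L → ∀ σ v c → ι (suc j ℕ.^ s) * ∣ pw s f σ - pw s f (σ [ v ]≔ c) ∣ ≤ ι (j ℕ.^ s) * L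
      Lip-decay zero    lip σ v c = *-monoʳ 0≤1 (lip σ v c)
      Lip-decay (suc s) {f} {L} lip σ v c = begin
        ι (suc j ℕ.^ suc s) * x  ≡⟨ trans (cong (_* x) (ι-* (suc j) (suc j ℕ.^ s))) (*-assoc (ι (suc j)) (ι (suc j ℕ.^ s)) x) ⟩
        ι (suc j) * (ι (suc j ℕ.^ s) * x)  ≤⟨ *-monoʳ (ι-nonneg (suc j)) (Lip-decay s {P f} (Lip-step {f} lip) σ v c) ⟩
        ι (suc j) * (ι (j ℕ.^ s) * (recip (ι (suc j)) * (ι j * L)))  ≡⟨ trans (eq (ι (suc j)) (ι (j ℕ.^ s)) (recip (ι (suc j))) (ι j) L) (cong₂ (λ a b → a * (b * L)) (recip-inverseˡ (ι≢0 {suc j} (ℕ.s≤s ℕ.z≤n))) (sym (ι-* j (j ℕ.^ s)))) ⟩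
        1ℚ * (ι (j ℕ.^ suc s) * L)  ≡⟨ *-identityˡ _ ⟩
        ι (j ℕ.^ suc s) * L  ∎
        where
        open ≤-Reasoning
        x : ℚ
        x = ∣ pw s (P f) σ - pw s (P f) (σ [ v ]≔ c) ∣
        eq : ∀ a b r j L → a * (b * (r * (j * L))) ≡ r * a * (j * b * L)
        eq = solve-∀ ℚ-ring

      copy : Col → Col → List (Fin n) → Col
      copy σ τ []       = σ
      copy σ τ (v ∷ vs) = copy (σ [ v ]≔ lookup τ v) τ vs

      lookup-copy : ∀ vs σ τ u → u ∈ vs ⊎ lookup σ u ≡ lookup τ u → lookup (copy σ τ vs) u ≡ lookup τ u
      lookup-copy []       σ τ u (inj₂ e) = e
      lookup-copy (v ∷ vs) σ τ u h with u Fin.≟ v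
      ... | yes refl = lookup-copy vs (σ [ v ]≔ lookup τ v) τ v (inj₂ (lookup∘update v σ (lookup τ v)))
      lookup-copy (v ∷ vs) σ τ u (inj₁ (here e))   | no u≢v = ⊥-elim (u≢v e)
      lookup-copy (v ∷ vs) σ τ u (inj₁ (there u∈)) | no u≢v = lookup-copy vs (σ [ v ]≔ lookup τ v) τ u (inj₁ u∈)
      lookup-copy (v ∷ vs) σ τ u (inj₂ e)          | no u≢v = lookup-copy vs (σ [ v ]≔ lookup τ v) τ u (inj₂ (trans (lookup∘update′ u≢v σ (lookup τ v)) e))

      copy-all : ∀ σ τ → copy σ τ (allFin n) ≡ τ
      copy-all σ τ = lookup-ext λ u → lookup-copy (allFin n) σ τ u (inj₁ (∈-allFin u))

      copy-lip : ∀ vs {g : Fn} {K B} → 0ℚ ≤ K → (∀ σ v c → K * ∣ g σ - g (σ [ v ]≔ c) ∣ ≤ B) → ∀ σ τ → K * ∣ g σ - g (copy σ τ vs) ∣ ≤ ι (length vs) * B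
      copy-lip [] {g} {K} {B} 0≤K h σ τ = ≤-reflexive (trans (cong (λ x → K * ∣ x ∣) (+-inverseʳ (g σ))) (trans (*-zeroʳ K) (sym (*-zeroˡ B))))
      copy-lip (v ∷ vs) {g} {K} {B} 0≤K h σ τ = begin
        K * ∣ g σ - g ρ ∣  ≤⟨ *-monoʳ 0≤K (∣∣-triangle (g σ) (g σ₁) (g ρ)) ⟩
        K * (∣ g σ - g σ₁ ∣ + ∣ g σ₁ - g ρ ∣)  ≡⟨ *-distribˡ-+ K ∣ g σ - g σ₁ ∣ ∣ g σ₁ - g ρ ∣ ⟩
        K * ∣ g σ - g σ₁ ∣ + K * ∣ g σ₁ - g ρ ∣  ≤⟨ +-mono-≤ (h σ v (lookup τ v)) (copy-lip vs {g} 0≤K h σ₁ τ) ⟩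
        B + ι (length vs) * B  ≡⟨ eq B (ι (length vs)) ⟩
        ι (suc (length vs)) * B  ∎
        where
        open ≤-Reasoning
        σ₁ ρ : Col
        σ₁ = σ [ v ]≔ lookup τ v
        ρ = copy σ₁ τ vs
        eq : ∀ b l → b + l * b ≡ (1ℚ + l) * b
        eq = solve-∀ ℚ-ring

      -- The colouring `τ` is copied onto `σ` one vertex at a time, in `n` steps whose intermediate
      -- colourings may be improper.
      oscillation : ∀ s {f L} → Lip f L → ∀ σ τ → ι (suc j ℕ.^ s) * ∣ pw s f σ - pw s f τ ∣ ≤ ι n * (ι (j ℕ.^ s) * L)
      oscillation s {f} {L} lip σ τ = subst₂ (λ ρ k → ι (suc j ℕ.^ s) * ∣ pw s f σ - pw s f ρ ∣ ≤ ι k * (ι (j ℕ.^ s) * L)) (copy-all σ τ) (length-tabulate {n = n} id)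
        (copy-lip (allFin n) {pw s f} (ι-nonneg (suc j ℕ.^ s)) (Lip-decay s {f} lip) σ τ)

      -- By stationarity `𝔼 f` is also the mean of `g`, so the distance is an average of differences
      -- `g σ₀ - g τ`. The loss is 2n in place of the square root of q^n, so a large `q` does no
      -- harm.
      ℓ¹-bound : ∀ {σ₀} → Proper G σ₀ → ∀ s → ι (suc j ℕ.^ s) * ℓ¹ σ₀ s ≤ ι n * (ι (j ℕ.^ s) * 2ℚ)
      ℓ¹-bound {σ₀} p s = begin
        K * ℓ¹ σ₀ s  ≡⟨ cong (K *_) (trans (ℓ¹-dual {σ₀} p s) as-average) ⟩
        K * (recip N * S (λ τ → w τ * (g σ₀ - g τ)))  ≡⟨ trans (*-leftComm K (recip N) (S (λ τ → w τ * (g σ₀ - g τ)))) (cong (recip N *_) (sym (∑-* cs K (λ τ → w τ * (g σ₀ - g τ))))) ⟩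
        recip N * S (λ τ → K * (w τ * (g σ₀ - g τ)))  ≤⟨ *-monoʳ (recip-nonneg 0≤N) (∑-mono cs λ τ → ≤-trans (≤-reflexive (*-leftComm K (w τ) (g σ₀ - g τ))) (*-monoʳ (w-nonneg τ) (≤-trans (*-monoʳ (ι-nonneg (suc j ℕ.^ s)) (≤∣∣ (g σ₀ - g τ))) (oscillation s {f} lip σ₀ τ)))) ⟩
        recip N * S (λ τ → w τ * B)  ≡⟨ trans (cong (recip N *_) (∑-*ʳ cs B w)) (trans (sym (*-assoc (recip N) N B)) (trans (cong (_* B) (recip-inverseˡ N≢0)) (*-identityˡ B))) ⟩
        B  ∎
        where
        open ≤-Reasoning
        f g : Fn
        f = test σ₀ s
        g = pw s f
        K B : ℚ
        K = ι (suc j ℕ.^ s)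
        B = ι n * (ι (j ℕ.^ s) * 2ℚ)
        N≢0 : N ≢ 0ℚ
        N≢0 = ≥1⇒≢0 (N≥1 {σ₀} p)
        0≤N : 0ℚ ≤ N
        0≤N = ∑-nonneg cs w-nonneg
        lip : Lip f 2ℚ
        lip σ v c = ≤-trans (∣p-q∣≤∣p∣+∣q∣ (f σ) (f (σ [ v ]≔ c))) (+-mono-≤ (∣sgn∣≤1 (distAfter G σ₀ s σ - uniformProper G σ)) (∣sgn∣≤1 (distAfter G σ₀ s (σ [ v ]≔ c) - uniformProper G (σ [ v ]≔ c))))
        eq₂ : ∀ w a b → w * (a - b) ≡ w * a - w * (1ℚ * b)
        eq₂ = solve-∀ ℚ-ring
        eq₃ : ∀ i a b → i * (a - b) ≡ i * a - i * b
        eq₃ = solve-∀ ℚ-ring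
        as-average : g σ₀ - 𝔼 f ≡ recip N * S (λ τ → w τ * (g σ₀ - g τ))
        as-average = sym (trans (cong (recip N *_) (trans (∑-cong cs λ τ → eq₂ (w τ) (g σ₀) (g τ)) (∑-minus cs (λ τ → w τ * g σ₀) (λ τ → w τ * (1ℚ * g τ)))))
          (trans (eq₃ (recip N) (S (λ τ → w τ * g σ₀)) ⟪ one , g ⟫)
            (cong₂ _-_ (trans (cong (recip N *_) (∑-*ʳ cs (g σ₀) w)) (trans (sym (*-assoc (recip N) N (g σ₀))) (trans (cong (_* g σ₀) (recip-inverseˡ N≢0)) (*-identityˡ (g σ₀)))))
              (cong (recip N *_) (pw-stationary s f)))))

      Dobrushin-mixing : ∀ {σ₀} → Proper G σ₀ → ∀ r → 4 ℕ.* n ℕ.≤ 2 ℕ.^ r → 2ℚ * ℓ¹ σ₀ (suc j ℕ.* r) ≤ 1ℚ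
      Dobrushin-mixing {σ₀} p r large = pos-cancel (0<M^ s) (begin
        K * (2ℚ * x)  ≡⟨ *-leftComm K 2ℚ x ⟩
        2ℚ * (K * x)  ≤⟨ *-monoʳ 0≤2 (ℓ¹-bound {σ₀} p s) ⟩
        2ℚ * (ι n * (ι (j ℕ.^ s) * 2ℚ))  ≡⟨ trans (eq₂ (ι n) (ι (j ℕ.^ s))) (cong (_* ι (j ℕ.^ s)) (sym (ι-* 4 n))) ⟩
        ι (4 ℕ.* n) * ι (j ℕ.^ s)  ≤⟨ *-monoˡ (ι-nonneg (j ℕ.^ s)) (ι-mono large) ⟩
        ι (2 ℕ.^ r) * ι (j ℕ.^ s)  ≡⟨ ι-* (2 ℕ.^ r) (j ℕ.^ s) ⟨
        ι (2 ℕ.^ r ℕ.* j ℕ.^ s)  ≤⟨ ι-mono (2^r*j^≤ j r) ⟩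
        K  ≡⟨ *-identityʳ K ⟨
        K * 1ℚ  ∎)
        where
        open ≤-Reasoning
        s : ℕ
        s = suc j ℕ.* r
        K x : ℚ
        K = ι (suc j ℕ.^ s)
        x = ℓ¹ σ₀ s
        eq₂ : ∀ n j → (1ℚ + 1ℚ) * (n * (j * (1ℚ + 1ℚ))) ≡ (1ℚ + (1ℚ + (1ℚ + (1ℚ + 0ℚ)))) * n * j
        eq₂ = solve-∀ ℚ-ring

module Decompositions where

  open import Defs using (step; here)
  open import Data.Nat using (_≤_; _<_; z≤n; s≤s; _+_; _*_; _^_; _∸_)

  -- Simple paths, and the exploration of the decomposition tree.

  module Paths {n : ℕ} (G : Graph n) where

    Walk-head : ∀ {P u v} → Walk G P u v → P u
    Walk-head (here p)     = p
    Walk-head (step p _ _) = p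

    Walk-map : ∀ {P Q : Fin n → Set} → (∀ {x} → P x → Q x) → ∀ {u v} → Walk G P u v → Walk G Q u v
    Walk-map f (here p)     = here (f p)
    Walk-map f (step p a r) = step (f p) a (Walk-map f r)

    Walk-snoc : ∀ {P u v w} → Walk G P u v → T (adj G v w) → P w → Walk G P u w
    Walk-snoc (here p)     a q = step p a (here q)
    Walk-snoc (step p b r) a q = step p b (Walk-snoc r a q)

    -- Walks with their list of distinct vertices: `HasCycle` asks for an injective enumeration,
    -- which `lookup` in such a list provides.
    data SPath (P : Fin n → Set) : Fin n → Fin n → List (Fin n) → Set where
      stop : ∀ {u} → P u → SPath P u u (u ∷ [])
      link : ∀ {u w v l} → P u → T (adj G u w) → All (u ≢_) l → SPath P w v l → SPath P u v (u ∷ l)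

    suffix : ∀ {P u v w l} → SPath P w v l → u ∈ l → ∃[ l′ ] SPath P u v l′
    suffix s@(stop _)       (here refl) = _ , s
    suffix s@(link _ _ _ _) (here refl) = _ , s
    suffix (link _ _ _ s)   (there u∈l) = suffix s u∈l

    simplify : ∀ {P u v} → Walk G P u v → ∃[ l ] SPath P u v l
    simplify (here p) = _ , stop p
    simplify {u = u} (step p a r) with simplify r
    ... | l , s with any? (u Fin.≟_) l
    ...   | yes u∈l = suffix s u∈l
    ...   | no  u∉l = _ , link p a (Allₚ.¬Any⇒All¬ l u∉l) s

    SPath-All : ∀ {P u v l} → SPath P u v l → All P l
    SPath-All (stop p)       = p ∷ []
    SPath-All (link p _ _ s) = p ∷ SPath-All s

    SPath-Unique : ∀ {P u v l} → SPath P u v l → Unique l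
    SPath-Unique (stop _)       = [] ∷ []
    SPath-Unique (link _ _ f s) = f ∷ SPath-Unique s

    -- The predicates exclude each other, which keeps the concatenation simple.
    join : ∀ {P Q : Fin n → Set} → (∀ {x} → P x → ¬ Q x) → ∀ {u z s p l₁ l₂} →
           SPath P u z l₁ → T (adj G z s) → SPath Q s p l₂ → SPath (λ _ → ⊤) u p (l₁ ++ l₂)
    join {P} {Q} disj (stop p) a s = link tt a (All.map (λ q u≡x → disj p (subst Q (sym u≡x) q)) (SPath-All s)) (forget s)
      where
      forget : ∀ {u v l} → SPath Q u v l → SPath (λ _ → ⊤) u v l
      forget (stop _)       = stop tt
      forget (link _ a f s) = link tt a f (forget s)
    join {P} {Q} disj (link p b f r) a s =
      link tt b (Allₚ.++⁺ f (All.map (λ q u≡x → disj p (subst Q (sym u≡x) q)) (SPath-All s))) (join disj r a s)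

    lookup-injective : ∀ {l : List (Fin n)} → Unique l → ∀ {i j} → List.lookup l i ≡ List.lookup l j → i ≡ j
    lookup-injective (_ ∷ _) {Fin.zero}  {Fin.zero}  _ = refl
    lookup-injective (f ∷ _) {Fin.zero}  {Fin.suc j} e = ⊥-elim (All.lookup f (∈-lookup j) e)
    lookup-injective (f ∷ _) {Fin.suc i} {Fin.zero}  e = ⊥-elim (All.lookup f (∈-lookup i) (sym e))
    lookup-injective (_ ∷ u) {Fin.suc i} {Fin.suc j} e = cong Fin.suc (lookup-injective u e)

    consecutive : ∀ {P u v x l} → SPath P u v (x ∷ l) → ∀ i → T (adj G (List.lookup (x ∷ l) (inject₁ i)) (List.lookup l i))
    consecutive (link _ a _ (stop _))         Fin.zero    = a
    consecutive (link _ a _ (link _ _ _ _))   Fin.zero    = a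
    consecutive (link _ _ _ s@(link _ _ _ _)) (Fin.suc i) = consecutive s i

    SPath-last : ∀ {P u v x l} → SPath P u v (x ∷ l) → List.lookup (x ∷ l) (fromℕ (length l)) ≡ v
    SPath-last (stop _)                        = refl
    SPath-last (link _ _ _ s@(stop _))         = refl
    SPath-last (link _ _ _ s@(link _ _ _ _))   = SPath-last s

    SPath-first : ∀ {P u v x l} → SPath P u v (x ∷ l) → u ≡ x
    SPath-first (stop _)       = refl
    SPath-first (link _ _ _ _) = refl

    close : ∀ {P u v l} → SPath P u v l → 3 ≤ length l → T (adj G v u) → HasCycle G
    close {u = u} {v} {x ∷ y ∷ z ∷ l} s _ vu = length l , List.lookup (x ∷ y ∷ z ∷ l) , lookup-injective (SPath-Unique s) , consecutive s
      , subst₂ (λ a b → T (adj G a b)) (sym (SPath-last s)) (SPath-first s) vu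
    close {l = _ ∷ []}     s (s≤s ())       vu
    close {l = _ ∷ _ ∷ []} s (s≤s (s≤s ())) vu

    ends-distinct : ∀ {P u v l} → SPath P u v l → u ≢ v → 2 ≤ length l
    ends-distinct (stop _)                     u≢u = ⊥-elim (u≢u refl)
    ends-distinct (link _ _ _ (stop _))        _   = s≤s (s≤s z≤n)
    ends-distinct (link _ _ _ (link _ _ _ _))  _   = s≤s (s≤s z≤n)

    nonempty : ∀ {P u v l} → SPath P u v l → 1 ≤ length l
    nonempty (stop _)       = s≤s z≤n
    nonempty (link _ _ _ _) = s≤s z≤n

  -- The bags meet each vertex in a connected set of tree nodes.  Exploring the tree from r gives
  -- every node a level and a parent such that two bags with a common vertex v force v into the bag
  -- of the parent of the later one (the running intersection property).
  module Growth {m : ℕ} (tree : Graph m) (connected : Connected tree) (acyclic : ¬ HasCycle tree)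
    {V : Set} (In : V → Fin m → Set) (coherent : ∀ v i j → In v i → In v j → Walk tree (In v) i j) (r : Fin m) where

    open Paths tree

    Node : Set
    Node = Fin m

    -- `level` is the time of discovery and not the distance from `r`: a new node exceeds all
    -- earlier ones, so in `meet` it can only be the later of the two, and what is known of old
    -- pairs survives.
    record Explored : Set where
      field
        seen      : Node → Bool
        level     : Node → ℕ
        par       : Node → Node
        top       : ℕ
        root-seen : T (seen r)
        linked    : ∀ a b → T (seen a) → T (seen b) → Walk tree (T ∘ seen) a b
        level<top : ∀ x → T (seen x) → level x < top
        par-seen  : ∀ x → T (seen x) → T (seen (par x))
        par-level : ∀ x → T (seen x) → x ≢ r → level (par x) < level x
        meet      : ∀ v x y → T (seen x) → T (seen y) → x ≢ y → level y ≤ level x → In v x → In v y → In v (par x)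

    -- The walk is cut where it first enters the seen set.
    entry : ∀ {P : Node → Set} (seen : Node → Bool) {x y} → ¬ T (seen x) → T (seen y) → Walk tree P x y →
            ∃[ z ] ∃[ s ] (Walk tree (λ a → ¬ T (seen a)) x z × T (adj tree z s) × T (seen s) × P s)
    entry seen x∉ y∈ (here _) = ⊥-elim (x∉ y∈)
    entry seen x∉ y∈ (step {w = w} _ a rest) with T? (seen w)
    ... | yes w∈ = _ , w , here x∉ , a , w∈ , Walk-head rest
    ... | no  w∉ with entry seen w∉ y∈ rest
    ...   | z , s , walk , zs , s∈ , Ps = z , s , step x∉ a walk , zs , s∈ , Ps

    -- If the walk entered at some `s` other than `p`, the unseen stretch from `x`, the seen path
    -- from `s` to `p` and the edge back to `x` would close a cycle, with at least one unseen and
    -- two seen nodes.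
    single-entry : ∀ (seen : Node → Bool) → (∀ a b → T (seen a) → T (seen b) → Walk tree (T ∘ seen) a b) →
                   ∀ {P : Node → Set} {x y p} → ¬ T (seen x) → T (seen p) → T (adj tree p x) → T (seen y) → Walk tree P x y → P p
    single-entry seen linked {P} {x} {y} {p} x∉ p∈ px y∈ walk with entry seen x∉ y∈ walk
    ... | z , s , escape , zs , s∈ , Ps with s Fin.≟ p
    ...   | yes refl = Ps
    ...   | no s≢p with simplify escape | simplify (linked s p s∈ p∈)
    ...     | l₁ , path₁ | l₂ , path₂ = ⊥-elim (acyclic (close (join id path₁ zs path₂)
                (subst (3 ≤_) (sym (length-++ l₁)) (ℕₚ.+-mono-≤ (nonempty path₁) (ends-distinct path₂ s≢p))) px))

    start : Explored
    start = record
      { seen = λ x → x == r ; level = λ _ → 0 ; par = id ; top = 1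
      ; root-seen = ==⁺ {a = r} refl
      ; linked = λ a b a∈ b∈ → walk a∈ b∈ (==⁻ a∈) (==⁻ b∈)
      ; level<top = λ _ _ → s≤s z≤n
      ; par-seen = λ _ x∈ → x∈
      ; par-level = λ x x∈ x≢r → ⊥-elim (x≢r (==⁻ x∈))
      ; meet = λ v x y x∈ y∈ x≢y _ _ _ → ⊥-elim (x≢y (trans (==⁻ x∈) (sym (==⁻ y∈)))) }
      where
      walk : ∀ {a b} → T (a == r) → T (b == r) → a ≡ r → b ≡ r → Walk tree (λ x → T (x == r)) a b
      walk a∈ _ refl refl = here a∈

    module Extend (S : Explored) (x p : Node) (x∉ : ¬ T (Explored.seen S x)) (p∈ : T (Explored.seen S p)) (px : T (adj tree p x)) where

      open Explored S

      xp : T (adj tree x p)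
      xp = subst T (adj-sym tree p x) px

      seen′ : Node → Bool
      seen′ z = seen z ∨ (z == x)

      pick : ∀ {A : Set} → A → A → Node → A
      pick a b z = if z == x then a else b

      pick-new : ∀ {A : Set} (f : Node → A) a → pick a (f x) x ≡ a
      pick-new f a with x Fin.≟ x
      ... | yes _ = refl
      ... | no ≢  = ⊥-elim (≢ refl)

      pick-old : ∀ {A : Set} (f : Node → A) a {z} → T (seen z) → pick a (f z) z ≡ f z
      pick-old f a {z} z∈ with z Fin.≟ x
      ... | yes refl = ⊥-elim (x∉ z∈)
      ... | no _     = refl

      old : ∀ {z} → T (seen z) → T (seen′ z)
      old {z} z∈ = Equivalence.from (T-∨ {seen z}) (inj₁ z∈)

      new : T (seen′ x)
      new = Equivalence.from (T-∨ {seen x}) (inj₂ (==⁺ {a = x} refl))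

      cases : ∀ {z} → T (seen′ z) → T (seen z) ⊎ z ≡ x
      cases {z} z∈ with Equivalence.to (T-∨ {seen z}) z∈
      ... | inj₁ p = inj₁ p
      ... | inj₂ q = inj₂ (==⁻ q)

      level′ : Node → ℕ
      level′ z = pick top (level z) z

      par′ : Node → Node
      par′ z = pick p (par z) z

      extended : Explored
      extended = record
        { seen = seen′ ; level = level′ ; par = par′ ; top = suc top
        ; root-seen = old root-seen
        ; linked = λ a b a∈ b∈ → linked′ (cases a∈) (cases b∈)
        ; level<top = λ z z∈ → level<top′ (cases z∈)
        ; par-seen = λ z z∈ → par-seen′ (cases z∈)
        ; par-level = λ z z∈ z≢r → par-level′ (cases z∈) z≢r
        ; meet = λ v a b a∈ b∈ → meet′ v (cases a∈) (cases b∈) }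
        where
        lift : ∀ {a b} → Walk tree (T ∘ seen) a b → Walk tree (T ∘ seen′) a b
        lift = Walk-map (λ {z} → old {z})
        linked′ : ∀ {a b} → T (seen a) ⊎ a ≡ x → T (seen b) ⊎ b ≡ x → Walk tree (T ∘ seen′) a b
        linked′ (inj₁ a∈)   (inj₁ b∈)   = lift (linked _ _ a∈ b∈)
        linked′ (inj₁ a∈)   (inj₂ refl) = Walk-snoc (lift (linked _ _ a∈ p∈)) px new
        linked′ (inj₂ refl) (inj₁ b∈)   = step new xp (lift (linked _ _ p∈ b∈))
        linked′ (inj₂ refl) (inj₂ refl) = here new
        level<top′ : ∀ {z} → T (seen z) ⊎ z ≡ x → level′ z < suc top
        level<top′ {z} (inj₁ z∈)   = subst (_< suc top) (sym (pick-old level top z∈)) (ℕₚ.m<n⇒m<1+n (level<top z z∈))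
        level<top′     (inj₂ refl) = subst (_< suc top) (sym (pick-new level top)) (ℕₚ.n<1+n top)
        par-seen′ : ∀ {z} → T (seen z) ⊎ z ≡ x → T (seen′ (par′ z))
        par-seen′ {z} (inj₁ z∈)   = subst (T ∘ seen′) (sym (pick-old par p z∈)) (old (par-seen z z∈))
        par-seen′     (inj₂ refl) = subst (T ∘ seen′) (sym (pick-new par p)) (old p∈)
        par-level′ : ∀ {z} → T (seen z) ⊎ z ≡ x → z ≢ r → level′ (par′ z) < level′ z
        par-level′ {z} (inj₁ z∈) z≢r = subst₂ (λ a b → level′ a < b) (sym (pick-old par p z∈)) (sym (pick-old level top z∈))
          (subst (_< level z) (sym (pick-old level top (par-seen z z∈))) (par-level z z∈ z≢r))
        par-level′ (inj₂ refl) _ = subst₂ (λ a b → level′ a < b) (sym (pick-new par p)) (sym (pick-new level top))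
          (subst (_< top) (sym (pick-old level top p∈)) (level<top p p∈))
        meet′ : ∀ v {a b} → T (seen a) ⊎ a ≡ x → T (seen b) ⊎ b ≡ x → a ≢ b → level′ b ≤ level′ a → In v a → In v b → In v (par′ a)
        meet′ v {a} {b} (inj₁ a∈) (inj₁ b∈) a≢b le va vb = subst (In v) (sym (pick-old par p a∈))
          (meet v a b a∈ b∈ a≢b (subst₂ _≤_ (pick-old level top b∈) (pick-old level top a∈) le) va vb)
        meet′ v {a} (inj₁ a∈) (inj₂ refl) a≢b le va vb = ⊥-elim (ℕₚ.<⇒≱ (level<top a a∈)
          (subst₂ _≤_ (pick-new level top) (pick-old level top a∈) le))
        -- Coherence gives a walk from the new node to `b` through bags that contain `v`, and it
        -- must enter the seen set at the new parent.
        meet′ v {a} {b} (inj₂ refl) (inj₁ b∈) a≢b le va vb = subst (In v) (sym (pick-new par p))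
          (single-entry seen linked x∉ p∈ px b∈ (coherent v x b va vb))
        meet′ v (inj₂ refl) (inj₂ refl) a≢b le va vb = ⊥-elim (a≢b refl)

    open Explored

    along : ∀ (S : Explored) {u x} → T (seen S u) → Walk tree (λ _ → ⊤) u x →
            Σ Explored λ S′ → (∀ {z} → T (seen S z) → T (seen S′ z)) × T (seen S′ x)
    along S u∈ (here _) = S , id , u∈
    along S {u} u∈ (step {w = w} _ uw rest) with T? (seen S w)
    ... | yes w∈ = along S w∈ rest
    ... | no  w∉ with along (Extend.extended S w u w∉ u∈ uw) (Extend.new S w u w∉ u∈ uw) rest
    ...   | S′ , mono , x∈ = S′ , (λ {z} z∈ → mono (Extend.old S w u w∉ u∈ uw {z} z∈)) , x∈

    covering : ∀ (L : List Node) → Σ Explored λ S → All (T ∘ seen S) L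
    covering []      = start , []
    covering (x ∷ L) with covering L
    ... | S , all with along S (root-seen S) (connected r x)
    ...   | S′ , mono , x∈ = S′ , x∈ ∷ All.map (λ {z} → mono {z}) all

    explored : Σ Explored λ S → ∀ x → T (seen S x)
    explored with covering (allFin m)
    ... | S , all = S , λ x → All.lookup all (∈-allFin x)

  minimiser : ∀ {m} {P : Fin m → Set} → (∀ x → Dec (P x)) → (μ : Fin m → ℕ) → ∃ P → ∃[ x ] (P x × ∀ y → P y → μ x ≤ μ y)
  minimiser {m} {P} P? μ (x , Px) = go x Px (<-wellFounded (μ x))
    where
    go : ∀ x → P x → Acc _<_ (μ x) → ∃[ x ] (P x × ∀ y → P y → μ x ≤ μ y)
    go x Px (acc rec) with Finₚ.any? (λ y → P? y ×-dec (μ y ℕ.<? μ x))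
    ... | yes (y , Py , y<x) = go y Py (rec y<x)
    ... | no none            = x , Px , λ y Py → ℕₚ.≮⇒≥ (λ y<x → none (y , Py , y<x))

  module _ {A : Set} where

    count : (A → Bool) → List A → ℕ
    count p xs = length (filter (λ x → T? (p x)) xs)

    count-mono : ∀ {p r : A → Bool} → (∀ x → T (p x) → T (r x)) → ∀ xs → count p xs ≤ count r xs
    count-mono h [] = z≤n
    count-mono {p} {r} h (x ∷ xs) with p x | r x | h x
    ... | true  | true  | _ = s≤s (count-mono h xs)
    ... | true  | false | f = ⊥-elim (f _)
    ... | false | true  | _ = ℕₚ.m≤n⇒m≤1+n (count-mono h xs)
    ... | false | false | _ = count-mono h xs

    count-disjoint : ∀ {p s r : A → Bool} → (∀ x → T (p x) → T (r x)) → (∀ x → T (s x) → T (r x)) → (∀ x → T (p x) → ¬ T (s x)) →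
                     ∀ xs → count p xs + count s xs ≤ count r xs
    count-disjoint f g h [] = z≤n
    count-disjoint {p} {s} {r} f g h (x ∷ xs) with p x | s x | r x | f x | g x | h x
    ... | true  | true  | _     | _  | _  | k = ⊥-elim (k _ _)
    ... | true  | false | true  | _  | _  | _ = s≤s (count-disjoint f g h xs)
    ... | true  | false | false | f′ | _  | _ = ⊥-elim (f′ _)
    ... | false | true  | true  | _  | _  | _ = subst (_≤ suc (count r xs)) (sym (ℕₚ.+-suc (count p xs) (count s xs))) (s≤s (count-disjoint f g h xs))
    ... | false | true  | false | _  | g′ | _ = ⊥-elim (g′ _)
    ... | false | false | true  | _  | _  | _ = ℕₚ.m≤n⇒m≤1+n (count-disjoint f g h xs)
    ... | false | false | false | _  | _  | _ = count-disjoint f g h xs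

  -- Constructing eliminations.

  module Eliminations {n : ℕ} (G : Graph n) where

    VSet : Set
    VSet = Fin n → Bool

    -- The vertex set is an index, hence fixed up to definitional equality; splitting off an empty
    -- part replaces it by any pointwise equal function at no cost.
    Elim-resp : ∀ {U U′ k} → (∀ u → U′ u ≡ U u) → Elim G U k → Elim G U′ k
    Elim-resp {U} e el = split U (λ _ → false) (λ u → trans (e u) (sym (∨-identityʳ (U u)))) (λ _ _ → refl) (λ _ _ _ ()) el (empty (λ _ → refl))

    minus : VSet → List (Fin n) → VSet
    minus U []       = U
    minus U (x ∷ xs) = minus (λ u → U u ∧ not (u == x)) xs

    minus⁻ : ∀ xs {U u} → T (minus U xs u) → T (U u) × ¬ (u ∈ xs)
    minus⁻ []       t = t , λ ()
    minus⁻ (x ∷ xs) {U} {u} t with minus⁻ xs {λ u → U u ∧ not (u == x)} t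
    ... | t′ , u∉xs with ∧⁻ {U u} t′
    ...   | Uu , u≠x = Uu , λ { (here e) → T-not⁻ u≠x (==⁺ e) ; (there i) → u∉xs i }

    -- A listed vertex outside `U` costs a round too, by `weaken`, so that the depth is governed by
    -- the length of the list alone.
    strip : ∀ xs {U k} → Elim G (minus U xs) k → Elim G U (length xs + k)
    strip []       e = e
    strip (x ∷ xs) {U} {k} e with U x in eq
    ... | true  = remove x eq (strip xs e)
    ... | false = weaken (Elim-resp same (strip xs e))
      where
      same : ∀ u → U u ≡ U u ∧ not (u == x)
      same u = T-iff (λ t → ∧⁺ t (T-not⁺ λ e′ → subst T eq (subst (T ∘ U) (==⁻ e′) t))) (λ t → proj₁ (∧⁻ {U u} t))

    weakenBy : ∀ j {U k} → Elim G U k → Elim G U (j + k)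
    weakenBy zero    e = e
    weakenBy (suc j) e = weaken (weakenBy j e)

    -- Label classes have no edges between them and are split off one at a time; a split costs no
    -- round, so the depth is independent of the number of labels.
    byLabels : ∀ {m} {U : VSet} {k} (lab : Fin n → Fin m) →
               (∀ u v → T (U u) → T (U v) → T (adj G u v) → lab u ≡ lab v) →
               (∀ c → Elim G (λ u → U u ∧ (lab u == c)) k) → Elim G U k
    byLabels {m} {U} {k} lab respects classes = Elim-resp full (go m ℕₚ.≤-refl)
      where
      below : ℕ → VSet
      below i u = U u ∧ ⌊ toℕ (lab u) ℕ.<? i ⌋
      full : ∀ u → U u ≡ below m u
      full u = T-iff (λ t → ∧⁺ t (fromWitness (Finₚ.toℕ<n (lab u)))) (λ t → proj₁ (∧⁻ {U u} t))
      go : ∀ i → i ≤ m → Elim G (below i) k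
      go zero    _   = empty λ u → ¬T⇒≡ λ t → none (toWitness {a? = toℕ (lab u) ℕ.<? 0} (proj₂ (∧⁻ {U u} t)))
        where
        none : ∀ {x} → ¬ (x < 0)
        none ()
      go (suc i) i<m = split (λ u → U u ∧ (lab u == c)) (below i) eq disj sep (classes c) (go i (ℕₚ.<⇒≤ i<m))
        where
        c : Fin m
        c = fromℕ< i<m
        c≡i : toℕ c ≡ i
        c≡i = Finₚ.toℕ-fromℕ< i<m
        lt : ∀ u i → T (below i u) → toℕ (lab u) < i
        lt u i t = toWitness {a? = toℕ (lab u) ℕ.<? i} (proj₂ (∧⁻ {U u} t))
        eq : ∀ u → below (suc i) u ≡ (U u ∧ (lab u == c)) ∨ below i u
        eq u = T-iff to from
          where
          to : T (below (suc i) u) → T ((U u ∧ (lab u == c)) ∨ below i u)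
          to t with toℕ (lab u) ℕ.≟ i
          ... | yes e = Equivalence.from (T-∨ {U u ∧ (lab u == c)}) (inj₁ (∧⁺ (proj₁ (∧⁻ {U u} t)) (==⁺ (Finₚ.toℕ-injective (trans e (sym c≡i))))))
          ... | no ≢i = Equivalence.from (T-∨ {U u ∧ (lab u == c)}) (inj₂ (∧⁺ (proj₁ (∧⁻ {U u} t)) (fromWitness (ℕₚ.≤∧≢⇒< (ℕ.s≤s⁻¹ (lt u (suc i) t)) ≢i))))
          from : T ((U u ∧ (lab u == c)) ∨ below i u) → T (below (suc i) u)
          from t with Equivalence.to (T-∨ {U u ∧ (lab u == c)}) t
          ... | inj₁ t₁ = ∧⁺ (proj₁ (∧⁻ {U u} t₁)) (fromWitness (s≤s (ℕₚ.≤-reflexive (trans (cong toℕ (==⁻ (proj₂ (∧⁻ {U u} t₁)))) c≡i))))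
          ... | inj₂ t₂ = ∧⁺ (proj₁ (∧⁻ {U u} t₂)) (fromWitness (ℕₚ.m<n⇒m<1+n (lt u i t₂)))
        lab≡i : ∀ u → U u ∧ (lab u == c) ≡ true → toℕ (lab u) ≡ i
        lab≡i u e = trans (cong toℕ (==⁻ (proj₂ (∧⁻ {U u} (≡⇒T e))))) c≡i
        disj : ∀ u → U u ∧ (lab u == c) ≡ true → below i u ≡ false
        disj u e = ¬T⇒≡ λ t → ℕₚ.<-irrefl (lab≡i u e) (lt u i t)
        sep : ∀ u v → U u ∧ (lab u == c) ≡ true → below i v ≡ true → ¬ T (adj G u v)
        sep u v e e′ uv = ℕₚ.<-irrefl (trans (cong toℕ (sym (respects u v (proj₁ (∧⁻ {U u} (≡⇒T e))) (proj₁ (∧⁻ {U v} (≡⇒T e′))) uv))) (lab≡i u e)) (lt v i (≡⇒T e′))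

  members : ∀ {n} → Subset n → List (Fin n)
  members V.[]              = []
  members (inside V.∷ p)    = Fin.zero ∷ map Fin.suc (members p)
  members (outside V.∷ p)   = map Fin.suc (members p)

  length-members : ∀ {n} (p : Subset n) → length (members p) ≡ Sub.∣ p ∣
  length-members V.[]            = refl
  length-members (inside V.∷ p)  = cong suc (trans (length-map Fin.suc (members p)) (length-members p))
  length-members (outside V.∷ p) = trans (length-map Fin.suc (members p)) (length-members p)

  ∈-members : ∀ {n} {p : Subset n} {v} → v Sub.∈ p → v ∈ members p
  ∈-members {p = inside V.∷ p}  here      = here refl
  ∈-members {p = inside V.∷ p}  (there i) = there (∈-map⁺ Fin.suc (∈-members i))
  ∈-members {p = outside V.∷ p} (there i) = ∈-map⁺ Fin.suc (∈-members i)

  -- Balanced separators from a tree decomposition.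

  module Separation {n : ℕ} {G : Graph n} (𝒟 : TreeDecomposition G) where

    open TreeDecomposition 𝒟 using (m; tree; isTree; bag; cover; edgeCov; coherent)
    open Eliminations G

    r : Fin m
    r = fromℕ< (proj₁ isTree)

    module Gr = Growth tree (proj₁ (proj₂ isTree)) (proj₂ (proj₂ isTree)) (λ v i → v Sub.∈ bag i) coherent r
    open Gr using (Node)

    𝒮 : Gr.Explored
    𝒮 = proj₁ Gr.explored

    open Gr.Explored 𝒮 using (level; par; top)

    seen-all : ∀ x → T (Gr.Explored.seen 𝒮 x)
    seen-all = proj₂ Gr.explored

    level<top : ∀ x → level x < top
    level<top x = Gr.Explored.level<top 𝒮 x (seen-all x)

    par-level : ∀ x → x ≢ r → level (par x) < level x
    par-level x = Gr.Explored.par-level 𝒮 x (seen-all x)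

    meet : ∀ v x y → x ≢ y → level y ≤ level x → v Sub.∈ bag x → v Sub.∈ bag y → v Sub.∈ bag (par x)
    meet v x y = Gr.Explored.meet 𝒮 v x y (seen-all x) (seen-all y)

    level-induction : ∀ (P : Node → Set) → (∀ x → (x ≢ r → P (par x)) → P x) → ∀ x → P x
    level-induction P ih x = go x (<-wellFounded (level x))
      where
      go : ∀ x → Acc _<_ (level x) → P x
      go x (acc rec) = ih x λ x≢r → go (par x) (rec (par-level x x≢r))

    root-lowest : ∀ x → x ≢ r → level r < level x
    root-lowest = level-induction _ λ x ih x≢r → onCase x x≢r (par x Fin.≟ r) (ih x≢r)
      where
      onCase : ∀ x → x ≢ r → Dec (par x ≡ r) → (par x ≢ r → level r < level (par x)) → level r < level x
      onCase x x≢r (yes e)  _ = subst (λ z → level z < level x) e (par-level x x≢r)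
      onCase x x≢r (no ≢r) ih = ℕₚ.<-trans (ih ≢r) (par-level x x≢r)

    -- climb s x is the first node at or above x that is the root or satisfies s.
    module Climb (s : Node → Bool) where

      up : Node → Node
      up x = if (x == r) ∨ s x then x else par x

      up-stop : ∀ {x} → T ((x == r) ∨ s x) → up x ≡ x
      up-stop {x} t rewrite T⇒≡ t = refl

      up-go : ∀ {x} → x ≢ r → ¬ T (s x) → up x ≡ par x
      up-go {x} x≢r ¬s rewrite ¬T⇒≡ {(x == r) ∨ s x} (λ t → [ (λ e → x≢r (==⁻ e)) , ¬s ]′ (Equivalence.to (T-∨ {x == r}) t)) = refl

      iter : ℕ → Node → Node
      iter zero    x = x
      iter (suc k) x = iter k (up x)

      iter-up : ∀ k x → iter k (up x) ≡ up (iter k x)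
      iter-up zero    x = refl
      iter-up (suc k) x = iter-up k (up x)

      iter-stop : ∀ k {x} → up x ≡ x → iter k x ≡ x
      iter-stop zero    e = refl
      iter-stop (suc k) {x} e = trans (cong (iter k) e) (iter-stop k e)

      -- Levels drop strictly on the way up, so `level x` steps reach the stopping node; `climb`
      -- takes `top` steps, which is more for every node.
      iter-fixed : ∀ k x → level x ≤ k → up (iter k x) ≡ iter k x
      iter-fixed k x le = onCase k le (x Fin.≟ r) (T? (s x))
        where
        stopped : ∀ k → up x ≡ x → up (iter k x) ≡ iter k x
        stopped k e = trans (cong up (iter-stop k e)) (trans e (sym (iter-stop k e)))
        onCase : ∀ k → level x ≤ k → Dec (x ≡ r) → Dec (T (s x)) → up (iter k x) ≡ iter k x
        onCase k       le (yes e)  _       = stopped k (up-stop (Equivalence.from (T-∨ {x == r}) (inj₁ (==⁺ e))))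
        onCase k       le (no _)   (yes t) = stopped k (up-stop (Equivalence.from (T-∨ {x == r}) (inj₂ t)))
        onCase zero    le (no x≢r) (no _)  = ⊥-elim (ℕₚ.<⇒≱ (par-level x x≢r) (ℕₚ.≤-trans le z≤n))
        onCase (suc k) le (no x≢r) (no ¬t) = iter-fixed k (up x) (subst (λ z → level z ≤ k) (sym (up-go x≢r ¬t))
          (ℕ.s≤s⁻¹ (ℕₚ.≤-trans (par-level x x≢r) le)))

      climb : Node → Node
      climb = iter top

      climb-root : climb r ≡ r
      climb-root = iter-stop top (up-stop (Equivalence.from (T-∨ {r == r}) (inj₁ (==⁺ {a = r} refl))))

      climb-stop : ∀ {x} → T (s x) → climb x ≡ x
      climb-stop {x} t = iter-stop top (up-stop (Equivalence.from (T-∨ {x == r}) (inj₂ t)))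

      climb-par : ∀ {x} → x ≢ r → ¬ T (s x) → climb x ≡ climb (par x)
      climb-par {x} x≢r ¬s = trans (sym (iter-fixed top x (ℕₚ.<⇒≤ (level<top x)))) (trans (sym (iter-up top x)) (cong climb (up-go x≢r ¬s)))

      climb-end : ∀ x → climb x ≡ r ⊎ T (s (climb x))
      climb-end = level-induction _ λ x ih → onCase x (x Fin.≟ r) (T? (s x)) ih
        where
        onCase : ∀ x → Dec (x ≡ r) → Dec (T (s x)) → (x ≢ r → climb (par x) ≡ r ⊎ T (s (climb (par x)))) → climb x ≡ r ⊎ T (s (climb x))
        onCase x (yes refl) _ _  = inj₁ climb-root
        onCase x (no _) (yes t) _ = inj₂ (subst (T ∘ s) (sym (climb-stop t)) t)
        onCase x (no x≢r) (no ¬t) ih = subst (λ z → z ≡ r ⊎ T (s z)) (sym (climb-par x≢r ¬t)) (ih x≢r)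

    -- `c` is at or above `x`: a climb told to halt at `c` ends there instead of passing it by on
    -- the way to the root.
    desc : Node → Node → Bool
    desc c x = Climb.climb (_== c) x == c

    -- lab i x names the component of x after node i is deleted, by its top node.
    lab : Node → Node → Node
    lab i = Climb.climb (λ x → par x == i)

    desc-root : ∀ x → T (desc r x)
    desc-root x = ==⁺ ([ id , ==⁻ ]′ (Climb.climb-end (_== r) x))

    lab⇒desc : ∀ i c x → lab i x ≡ c → T (desc c x)
    lab⇒desc i c x e = ==⁺ (level-induction (λ x → lab i x ≡ c → Climb.climb (_== c) x ≡ c) (λ x ih → onCase x (x Fin.≟ c) (x Fin.≟ r) (T? (par x == i)) ih) x e)
      where
      onCase : ∀ x → Dec (x ≡ c) → Dec (x ≡ r) → Dec (T (par x == i)) → (x ≢ r → lab i (par x) ≡ c → Climb.climb (_== c) (par x) ≡ c) →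
               lab i x ≡ c → Climb.climb (_== c) x ≡ c
      onCase x (yes refl) _ _ _ _ = Climb.climb-stop (_== c) (==⁺ {a = x} refl)
      onCase x (no x≢c) (yes refl) _ _ e = ⊥-elim (x≢c (trans (sym (Climb.climb-root (λ x → par x == i))) e))
      onCase x (no x≢c) (no _) (yes t) _ e = ⊥-elim (x≢c (trans (sym (Climb.climb-stop (λ x → par x == i) t)) e))
      onCase x (no x≢c) (no x≢r) (no ¬t) ih e = trans (Climb.climb-par (_== c) x≢r (x≢c ∘ ==⁻))
        (ih x≢r (trans (sym (Climb.climb-par (λ x → par x == i) x≢r ¬t)) e))

    -- A climb from strictly below `i` halts at a child of `i`, hence never reaches the root.
    lab-root : ∀ i x → lab i x ≡ r → x ≢ i → ¬ T (desc i x)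
    lab-root i x e x≢i t = level-induction (λ x → lab i x ≡ r → x ≢ i → Climb.climb (_== i) x ≢ i) (λ x ih → onCase x (x Fin.≟ r) (T? (par x == i)) ih) x e x≢i (==⁻ t)
      where
      onCase : ∀ x → Dec (x ≡ r) → Dec (T (par x == i)) → (x ≢ r → lab i (par x) ≡ r → par x ≢ i → Climb.climb (_== i) (par x) ≢ i) →
               lab i x ≡ r → x ≢ i → Climb.climb (_== i) x ≢ i
      onCase x (yes refl) _ _ _ x≢i d = x≢i (trans (sym (Climb.climb-root (_== i))) d)
      onCase x (no x≢r) (yes t) _ e _ _ = x≢r (trans (sym (Climb.climb-stop (λ x → par x == i) t)) e)
      onCase x (no x≢r) (no ¬t) ih e x≢i d = ih x≢r (trans (sym (Climb.climb-par (λ x → par x == i) x≢r ¬t)) e) (¬t ∘ ==⁺)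
        (trans (sym (Climb.climb-par (_== i) x≢r (x≢i ∘ ==⁻))) d)

    highest : ∀ v → ∃[ x ] (v Sub.∈ bag x × ∀ y → v Sub.∈ bag y → level x ≤ level y)
    highest v = minimiser (λ x → v ∈? bag x) level (cover v)

    -- Each vertex is charged to one node only, the top of the subtree formed by the bags that
    -- contain it, so that sizes add up over disjoint sets of nodes.
    home : Fin n → Node
    home v = proj₁ (highest v)

    home∈ : ∀ v → v Sub.∈ bag (home v)
    home∈ v = proj₁ (proj₂ (highest v))

    -- Every bag between k and home u contains u, hence none of them is bag i.
    lab-home : ∀ i u → ¬ (u Sub.∈ bag i) → ∀ k → u Sub.∈ bag k → lab i k ≡ lab i (home u)
    lab-home i u u∉i = level-induction _ λ k ih k∋u → onCase k k∋u (k Fin.≟ home u) ih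
      where
      onCase : ∀ k → u Sub.∈ bag k → Dec (k ≡ home u) → (k ≢ r → u Sub.∈ bag (par k) → lab i (par k) ≡ lab i (home u)) → lab i k ≡ lab i (home u)
      onCase k k∋u (yes e) _ = cong (lab i) e
      onCase k k∋u (no k≢h) ih = trans (Climb.climb-par (λ x → par x == i) k≢r (λ t → u∉i (subst (λ z → u Sub.∈ bag z) (==⁻ t) par∋u))) (ih k≢r par∋u)
        where
        h≤k : level (home u) ≤ level k
        h≤k = proj₂ (proj₂ (highest u)) k k∋u
        k≢r : k ≢ r
        k≢r refl = ℕₚ.<⇒≱ (root-lowest (home u) (λ e → k≢h (sym e))) h≤k
        par∋u : u Sub.∈ bag (par k)
        par∋u = meet u k (home u) k≢h h≤k k∋u (home∈ u)

    size : VSet → ℕ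
    size U = countV n U

    weight : VSet → Node → ℕ
    weight U c = size (λ v → U v ∧ desc c (home v))

    -- Take the node of greatest level, that is of least `top ∸ level`, whose subtree holds more
    -- than half of `U`. One exists, because all homes lie at or below the root.
    centroid : ∀ U → 1 ≤ size U → ∃[ i ] (size U < 2 * weight U i × ∀ c → level i < level c → 2 * weight U c ≤ size U)
    centroid U 1≤ with minimiser (λ i → size U ℕ.<? 2 * weight U i) (λ i → top ∸ level i) (r , heavy)
      where
      heavy : size U < 2 * weight U r
      heavy = ℕₚ.<-≤-trans (ℕₚ.m<m+n (size U) 1≤) (ℕₚ.≤-trans (ℕₚ.≤-reflexive (cong (size U +_) (sym (ℕₚ.+-identityʳ (size U)))))
        (ℕₚ.*-monoʳ-≤ 2 (count-mono (λ v t → ∧⁺ t (desc-root (home v))) (allFin n))))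
    ... | i , heavy , best = i , heavy , λ c i<c → ℕₚ.≮⇒≥ λ h → ℕₚ.<⇒≱ (ℕₚ.∸-monoʳ-< i<c (ℕₚ.<⇒≤ (level<top c))) (best c h)

    module Cut (U : VSet) (i : Node) (heavy : size U < 2 * weight U i) (best : ∀ c → level i < level c → 2 * weight U c ≤ size U) where

      rest : VSet
      rest = minus U (members (bag i))

      rest⊆ : ∀ {u} → T (rest u) → T (U u)
      rest⊆ t = proj₁ (minus⁻ (members (bag i)) t)

      rest∉ : ∀ {u} → T (rest u) → ¬ (u Sub.∈ bag i)
      rest∉ t = proj₂ (minus⁻ (members (bag i)) t) ∘ ∈-members

      label : Fin n → Node
      label u = lab i (home u)

      -- The edge lies in some bag `k`, and a vertex of that bag outside bag `i` carries the label
      -- of `k`.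
      respects : ∀ u v → T (rest u) → T (rest v) → T (adj G u v) → label u ≡ label v
      respects u v tu tv uv with edgeCov u v uv
      ... | k , u∈k , v∈k = trans (sym (lab-home i u (rest∉ tu) k u∈k)) (lab-home i v (rest∉ tv) k v∈k)

      part : Node → VSet
      part c u = rest u ∧ (label u == c)

      -- The root component is disjoint from the subtree of `i`, which holds more than half. The
      -- component of a child `c` of `i` lies in the subtree of `c`, which is light since `c` has
      -- greater level than `i`. No other node occurs as a label.
      halved : ∀ c → 2 * size (part c) ≤ size U
      halved c with c Fin.≟ r
      ... | yes refl = ℕₚ.≤-trans (ℕₚ.+-cancelʳ-≤ (size U) _ _ (ℕₚ.≤-trans (ℕₚ.+-monoʳ-≤ (2 * size (part r)) (ℕₚ.<⇒≤ heavy))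
          (ℕₚ.≤-trans (ℕₚ.≤-reflexive (sym (ℕₚ.*-distribˡ-+ 2 (size (part r)) (weight U i))))
            (ℕₚ.≤-trans (ℕₚ.*-monoʳ-≤ 2 disjoint) (ℕₚ.≤-reflexive (cong (size U +_) (ℕₚ.+-identityʳ (size U)))))))) ℕₚ.≤-refl
        where
        disjoint : size (part r) + weight U i ≤ size U
        disjoint = count-disjoint {p = part r} (λ u t → rest⊆ (proj₁ (∧⁻ {rest u} t))) (λ u t → proj₁ (∧⁻ {U u} t))
          (λ u t t′ → lab-root i (home u) (==⁻ (proj₂ (∧⁻ {rest u} t))) (λ e → rest∉ (proj₁ (∧⁻ {rest u} t)) (subst (λ z → u Sub.∈ bag z) e (home∈ u))) (proj₂ (∧⁻ {U u} t′))) (allFin n)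
      ... | no c≢r with T? (par c == i)
      ...   | yes t = ℕₚ.≤-trans (ℕₚ.*-monoʳ-≤ 2 (count-mono (λ u p → ∧⁺ (rest⊆ (proj₁ (∧⁻ {rest u} p))) (lab⇒desc i c (home u) (==⁻ (proj₂ (∧⁻ {rest u} p))))) (allFin n)))
          (best c (subst (λ z → level z < level c) (==⁻ t) (par-level c c≢r)))
      ...   | no ¬t = ℕₚ.≤-trans (ℕₚ.*-monoʳ-≤ 2 (count-mono {r = λ _ → false} (λ u p → noLabel u (==⁻ (proj₂ (∧⁻ {rest u} p)))) (allFin n))) (none (allFin n))
        where
        noLabel : ∀ u → label u ≡ c → ⊥
        noLabel u refl with Climb.climb-end (λ x → par x == i) (home u)
        ... | inj₁ e = c≢r e
        ... | inj₂ t = ¬t t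
        none : ∀ xs → 2 * count {Fin n} (λ _ → false) xs ≤ size U
        none []       = z≤n
        none (x ∷ xs) = none xs

    -- Deleting the bag of the centroid leaves components of at most half the size, so each call
    -- lowers the exponent `l` by one for at most `b` rounds.
    elimination : ∀ {b} → BagsAtMost 𝒟 b → ∀ l U → size U < 2 ^ l → Elim G U (b * l)
    elimination {b} bags l U lt with 1 ℕ.≤? size U
    ... | no ¬1≤ = empty λ u → ¬T⇒≡ λ t → ¬1≤ (∈-length (∈-filter⁺ (λ v → T? (U v)) (∈-allFin u) t))
    elimination bags zero    U lt | yes 1≤ = ⊥-elim (ℕₚ.<⇒≱ lt 1≤)
    elimination {b} bags (suc l) U lt | yes 1≤ with centroid U 1≤
    -- A bag may have fewer than `b` vertices; padding makes every stage cost exactly `b` rounds.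
    ... | i , heavy , best = subst (Elim G U) depth (weakenBy (b ∸ length xs) (strip xs (byLabels label respects parts)))
      where
      open Cut U i heavy best
      xs : List (Fin n)
      xs = members (bag i)
      parts : ∀ c → Elim G (part c) (b * l)
      parts c = elimination bags l (part c) (ℕₚ.*-cancelˡ-< 2 (size (part c)) (2 ^ l) (ℕₚ.≤-<-trans (halved c) lt))
      depth : (b ∸ length xs) + (length xs + b * l) ≡ b * suc l
      depth = trans (sym (ℕₚ.+-assoc (b ∸ length xs) (length xs) (b * l))) (trans (cong (_+ b * l) (ℕₚ.m∸n+n≡m (subst (_≤ b) (sym (length-members (bag i))) (bags i)))) (sym (ℕₚ.*-suc b l)))

open Analysis
open Decompositions
open import Data.Nat using (_≤_; _<_; z≤n; s≤s; _+_; _*_; _∸_; _^_; _<?_; _≤?_; >-nonZero)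
open import Data.Nat.Properties

-- Numerical bounds and conclusion.

tvDist≤¼ : ∀ {n} q (G : Graph n) σ₀ s → 2ℚ ℚ.* Glauber.ℓ¹ q G σ₀ s ℚ.≤ ℚ.1ℚ → tvDist G σ₀ s ℚ.≤ (ℤ.+ 1 ℚ./ 4)
-- The factor 1/2 of the total variation distance is 1/4 times 2 by computation, which produces the
-- 2 of the hypothesis.
tvDist≤¼ q G σ₀ s h = subst (ℚ._≤ (ℤ.+ 1 ℚ./ 4)) (sym (ℚₚ.*-assoc (ℤ.+ 1 ℚ./ 4) 2ℚ (Glauber.ℓ¹ q G σ₀ s)))
  (*-monoʳ {ℤ.+ 1 ℚ./ 4} (ℚₚ.nonNegative⁻¹ (ℤ.+ 1 ℚ./ 4)) h)

countV≤ : ∀ n p → countV n p ≤ n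
countV≤ n p = subst (countV n p ≤_) (length-tabulate {n = n} id) (length-filter (λ v → T? (p v)) (allFin n))

log₂ : ∀ n → 1 ≤ n → ∃[ l ] (2 ^ l ≤ n × n < 2 ^ suc l)
log₂ (suc zero)      _ = 0 , ≤-refl , ≤-refl
log₂ (suc n@(suc _)) _ with log₂ n (s≤s z≤n)
... | l , 2^l≤n , n<2^ with suc n <? 2 ^ suc l
...   | yes lt = l , m≤n⇒m≤1+n 2^l≤n , lt
...   | no ¬lt = suc l , ≮⇒≥ ¬lt , ≤-<-trans n<2^ (^-monoʳ-< 2 (s≤s (s≤s z≤n)) (n<1+n (suc l)))

module Bounds (n Δ t : ℕ) (3≤n : 3 ≤ n) (1≤Δ : 1 ≤ Δ) (1≤t : 1 ≤ t) where

  n^-mono : ∀ {a b} → a ≤ b → n ^ a ≤ n ^ b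
  n^-mono = ^-monoʳ-≤ n {{>-nonZero (≤-trans (s≤s z≤n) 3≤n)}}

  n² n⁴ : ℕ
  n² = n * n
  n⁴ = n² * n²

  3n≤n² : 3 * n ≤ n²
  3n≤n² = *-monoˡ-≤ n 3≤n

  9≤n² : 9 ≤ n²
  9≤n² = *-mono-≤ 3≤n 3≤n

  n⁴≡ : n⁴ ≡ n ^ 4
  n⁴≡ = eq n
    where
    eq : ∀ n → n * n * (n * n) ≡ n * (n * (n * (n * 1)))
    eq = ℕ-solve-∀

  1≤tΔ : 1 ≤ t * Δ
  1≤tΔ = *-mono-≤ 1≤t 1≤Δ

  -- Origin of the constant 21 = 5 + 16: the additive 5 is absorbed because tΔ ≥ 1.
  exponent : ∀ {e} → e ≤ 5 + 16 * (t * Δ) → e ≤ 21 * t * Δ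
  exponent {e} h = ≤-trans h (≤-trans (+-monoˡ-≤ (16 * (t * Δ)) (*-monoʳ-≤ 5 1≤tΔ)) (≤-reflexive (eq t Δ)))
    where
    eq : ∀ t Δ → 5 * (t * Δ) + 16 * (t * Δ) ≡ 21 * t * Δ
    eq = ℕ-solve-∀

  -- The inverse rate 2n times n + 2 halvings, which are enough because 4n ≤ 2^(n+2). Both factors
  -- are at most n².
  dobrushin-time : (n + n) * (2 + n) ≤ n ^ (21 * t * Δ)
  dobrushin-time = ≤-trans (*-mono-≤ 2n≤ n+2≤) (≤-trans (≤-reflexive n⁴≡) (n^-mono (exponent (≤-trans (n≤1+n 4) (m≤m+n 5 (16 * (t * Δ)))))))
    where
    2n≤ : n + n ≤ n²
    2n≤ = ≤-trans (+-monoʳ-≤ n (m≤m+n n (n + 0))) 3n≤n²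
    n+2≤ : 2 + n ≤ n²
    n+2≤ = ≤-trans (+-monoˡ-≤ n (≤-trans (n≤1+n 2) 3≤n)) 2n≤

  -- As 2^(l+1) ≤ n², the factor 4^((Δ+1)(t+1)(l+1)) is at most n^(4(t+1)(Δ+1)), and 4(t+1)(Δ+1) ≤
  -- 16tΔ. The prefactor n and the n⁴ that bounds the number of halvings supply the 5.
  l²-time : ∀ l → 2 ^ l ≤ n → n * (4 ^ suc Δ) ^ (suc t * suc l) * (2 + 4 * n²) ≤ n ^ (21 * t * Δ)
  l²-time l 2^l≤n = ≤-trans (*-mono-≤ (*-monoʳ-≤ n gap≤) r≤) (≤-trans (≤-reflexive collect) (n^-mono (exponent (+-monoʳ-≤ 5 (≤-trans (*-monoʳ-≤ 4 (*-mono-≤ t+1≤ Δ+1≤)) (≤-reflexive (eq₂ t Δ)))))))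
    where
    eq₀ : ∀ a b c → 2 * (a * (b * c)) ≡ c * (2 * (b * a))
    eq₀ = ℕ-solve-∀
    eq₁ : ∀ a b → 2 * (2 * (a * b)) ≡ 4 * (a * b)
    eq₁ = ℕ-solve-∀
    eq₂ : ∀ t Δ → 4 * (2 * t * (2 * Δ)) ≡ 16 * (t * Δ)
    eq₂ = ℕ-solve-∀
    t+1≤ : suc t ≤ 2 * t
    t+1≤ = ≤-trans (+-monoˡ-≤ t 1≤t) (≤-reflexive (cong (t +_) (sym (+-identityʳ t))))
    Δ+1≤ : suc Δ ≤ 2 * Δ
    Δ+1≤ = ≤-trans (+-monoˡ-≤ Δ 1≤Δ) (≤-reflexive (cong (Δ +_) (sym (+-identityʳ Δ))))
    2^[1+l]≤ : 2 ^ suc l ≤ n ^ 2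
    2^[1+l]≤ = ≤-trans (*-monoʳ-≤ 2 2^l≤n) (≤-trans (*-monoˡ-≤ n (≤-trans (n≤1+n 2) 3≤n)) (≤-reflexive (cong (n *_) (sym (*-identityʳ n)))))
    gap≤ : (4 ^ suc Δ) ^ (suc t * suc l) ≤ n ^ (4 * (suc t * suc Δ))
    gap≤ = begin
      (4 ^ suc Δ) ^ (suc t * suc l)  ≡⟨ ^-*-assoc 4 (suc Δ) (suc t * suc l) ⟩
      (2 ^ 2) ^ (suc Δ * (suc t * suc l))  ≡⟨ ^-*-assoc 2 2 (suc Δ * (suc t * suc l)) ⟩
      2 ^ (2 * (suc Δ * (suc t * suc l)))  ≡⟨ cong (2 ^_) (eq₀ (suc Δ) (suc t) (suc l)) ⟩
      2 ^ (suc l * (2 * (suc t * suc Δ)))  ≡⟨ ^-*-assoc 2 (suc l) (2 * (suc t * suc Δ)) ⟨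
      (2 ^ suc l) ^ (2 * (suc t * suc Δ))  ≤⟨ ^-monoˡ-≤ (2 * (suc t * suc Δ)) 2^[1+l]≤ ⟩
      (n ^ 2) ^ (2 * (suc t * suc Δ))  ≡⟨ ^-*-assoc n 2 (2 * (suc t * suc Δ)) ⟩
      n ^ (2 * (2 * (suc t * suc Δ)))  ≡⟨ cong (n ^_) (eq₁ (suc t) (suc Δ)) ⟩
      n ^ (4 * (suc t * suc Δ))  ∎
      where open ≤-Reasoning
    r≤ : 2 + 4 * n² ≤ n ^ 4
    r≤ = begin
      2 + 4 * n²  ≤⟨ +-monoˡ-≤ (4 * n²) (≤-trans (m≤m+n 2 7) 9≤n²) ⟩
      5 * n²  ≤⟨ *-monoˡ-≤ n² (≤-trans (m≤m+n 5 4) 9≤n²) ⟩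
      n⁴  ≡⟨ n⁴≡ ⟩
      n ^ 4  ∎
      where open ≤-Reasoning
    collect : n * n ^ (4 * (suc t * suc Δ)) * n ^ 4 ≡ n ^ (5 + 4 * (suc t * suc Δ))
    collect = trans (*-comm (n ^ (1 + 4 * (suc t * suc Δ))) (n ^ 4)) (trans (sym (^-distribˡ-+-* n 4 (1 + 4 * (suc t * suc Δ)))) (cong (n ^_) (+-suc 4 (4 * (suc t * suc Δ)))))

  -- In this regime q ≤ 5n² ≤ n⁴ ≤ 2^(4n), so 2 + 4n² halvings, a polynomial in `n` alone, outweigh
  -- the number of colourings.
  colourings-bound : ∀ {q d} → Δ ≤ n → q ≡ Δ + d → d < 4 * (Δ * Δ) → 4 * q ^ n ≤ 2 ^ (2 + 4 * n²)
  colourings-bound {q} {d} Δ≤n q≡ d< = begin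
    4 * q ^ n  ≤⟨ *-monoʳ-≤ 4 (^-monoˡ-≤ n q≤) ⟩
    4 * (2 ^ (4 * n)) ^ n  ≡⟨ cong (4 *_) (trans (^-*-assoc 2 (4 * n) n) (cong (2 ^_) (*-assoc 4 n n))) ⟩
    4 * 2 ^ (4 * n²)  ≡⟨ ^-distribˡ-+-* 2 2 (4 * n²) ⟨
    2 ^ (2 + 4 * n²)  ∎
    where
    open ≤-Reasoning
    q≤ : q ≤ 2 ^ (4 * n)
    q≤ = begin
      q  ≡⟨ q≡ ⟩
      Δ + d  ≤⟨ +-mono-≤ Δ≤n (≤-trans (<⇒≤ d<) (*-monoʳ-≤ 4 (*-mono-≤ Δ≤n Δ≤n))) ⟩
      n + 4 * n²  ≤⟨ +-monoˡ-≤ (4 * n²) (≤-trans (m≤m+n n (n + (n + 0))) 3n≤n²) ⟩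
      5 * n²  ≤⟨ *-monoˡ-≤ n² (≤-trans (m≤m+n 5 4) 9≤n²) ⟩
      n⁴  ≡⟨ n⁴≡ ⟩
      n ^ 4  ≤⟨ ^-monoˡ-≤ 4 (<⇒≤ (n<2^n n)) ⟩
      (2 ^ n) ^ 4  ≡⟨ trans (^-*-assoc 2 n 4) (cong (2 ^_) (*-comm n 4)) ⟩
      2 ^ (4 * n)  ∎

theorem1p2 : ∃[ C ] (∀ (n : ℕ) (G : Graph n) (Δ t q : ℕ) →
    MaxDegree G Δ → 3 ≤ Δ → Treewidth G t → 1 ≤ t → Δ + 2 ≤ q →
    MixingTimeAtMost G q (n ^ (C * t * Δ)))
theorem1p2 = 21 , mixing
  where
  mixing : ∀ (n : ℕ) (G : Graph n) (Δ t q : ℕ) → MaxDegree G Δ → 3 ≤ Δ → Treewidth G t → 1 ≤ t → Δ + 2 ≤ q →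
           MixingTimeAtMost G q (n ^ (21 * t * Δ))
  mixing n G Δ t q (degree≤ , v₀ , v₀-degree) 3≤Δ ((𝒟 , bags) , _) 1≤t Δ+2≤q = byRegime (4 * (Δ * Δ) ≤? d)
    where
    d : ℕ
    d = q ∸ Δ
    q≡ : q ≡ Δ + d
    q≡ = sym (m+[n∸m]≡n (≤-trans (m≤m+n Δ 2) Δ+2≤q))
    2≤d : 2 ≤ d
    2≤d = m+n≤o⇒m≤o∸n 2 (subst (_≤ q) (+-comm Δ 2) Δ+2≤q)
    1≤Δ : 1 ≤ Δ
    1≤Δ = ≤-trans (s≤s z≤n) 3≤Δ
    -- Some vertex attains degree Δ. This makes `q` polynomial in `n` in the second regime and, with
    -- `3 ≤ Δ`, makes `n` large enough for its powers to absorb numerical constants.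
    Δ≤n : Δ ≤ n
    Δ≤n = subst (_≤ n) v₀-degree (countV≤ n (adj G v₀))
    3≤n : 3 ≤ n
    3≤n = ≤-trans 3≤Δ Δ≤n
    1≤n : 1 ≤ n
    1≤n = ≤-trans (s≤s z≤n) 3≤n
    positive : ∀ {k} → 1 ≤ k → k ≡ suc (k ∸ 1)
    positive 1≤k = sym (m+[n∸m]≡n 1≤k)
    open Bounds n Δ t 3≤n 1≤Δ 1≤t
    byRegime : Dec (4 * (Δ * Δ) ≤ d) → MixingTimeAtMost G q (n ^ (21 * t * Δ))
    byRegime (yes large) = suc (n + n ∸ 1) * (2 + n) , subst (λ k → k * (2 + n) ≤ n ^ (21 * t * Δ)) 2n≡ dobrushin-time ,
      λ σ₀ p → tvDist≤¼ q G σ₀ (suc (n + n ∸ 1) * (2 + n)) (Dobrushin.Dobrushin-mixing q G 1≤n degree≤ q≡ 2≤d large 2n≡ {σ₀} p (2 + n)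
        (≤-trans (*-monoʳ-≤ 4 (<⇒≤ (n<2^n n))) (≤-reflexive (sym (^-distribˡ-+-* 2 2 n)))))
      where
      2n≡ : n + n ≡ suc (n + n ∸ 1)
      2n≡ = positive (≤-trans 1≤n (m≤m+n n n))
    byRegime (no small) with log₂ n 1≤n
    ... | l , 2^l≤n , n<2^[1+l] = suc (M ∸ 1) * r , subst (λ k → k * r ≤ n ^ (21 * t * Δ)) M≡ (l²-time l 2^l≤n) ,
      λ σ₀ p → tvDist≤¼ q G σ₀ (suc (M ∸ 1) * r) (L².Decay.L²-mixing q G 1≤n degree≤ q≡ 2≤d elim M≡ {σ₀} p r (colourings-bound Δ≤n q≡ (≰⇒> small)))
      where
      -- Bags have at most t + 1 vertices, and `n < 2 ^ suc l` calls for `suc l` halvings.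
      elim : Elim G (λ _ → true) (suc t * suc l)
      elim = Separation.elimination 𝒟 bags (suc l) (λ _ → true) (≤-<-trans (countV≤ n (λ _ → true)) n<2^[1+l])
      M r : ℕ
      M = n * (4 ^ suc Δ) ^ (suc t * suc l)
      r = 2 + 4 * n²
      M≡ : M ≡ suc (M ∸ 1)
      M≡ = positive (*-mono-≤ 1≤n (m^n>0 (4 ^ suc Δ) {{m^n≢0 4 (suc Δ)}} (suc t * suc l)))
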